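{- Let $\mathbf{X}$ be a represented space. The following are equivalent: 1. There exists a c.e. transitive relation $\prec\ \subseteq \mathbb{N}\times\mathbb{N}$ such that $\mathbf{X}$ is computably isomorphic to $\mathrm{RI}(\prec)$. 2. $\mathbf{X}$ is computably isomorphic to a $\Pi^0_2$-subspace of $\mathcal{O}(\mathbb{N})$. 3. $\mathbf{X}$ admits an effectively fiber-overt computably admissible representation $\delta$ such that $\mathrm{dom}(\delta)\subseteq\mathbb{N}^{\mathbb{N}}$ is $\Pi^0_2$.
   Context: A represented space $\mathbf{X}=(X,\delta_X)$ is a set $X$ with a partial surjection $\delta_X:\subseteq\mathbb{N}^{\mathbb{N}}\to X$ (if $\delta_X(p)=x$, $p$ is a name of $x$). A realizer of a partial multivalued function $f:\subseteq\mathbf{X}\rightrightarrows\mathbf{Y}$ is a partial $F:\subseteq\mathbb{N}^{\mathbb{N}}\to\mathbb{N}^{\mathbb{N}}$ with $\delta_Y(F(p))\in f(\delta_X(p))$ for all $p\in\mathrm{dom}(f\circ\delta_X)$; $f$ is computable (continuous) if it has a computable (continuous) realizer. A computable isomorphism is a computable bijection with computable inverse. That $\mathbf{X}$ admits a representation $\delta$ with given properties means that there is a representation $\delta$ of the set $X$ with these properties such that the identity between $(X,\delta_X)$ and $(X,\delta)$ is a computable isomorphism. A subspace of a represented space carries the restricted representation. Sierpinski space $\Sigma$ is $\{\top,\bot\}$ represented by $\delta_\Sigma:\mathbb{N}^{\mathbb{N}}\to\{\top,\bot\}$ with $\delta_\Sigma(p)=\bot$ iff $p=0^\omega$. $\mathcal{O}(\mathbf{X})$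 is the represented space of the open sets $U\subseteq X$ (those open in the final topology of $\delta_X$), each identified with its continuous characteristic function $\chi_U:\mathbf{X}\to\Sigma$ in the function space $\mathcal{C}(\mathbf{X},\Sigma)$ (represented via a universal machine with oracle, so that evaluation and currying are computable). In particular, $\mathcal{O}(\mathbb{N})$ is the set of all subsets of $\mathbb{N}$, represented by enumerations (with the Scott topology). $\mathcal{V}(\mathbf{X})$ is the represented space of closed subsets $A$ of $\mathbf{X}$, where $A$ is identified with $\{U\in\mathcal{O}(\mathbf{X})\mid U\cap A\neq\emptyset\}\in\mathcal{O}(\mathcal{O}(\mathbf{X}))$. For a transitive relation $\prec$ on $\mathbb{N}$, $I\subseteq\mathbb{N}$ is a rounded ideal if (i) $I\neq\emptyset$; (ii) $y\in I$ and $x\prec y$ imply $x\in I$; (iii) for all $x,y\in I$ there is $z\in I$ with $x\prec z$ and $y\prec z$. $\mathrm{RI}(\prec)\subseteq\mathcal{O}(\mathbb{N})$ is the subspace of all rounded ideals. A $\Pi^0_2$-subset (lightface) of $\mathbf{Z}=\mathcal{O}(\mathbb{N})$ or $\mathbf{Z}=\mathbb{N}^{\mathbb{N}}$ is a set of the form $\{z\mid\forall n\ (z\in U_n\Rightarrow z\in V_n)\}$ for computable sequences $(U_n)_n,(V_n)_n$ in $\mathcal{O}(\mathbf{Z})$. A representation $\delta$ of $\mathbf{X}$ is effectively fiber-overt if $x\mapsto\overline{\delta^{ -1}(\{x\})}:\mathbf{X}\to\mathcal{V}(\mathbb{N}^{\mathbb{N}})$ is computable. It is computably admissible if, for $\mathbf{X}=(X,\delta)$,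 the computable map $x\mapsto\{U\in\mathcal{O}(\mathbf{X})\mid x\in U\}:\mathbf{X}\to\mathcal{O}(\mathcal{O}(\mathbf{X}))$ is injective with computable partial inverse. -}

module Defs where

open import Level using (Level; 0ℓ; _⊔_) renaming (suc to lsuc)
open import Axiom.ExcludedMiddle using (ExcludedMiddle)
open import Data.Bool using (Bool; true; false; not; if_then_else_)
open import Data.Bool.Properties using (not-injective)
open import Data.Fin using (Fin)
open import Data.Nat using (ℕ; zero; suc; _+_; _*_; _≤_; _<_; z≤n; s≤s)
open import Data.Nat.Properties
open import Data.Product using (Σ; ∃; ∃₂; ∃-syntax; _×_; _,_; proj₁; proj₂)
open import Data.Sum using (inj₁; inj₂)
open import Data.Vec using (Vec; []; _∷_; lookup)
open import Function using (_∘_; id)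
open import Function.Bundles using (_⇔_; mk⇔; Equivalence; Inverse)
open import Function.Definitions using (Injective)
open import Relation.Binary using (REL; Rel; Setoid; tri<; tri≈; tri>)
open import Relation.Binary.PropositionalEquality
  using (_≡_; _≢_; _≗_; refl; sym; trans; cong; subst; setoid; _→-setoid_)
open import Relation.Nullary using (yes; no; ¬_; does; contradiction)
open import Relation.Nullary.Decidable using (decidable-stable; dec-true; dec-false)
open import Relation.Unary using (Pred)

private variable
  a b ℓ ℓ′ : Level
  k m n x y z : ℕ

Baire : Set
Baire = ℕ → ℕ

private variable p p′ q q′ r r′ : Baire

-- Partial recursive functions relative to an oracle.

data Prog : ℕ → Set where
  zero   : Prog n
  suc    : Prog 1
  proj   : Fin n → Prog n
  oracle : Prog 1
  comp   : Prog m → Vec (Prog n) m → Prog n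
  prec   : Prog n → Prog (2 + n) → Prog (suc n)
  min    : Prog (suc n) → Prog n

private variable
  e f g : Prog n
  gs    : Vec (Prog n) m
  xs    : Vec ℕ n

infix 4 _⊢_·_⇓_

-- p ⊢ e · xs ⇓ y : with oracle p, the program e halts on xs with result y.

data _⊢_·_⇓_ (p : Baire) : Prog n → Vec ℕ n → ℕ → Set where
  zero⇓   : p ⊢ zero · xs ⇓ 0
  suc⇓    : p ⊢ suc · x ∷ [] ⇓ suc x
  proj⇓   : (i : Fin n) → p ⊢ proj i · xs ⇓ lookup xs i
  oracle⇓ : p ⊢ oracle · x ∷ [] ⇓ p x
  comp⇓   : (ys : Vec ℕ m) →
            (∀ i → p ⊢ lookup gs i · xs ⇓ lookup ys i) →
            p ⊢ f · ys ⇓ z → p ⊢ comp f gs · xs ⇓ z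
  prec0⇓  : p ⊢ f · xs ⇓ z → p ⊢ prec f g · 0 ∷ xs ⇓ z
  precS⇓  : p ⊢ prec f g · x ∷ xs ⇓ y → p ⊢ g · x ∷ y ∷ xs ⇓ z →
            p ⊢ prec f g · suc x ∷ xs ⇓ z
  min⇓    : (∀ {x} → x < y → ∃[ z ] p ⊢ f · x ∷ xs ⇓ suc z) →
            p ⊢ f · y ∷ xs ⇓ 0 → p ⊢ min f · xs ⇓ y

-- The partial function on Baire space computed by a program with access to
-- its argument p as an oracle; p is in the domain iff every digit converges.

⟦_⟧ : Prog 1 → REL Baire Baire 0ℓ
⟦ e ⟧ p q = ∀ n → p ⊢ e · n ∷ [] ⇓ q n

-- Computably enumerable: the domain of a partial recursive function (the
-- constant oracle carries no information).

CE : Rel ℕ 0ℓ → Set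
CE _≺_ = ∃[ e ] (∀ x y → (x ≺ y) ⇔ (∃[ z ] (λ _ → 0) ⊢ e · x ∷ y ∷ [] ⇓ z))

-- ⟪ x , y ⟫ = 2ˣ(2y + 1)

⟪_,_⟫ : ℕ → ℕ → ℕ
⟪ zero  , y ⟫ = suc (2 * y)
⟪ suc x , y ⟫ = 2 * ⟪ x , y ⟫

-- q ↾ k codes the list of the first k digits of q, the last one first.

_↾_ : Baire → ℕ → ℕ
q ↾ zero  = 0
q ↾ suc k = ⟪ q k , q ↾ k ⟫

-- The universal oracle machine.  With oracle p, on input q, it determines the
-- n-th output digit by reading more and more of q, consulting p on n and the
-- part of q read so far: the answer 0 means "read on", and suc m means
-- "output m".  Every continuous partial function on Baire space extends to
-- some η p, and every computable one to η p for a computable p.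

η : Baire → REL Baire Baire 0ℓ
η p q r = ∀ n → ∃[ k ] p ⟪ n , q ↾ k ⟫ ≡ suc (r n)
                      × (∀ {j} → j < k → p ⟪ n , q ↾ j ⟫ ≡ 0)

infix 4 _≈[_]_

_≈[_]_ : Baire → ℕ → Baire → Set
p ≈[ k ] q = ∀ {i} → i < k → p i ≡ q i

-- Sets are setoids.  A representation is given by its graph: δ p x says that
-- p is a name of x.

record Representation (S : Setoid ℓ ℓ) : Set (lsuc ℓ) where
  no-eta-equality
  open Setoid S
  field
    δ          : Baire → Carrier → Set ℓ
    respects   : ∀ {p q x y} → p ≗ q → x ≈ y → δ p x → δ q y
    functional : ∀ {p x y} → δ p x → δ p y → x ≈ y
    surjective : ∀ x → ∃[ p ] δ p x

  dom : Pred Baire ℓ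
  dom p = ∃[ x ] δ p x

record RepresentedSpace (ℓ : Level) : Set (lsuc ℓ) where
  no-eta-equality
  field
    points         : Setoid ℓ ℓ
    representation : Representation points
  open Setoid points public using (Carrier; _≈_)
  open Representation representation public

  module ≈ = Setoid points

open RepresentedSpace using (Carrier)

-- A multivalued partial function f :⊆ X ⇉ Y is a relation, with domain
-- { x ∣ ∃ y. f x y }.  The realizers F used below are single-valued.

module _ (X : RepresentedSpace ℓ) (Y : RepresentedSpace ℓ′) where
  private
    module X = RepresentedSpace X
    module Y = RepresentedSpace Y

  IsRealizer : REL Baire Baire 0ℓ → REL X.Carrier Y.Carrier a → Set _
  IsRealizer F f = ∀ p x → X.δ p x → ∃ (f x) →
                   ∃[ q ] F p q × (∃[ y ] Y.δ q y × f x y)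

  Computable : REL X.Carrier Y.Carrier a → Set _
  Computable f = ∃[ e ] IsRealizer ⟦ e ⟧ f

  graph : (X.Carrier → Y.Carrier) → REL X.Carrier Y.Carrier ℓ′
  graph f x y = f x Y.≈ y

  ComputableMap : (X.Carrier → Y.Carrier) → Set _
  ComputableMap f = Computable (graph f)

infix 4 _≅_

_≅_ : RepresentedSpace ℓ → RepresentedSpace ℓ′ → Set _
X ≅ Y = Σ (Inverse X.points Y.points) λ φ →
        ComputableMap X Y (Inverse.to φ) × ComputableMap Y X (Inverse.from φ)
  where
  module X = RepresentedSpace X
  module Y = RepresentedSpace Y

subspace : (X : RepresentedSpace ℓ) → Pred (Carrier X) ℓ → RepresentedSpace ℓ
subspace X A = record
  { points = record
    { Carrier       = Σ X.Carrier A
    ; _≈_           = λ x y → proj₁ x X.≈ proj₁ y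
    ; isEquivalence = record
      { refl = X.≈.refl ; sym = X.≈.sym ; trans = X.≈.trans }
    }
  ; representation = record
    { δ          = λ p x → X.δ p (proj₁ x)
    ; respects   = X.respects
    ; functional = X.functional
    ; surjective = X.surjective ∘ proj₁
    }
  }
  where module X = RepresentedSpace X

ℕₛ : RepresentedSpace 0ℓ
ℕₛ = record
  { points         = setoid ℕ
  ; representation = record
    { δ          = λ p n → p 0 ≡ n
    ; respects   = λ { p≗q refl pn → trans (sym (p≗q 0)) pn }
    ; functional = λ { refl refl → refl }
    ; surjective = λ n → (λ _ → n) , refl
    }
  }

Baireₛ : RepresentedSpace 0ℓ
Baireₛ = record
  { points         = ℕ →-setoid ℕ
  ; representation = record
    { δ          = _≗_
    ; respects   = λ p≗q x≗y p≗x n → trans (sym (p≗q n)) (trans (p≗x n) (x≗y n))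
    ; functional = λ p≗x p≗y n → trans (sym (p≗x n)) (p≗y n)
    ; surjective = λ p → p , λ _ → refl
    }
  }

-- Sierpinski space, with ⊤ = true and ⊥ = false.

δΣ : Baire → Bool → Set
δΣ p b = b ≡ false ⇔ (∀ n → p n ≡ 0)

δΣ-respects : ∀ {p q b c} → p ≗ q → b ≡ c → δΣ p b → δΣ q c
δΣ-respects p≗q refl h = mk⇔
  (λ b n → trans (sym (p≗q n)) (Equivalence.to h b n))
  (λ q0 → Equivalence.from h λ n → trans (p≗q n) (q0 n))

δΣ-functional : ∀ {p} b c → δΣ p b → δΣ p c → b ≡ c
δΣ-functional true  true  _ _ = refl
δΣ-functional true  false h g = Equivalence.from h (Equivalence.to g refl)
δΣ-functional false true  h g = sym (Equivalence.from g (Equivalence.to h refl))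
δΣ-functional false false _ _ = refl

δΣ-surjective : ∀ b → ∃[ p ] δΣ p b
δΣ-surjective true  = (λ _ → 1) , mk⇔ (λ ()) (λ h → contradiction (h 0) λ ())
δΣ-surjective false = (λ _ → 0) , mk⇔ (λ _ _ → refl) (λ _ → refl)

Sierpinski : RepresentedSpace 0ℓ
Sierpinski = record
  { points         = setoid Bool
  ; representation = record
    { δ          = δΣ
    ; respects   = δΣ-respects
    ; functional = λ {_} {b} {c} → δΣ-functional b c
    ; surjective = δΣ-surjective
    }
  }

module _ (X : RepresentedSpace ℓ) where
  private module X = RepresentedSpace X

  -- Open in the final topology of δ: the preimage under δ is open in dom δ.

  IsOpen : Pred X.Carrier a → Set _
  IsOpen U = ∀ p x → X.δ p x → U x →
             ∃[ k ] (∀ q y → p ≈[ k ] q → X.δ q y → U y)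

  record OpenSet : Set ℓ where
    field
      χ      : X.Carrier → Bool
      χ-cong : ∀ {x y} → x X.≈ y → χ x ≡ χ y
      isOpen : IsOpen (λ x → χ x ≡ true)

  record ClosedSet : Set ℓ where
    field
      χ        : X.Carrier → Bool
      χ-cong   : ∀ {x y} → x X.≈ y → χ x ≡ χ y
      isClosed : IsOpen (λ x → χ x ≡ false)

open OpenSet using (χ)

infix 4 _∈ₒ_ _∈_

_∈ₒ_ : {X : RepresentedSpace ℓ} → Carrier X → OpenSet X → Set
x ∈ₒ U = χ U x ≡ true

_∈_ : {X : RepresentedSpace ℓ} → Carrier X → ClosedSet X → Set
x ∈ A = ClosedSet.χ A x ≡ true

⟪⟫-injective : ∀ x x′ {y y′} → ⟪ x , y ⟫ ≡ ⟪ x′ , y′ ⟫ → x ≡ x′ × y ≡ y′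
⟪⟫-injective zero zero {y} {y′} eq = refl , *-cancelˡ-≡ y y′ 2 (suc-injective eq)
⟪⟫-injective zero (suc x′) {y} {y′} eq =
  contradiction (sym eq) (even≢odd ⟪ x′ , y′ ⟫ y)
⟪⟫-injective (suc x) zero {y} {y′} eq =
  contradiction eq (even≢odd ⟪ x , y ⟫ y′)
⟪⟫-injective (suc x) (suc x′) {y} {y′} eq =
  let x≡x′ , y≡y′ = ⟪⟫-injective x x′ (*-cancelˡ-≡ ⟪ x , y ⟫ ⟪ x′ , y′ ⟫ 2 eq)
  in cong suc x≡x′ , y≡y′

⟪⟫≢0 : ∀ x y → ⟪ x , y ⟫ ≢ 0
⟪⟫≢0 zero    y ()
⟪⟫≢0 (suc x) y eq = ⟪⟫≢0 x y (*-cancelˡ-≡ ⟪ x , y ⟫ 0 2 eq)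

≈[]-snoc : ∀ k → q k ≡ r k → q ≈[ k ] r → q ≈[ suc k ] r
≈[]-snoc k qk≡rk q≈r (s≤s i≤k) with m≤n⇒m<n∨m≡n i≤k
... | inj₁ i<k  = q≈r i<k
... | inj₂ refl = qk≡rk

↾-injective : ∀ j k → q ↾ j ≡ r ↾ k → j ≡ k × q ≈[ j ] r
↾-injective zero zero _ = refl , λ ()
↾-injective {q} {r} zero (suc k) eq = contradiction (sym eq) (⟪⟫≢0 (r k) (r ↾ k))
↾-injective {q} {r} (suc j) zero eq = contradiction eq (⟪⟫≢0 (q j) (q ↾ j))
↾-injective {q} {r} (suc j) (suc k) eq
  with hd , tl ← ⟪⟫-injective (q j) (r k) eq
  with refl , q≈r ← ↾-injective {q} {r} j k tl = refl , ≈[]-snoc {q} {r} j hd q≈r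

first-unique : (f : ℕ → ℕ) → f m ≡ suc x → (∀ {j} → j < m → f j ≡ 0) →
               f n ≡ suc y → (∀ {j} → j < n → f j ≡ 0) → x ≡ y
first-unique {m} {n = n} f fm m-first fn n-first with <-cmp m n
... | tri< m<n _ _  = contradiction (trans (sym fm) (n-first m<n)) λ ()
... | tri≈ _ refl _ = suc-injective (trans (sym fm) fn)
... | tri> _ _ n<m  = contradiction (trans (sym fn) (m-first n<m)) λ ()

η-functional : ∀ p q {r r′} → η p q r → η p q r′ → r ≗ r′
η-functional p q h h′ n =
  let k , hk , k-first = h n
      k′ , hk′ , k′-first = h′ n
  in first-unique (λ j → p ⟪ n , q ↾ j ⟫) hk k-first hk′ k′-first

η-cong : ∀ q r → p ≗ p′ → η p q r → η p′ q r
η-cong q r p≗p′ h n =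
  let k , hk , k-first = h n
  in k , trans (sym (p≗p′ _)) hk , λ j<k → trans (sym (p≗p′ _)) (k-first j<k)

bound : (ℕ → ℕ) → ℕ → ℕ
bound f zero    = suc (f 0)
bound f (suc k) = bound f k + suc (f (suc k))

<-bound : ∀ (f : ℕ → ℕ) {j} k → j ≤ k → f j < bound f k
<-bound f zero    z≤n = ≤-refl
<-bound f (suc k) j≤1+k with m≤n⇒m<n∨m≡n j≤1+k
... | inj₁ (s≤s j≤k) = ≤-trans (<-bound f k j≤k) (m≤m+n _ _)
... | inj₂ refl      = m≤n+m _ (bound f k)

η-continuous : ∀ p q r → η p q r → ∀ n →
               ∃[ k ] (∀ p′ r′ → p ≈[ k ] p′ → η p′ q r′ → r n ≡ r′ n)
η-continuous p q r h n =
  let k , hk , k-first = h n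
      query j = ⟪ n , q ↾ j ⟫
  in bound query k , λ p′ r′ p≈p′ h′ →
     let k′ , hk′ , k′-first = h′ n
         same j j≤k = p≈p′ {query j} (<-bound query k j≤k)
     in first-unique (p′ ∘ query)
          (trans (sym (same k ≤-refl)) hk)
          (λ {j} j<k → trans (sym (same j (<⇒≤ j<k))) (k-first j<k))
          hk′ k′-first

-- Excluded middle is what makes every open set have a name
-- and every subset have a Bool-valued characteristic function.

module Classical (em : ∀ {ℓ} → ExcludedMiddle ℓ) where

  does-true : {P : Set a} → P → does (em {P = P}) ≡ true
  does-true = dec-true em

  does-false : {P : Set a} → ¬ P → does (em {P = P}) ≡ false
  does-false = dec-false em

  true-does : {P : Set a} → does (em {P = P}) ≡ true → P
  true-does {P = P} eq with em {P = P}
  ... | yes h = h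

  false-does : {P : Set a} → does (em {P = P}) ≡ false → ¬ P
  false-does {P = P} eq with em {P = P}
  ... | no ¬h = ¬h

  does-⇔ : {P : Set a} {Q : Set b} → (P → Q) → (Q → P) →
           does (em {P = P}) ≡ does (em {P = Q})
  does-⇔ {P = P} {Q} f g with em {P = P} | em {P = Q}
  ... | yes _ | yes _ = refl
  ... | yes h | no ¬h = contradiction (f h) ¬h
  ... | no ¬h | yes h = contradiction (g h) ¬h
  ... | no _  | no _  = refl

  true-iff : {b c : Bool} → (b ≡ true → c ≡ true) → (c ≡ true → b ≡ true) → b ≡ c
  true-iff {true}  {_}     f _ = sym (f refl)
  true-iff {false} {true}  _ g = g refl
  true-iff {false} {false} _ _ = refl

  module _ (X : RepresentedSpace ℓ) where
    private module X = RepresentedSpace X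

    -- A name of U is an oracle with which the universal machine realizes the
    -- characteristic function of U.

    δ𝒪 : Baire → OpenSet X → Set ℓ
    δ𝒪 p U = IsRealizer X Sierpinski (η p) (graph X Sierpinski (χ U))

    infix 4 _≈𝒪_

    _≈𝒪_ : Rel (OpenSet X) ℓ
    U ≈𝒪 V = ∀ x → χ U x ≡ χ V x

    δ𝒪-elim : ∀ p U → δ𝒪 p U → ∀ q x → X.δ q x → ∃[ r ] η p q r × δΣ r (χ U x)
    δ𝒪-elim p U h q x qx with r , pqr , _ , ry , refl ← h q x qx (_ , refl) =
      r , pqr , ry

    δ𝒪-intro : ∀ p U → (∀ q x → X.δ q x → ∃[ r ] η p q r × δΣ r (χ U x)) → δ𝒪 p U
    δ𝒪-intro p U h q x qx _ =
      let r , pqr , ry = h q x qx in r , pqr , χ U x , ry , refl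

    module _ (U : OpenSet X) where
      private
        Inside : Baire → ℕ → Set ℓ
        Inside q n = ∀ q′ y → q ≈[ n ] q′ → X.δ q′ y → y ∈ₒ U

        digit : Baire → Baire
        digit q n = if does (em {P = Inside q n}) then 1 else 0

        Query : ℕ → Set
        Query c = ∃₂ λ n q → c ≡ ⟪ n , q ↾ n ⟫

      -- The n-th output digit depends on the first n input digits only, and
      -- is 1 iff these guarantee membership in U.
      name : Baire
      name c with em {P = Query c}
      ... | yes (n , q , _) = suc (digit q n)
      ... | no  _           = 0

      private
        digit-local : ∀ q q′ n → q ≈[ n ] q′ → digit q n ≡ digit q′ n
        digit-local q q′ n q≈q′ = cong (if_then 1 else 0) (does-⇔
          (λ h s y q′≈s → h s y λ i<n → trans (q≈q′ i<n) (q′≈s i<n))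
          (λ h s y q≈s → h s y λ i<n → trans (sym (q≈q′ i<n)) (q≈s i<n)))

        name-hit : ∀ q n → name ⟪ n , q ↾ n ⟫ ≡ suc (digit q n)
        name-hit q n with em {P = Query ⟪ n , q ↾ n ⟫}
        ... | no ¬h = contradiction (n , q , refl) ¬h
        ... | yes (n′ , q′ , eq)
          with refl , eq′ ← ⟪⟫-injective n n′ eq
          with _ , q≈q′ ← ↾-injective {q} {q′} n n eq′ =
          cong suc (sym (digit-local q q′ n q≈q′))

        name-miss : ∀ q n {j} → j < n → name ⟪ n , q ↾ j ⟫ ≡ 0
        name-miss q n {j} j<n with em {P = Query ⟪ n , q ↾ j ⟫}
        ... | no _ = refl
        ... | yes (n′ , q′ , eq)
          with refl , eq′ ← ⟪⟫-injective n n′ eq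
          with refl , _ ← ↾-injective {q} {q′} j n eq′ =
          contradiction j<n (<-irrefl refl)

        digit-correct : ∀ q x → X.δ q x → δΣ (digit q) (χ U x)
        digit-correct q x qx = mk⇔ out in′
          where
          out : χ U x ≡ false → ∀ n → digit q n ≡ 0
          out x∉U n = cong (if_then 1 else 0) (does-false λ ins →
            contradiction (trans (sym (ins q x (λ _ → refl) qx)) x∉U) λ ())
          in′ : (∀ n → digit q n ≡ 0) → χ U x ≡ false
          in′ h with χ U x in x∈U
          ... | false = refl
          ... | true  =
            let k , ins = OpenSet.isOpen U q x qx x∈U
            in contradiction
                 (trans (sym (cong (if_then 1 else 0) (does-true ins))) (h k))
                 λ ()

      name-names : δ𝒪 name U
      name-names = δ𝒪-intro name U λ q x qx →
        digit q , (λ n → n , name-hit q n , name-miss q n) , digit-correct q x qx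

    δ𝒪-respects : ∀ p q U V → p ≗ q → U ≈𝒪 V → δ𝒪 p U → δ𝒪 q V
    δ𝒪-respects p q U V p≗q U≈V pU = δ𝒪-intro q V λ s x sx →
      let r , psr , rx = δ𝒪-elim p U pU s x sx
      in r , η-cong s r p≗q psr , subst (δΣ r) (U≈V x) rx

    δ𝒪-functional : ∀ p U V → δ𝒪 p U → δ𝒪 p V → U ≈𝒪 V
    δ𝒪-functional p U V pU pV x =
      let q , qx       = X.surjective x
          r , pqr , rx = δ𝒪-elim p U pU q x qx
          s , pqs , sx = δ𝒪-elim p V pV q x qx
      in δΣ-functional {s} (χ U x) (χ V x)
           (δΣ-respects (η-functional p q pqr pqs) refl rx) sx

    𝒪 : RepresentedSpace ℓ
    𝒪 = record
      { points = record
        { Carrier       = OpenSet X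
        ; _≈_           = _≈𝒪_
        ; isEquivalence = record
          { refl  = λ _ → refl
          ; sym   = λ U≈V x → sym (U≈V x)
          ; trans = λ U≈V V≈W x → trans (U≈V x) (V≈W x)
          }
        }
      ; representation = record
        { δ          = δ𝒪
        ; respects   = λ {p} {q} {U} {V} → δ𝒪-respects p q U V
        ; functional = λ {p} {U} {V} → δ𝒪-functional p U V
        ; surjective = λ U → name U , name-names U
        }
      }

  module _ (X : RepresentedSpace ℓ) where
    private
      module X = RepresentedSpace X

      positive : ∀ b s n → δΣ s b → s n ≢ 0 → b ≡ true
      positive true  s n _  _    = refl
      positive false s n sb sn≢0 = contradiction (Equivalence.to sb refl n) sn≢0

      nonzero : ∀ b s → δΣ s b → b ≡ true → ∃[ n ] s n ≢ 0
      nonzero b s sb refl = decidable-stable em λ none →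
        contradiction
          (Equivalence.from sb λ n → decidable-stable (s n ≟ 0) λ sn≢0 →
            none (n , sn≢0))
          λ ()

    -- If p names U and x ∈ U, a finite part of p already guarantees x ∈ U.
    membership-open : ∀ x → IsOpen (𝒪 X) (λ U → x ∈ₒ U)
    membership-open x p U pU x∈U =
      let q , qx       = X.surjective x
          r , pqr , rx = δ𝒪-elim X p U pU q x qx
          n , rn≢0     = nonzero (χ U x) r rx x∈U
          k , local    = η-continuous p q r pqr n
      in k , λ p′ V p≈p′ p′V →
        let s , p′qs , sx = δ𝒪-elim X p′ V p′V q x qx
        in positive (χ V x) s n sx λ sn≡0 →
             rn≢0 (trans (local p′ s p≈p′ p′qs) sn≡0)

    -- { U ∣ x ∈ U }
    nbhds : X.Carrier → OpenSet (𝒪 X)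
    nbhds x = record
      { χ      = λ U → χ U x
      ; χ-cong = λ U≈V → U≈V x
      ; isOpen = membership-open x
      }

    Meets : ClosedSet X → OpenSet X → Set ℓ
    Meets A U = ∃[ x ] x ∈ₒ U × x ∈ A

    Meets-resp : ∀ A U V → _≈𝒪_ X U V → Meets A U → Meets A V
    Meets-resp A U V U≈V (x , x∈U , x∈A) = x , trans (sym (U≈V x)) x∈U , x∈A

    -- { U ∣ U ∩ A ≠ ∅ }
    hits : ClosedSet X → OpenSet (𝒪 X)
    hits A = record
      { χ      = λ U → does (em {P = Meets A U})
      ; χ-cong = λ {U} {V} U≈V → does-⇔
          (Meets-resp A U V U≈V) (Meets-resp A V U λ x → sym (U≈V x))
      ; isOpen = λ p U pU hit →
          let x , x∈U , x∈A = true-does {P = Meets A U} hit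
              k , local     = membership-open x p U pU x∈U
          in k , λ q V p≈q qV →
               does-true {P = Meets A V} (x , local q V p≈q qV , x∈A)
      }

    infix 4 _≈𝒱_

    _≈𝒱_ : Rel (ClosedSet X) ℓ
    A ≈𝒱 B = ∀ x → ClosedSet.χ A x ≡ ClosedSet.χ B x

    δ𝒱 : Baire → ClosedSet X → Set ℓ
    δ𝒱 p A = δ𝒪 (𝒪 X) p (hits A)

    hits-resp : ∀ A B → A ≈𝒱 B → _≈𝒪_ (𝒪 X) (hits A) (hits B)
    hits-resp A B A≈B U = does-⇔
      (λ (x , x∈U , x∈A) → x , x∈U , trans (sym (A≈B x)) x∈A)
      (λ (x , x∈U , x∈B) → x , x∈U , trans (A≈B x) x∈B)

    complement : ClosedSet X → OpenSet X
    complement A = record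
      { χ      = λ x → not (ClosedSet.χ A x)
      ; χ-cong = λ x≈y → cong not (ClosedSet.χ-cong A x≈y)
      ; isOpen = λ p x px x∉A →
          let k , h = ClosedSet.isClosed A p x px (not-injective x∉A)
          in k , λ q y p≈q qy → cong not (h q y p≈q qy)
      }

    hits-⊆ : ∀ A B → _≈𝒪_ (𝒪 X) (hits A) (hits B) → ∀ x → x ∈ A → x ∈ B
    hits-⊆ A B A≈B x x∈A with ClosedSet.χ B x in x∉B
    ... | true  = refl
    ... | false =
      let y , y∉B , y∈B = true-does {P = Meets B (complement B)}
            (trans (sym (A≈B (complement B)))
              (does-true {P = Meets A (complement B)} (x , cong not x∉B , x∈A)))
      in contradiction (trans (sym y∈B) (not-injective y∉B)) λ ()

    hits-injective : ∀ A B → _≈𝒪_ (𝒪 X) (hits A) (hits B) → A ≈𝒱 B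
    hits-injective A B A≈B x =
      true-iff (hits-⊆ A B A≈B x) (hits-⊆ B A (λ U → sym (A≈B U)) x)

    𝒱 : RepresentedSpace ℓ
    𝒱 = record
      { points = record
        { Carrier       = ClosedSet X
        ; _≈_           = _≈𝒱_
        ; isEquivalence = record
          { refl  = λ _ → refl
          ; sym   = λ A≈B x → sym (A≈B x)
          ; trans = λ A≈B B≈C x → trans (A≈B x) (B≈C x)
          }
        }
      ; representation = record
        { δ          = δ𝒱
        ; respects   = λ {p} {q} {A} {B} p≗q A≈B →
            δ𝒪-respects (𝒪 X) p q (hits A) (hits B) p≗q (hits-resp A B A≈B)
        ; functional = λ {p} {A} {B} pA pB → hits-injective A B
            (δ𝒪-functional (𝒪 X) p (hits A) (hits B) pA pB)
        ; surjective = λ A → name (𝒪 X) (hits A) , name-names (𝒪 X) (hits A)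
        }
      }

    Adherent : Pred X.Carrier a → X.Carrier → Set (ℓ ⊔ a)
    Adherent S x = ∀ (U : OpenSet X) → x ∈ₒ U → ∃[ y ] S y × y ∈ₒ U

    private
      Adherent-resp : (S : Pred X.Carrier a) → ∀ {x y} → x X.≈ y →
                      Adherent S x → Adherent S y
      Adherent-resp S x≈y h U y∈U = h U (trans (OpenSet.χ-cong U x≈y) y∈U)

      separated : (S : Pred X.Carrier a) → ∀ x → ¬ Adherent S x →
                  ∃[ U ] x ∈ₒ U × ¬ (∃[ y ] S y × y ∈ₒ U)
      separated S x ¬h = decidable-stable em λ none →
        ¬h λ U x∈U → decidable-stable em λ ¬y → none (U , x∈U , ¬y)

    closure : Pred X.Carrier a → ClosedSet X
    closure S = record
      { χ        = λ x → does (em {P = Adherent S x})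
      ; χ-cong   = λ x≈y → does-⇔
          (Adherent-resp S x≈y) (Adherent-resp S (X.≈.sym x≈y))
      ; isClosed = λ p x px x∉ →
          let U , x∈U , disjoint = separated S x (false-does {P = Adherent S x} x∉)
              k , inU            = OpenSet.isOpen U p x px x∈U
          in k , λ q y p≈q qy → does-false {P = Adherent S y} λ h →
               disjoint (h U (inU q y p≈q qy))
      }

  RoundedIdeal : Rel ℕ 0ℓ → Pred (OpenSet ℕₛ) 0ℓ
  RoundedIdeal _≺_ I =
      (∃[ x ] x ∈ₒ I)
    × (∀ {x y} → y ∈ₒ I → x ≺ y → x ∈ₒ I)
    × (∀ {x y} → x ∈ₒ I → y ∈ₒ I → ∃[ z ] z ∈ₒ I × x ≺ z × y ≺ z)

  RI : Rel ℕ 0ℓ → RepresentedSpace 0ℓ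
  RI _≺_ = subspace (𝒪 ℕₛ) (RoundedIdeal _≺_)

  IsΠ⁰₂ : (Z : RepresentedSpace ℓ) → Pred (Carrier Z) a → Set _
  IsΠ⁰₂ Z A = ∃₂ λ (U V : ℕ → OpenSet Z) →
      ComputableMap ℕₛ (𝒪 Z) U
    × ComputableMap ℕₛ (𝒪 Z) V
    × (∀ z → A z ⇔ (∀ n → z ∈ₒ U n → z ∈ₒ V n))

  EffectivelyFiberOvert : RepresentedSpace ℓ → Set _
  EffectivelyFiberOvert X =
    ComputableMap X (𝒱 Baireₛ) λ x → closure Baireₛ (λ p → X.δ p x)
    where module X = RepresentedSpace X

  ComputablyAdmissible : RepresentedSpace ℓ → Set _
  ComputablyAdmissible X =
      Injective X._≈_ 𝒪𝒪._≈_ (nbhds X)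
    × Computable (𝒪 (𝒪 X)) X (λ 𝒰 x → nbhds X x 𝒪𝒪.≈ 𝒰)
    where
    module X  = RepresentedSpace X
    module 𝒪𝒪 = RepresentedSpace (𝒪 (𝒪 X))

  -- X admits a representation ρ with property P.
  Admits : (X : RepresentedSpace ℓ) → (RepresentedSpace ℓ → Set a) → Set _
  Admits X P = ∃[ ρ ] let X′ = record { points = X.points ; representation = ρ } in
    ComputableMap X X′ id × ComputableMap X′ X id × P X′
    where module X = RepresentedSpace X

{-# OPTIONS --safe #-}
module Submission where

-- A semidecidable relation R on X × Z is the same as a computable map from X to
-- the open subsets of Z, because a run of an oracle machine only sees finite
-- parts of the names of x and z and can be simulated on these.
--
-- (1) ⇒ (2): each clause in the definition of a rounded ideal of a c.e. relation
-- has the form "U n implies V n" for all n.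
--
-- (2) ⇒ (1): for A = { x ∣ x ∈ U n implies x ∈ V n for all n } put w ≺ v, for
-- codes w, v of finite sets, if w < v, F w ⊆ F v and for n < w, whenever F w is
-- seen to be in U n by stage w, F v is seen to be in V n by stage v.  Then
-- x ↦ { w ∣ F w ⊆ x } maps A onto the rounded ideals, with inverse the union.
--
-- (2) ⇒ (3): name x by the enumerations of its image in A.  An open subset of
-- Baire space meets the fibre of x iff it contains an eventually constant
-- sequence that enumerates elements of the image only.
--
-- (3) ⇒ (2): send x to the set S of strings that are prefixes of names of x.
-- The sets S that arise are characterised by Π⁰₂ conditions: given such an S, a
-- generic path through S is in the domain, and it names a point whose set of
-- prefixes is S.  The point is recovered from S by admissibility, as x ∈ U iff
-- some string in S is accepted by U.

open import Defs
open import Level using (Level; 0ℓ; _⊔_; Lift; lift)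
open import Axiom.ExcludedMiddle using (ExcludedMiddle)
open import Data.Bool using (true; false)
open import Data.Fin using (Fin; zero; suc)
open import Data.Nat
  using (ℕ; zero; suc; pred; _+_; _*_; _∸_; _≤_; _<_; z≤n; s≤s; ⌊_/2⌋; ⌈_/2⌉; _≟_; _<?_)
open import Data.Nat.Induction using (<-rec)
open import Data.Nat.Properties
open import Data.Product using (Σ; ∃₂; ∃-syntax; _×_; _,_; proj₁; proj₂)
open import Data.Product.Relation.Binary.Pointwise.NonDependent using (×-setoid)
open import Data.Sum using (_⊎_; inj₁; inj₂)
open import Data.Vec using (Vec; []; _∷_; lookup; head; tail; tabulate)
open import Data.Vec.Properties using (lookup∘tabulate)
open import Function using (_∘_; id; const)
open import Function.Bundles using (_⇔_; mk⇔; Equivalence; Inverse)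
open import Function.Construct.Composition using (inverse)
import Function.Construct.Identity as Identity
open import Relation.Binary using (Rel; Transitive; tri<; tri≈; tri>)
open import Relation.Binary.PropositionalEquality hiding ([_])
open import Relation.Nullary using (yes; no; ¬_; contradiction; does)
open import Relation.Nullary.Decidable using (decidable-stable)
open import Relation.Unary using (Pred; _∩_)

open RepresentedSpace using (Carrier)

-- Every claim of computability has to be backed by a concrete `Prog`. `Total` assembles total
-- oracle functions; `Map` and `SemiDec` then assemble realizers and acceptors, so that later
-- arguments hardly mention programs. The link is `ev`: it recurs on a fixed program, so programs
-- need not be coded by numbers, and each `ev e` is itself a total computable function of a string
-- and the arguments. On the way from Π⁰₂ sets to ideals, `w < v` drives the codes in an ideal to
-- infinity, so that every n is eventually below some of them, while the bound `n < w` and the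
-- stages keep the relation decidable. On the way from representations to sets of strings, no point
-- is given in advance. A path in the domain could name a point that touches fewer or more strings
-- than S contains; `Accepting` rules out the former and `Saturated` the latter.

private variable
  a b ℓ ℓ′ ℓ″ : Level
  j k m n x y z : ℕ
  p q : Baire
  P Q : ℕ → Set a
  W X Y Z : RepresentedSpace ℓ

-- Determinism and relativization of oracle programs

lookup-injective : {A : Set} (xs ys : Vec A n) → (∀ i → lookup xs i ≡ lookup ys i) → xs ≡ ys
lookup-injective []       []       _ = refl
lookup-injective (x ∷ xs) (y ∷ ys) h =
  cong₂ _∷_ (h zero) (lookup-injective xs ys (h ∘ suc))

⇓-functional : {e : Prog n} {xs : Vec ℕ n} → p ⊢ e · xs ⇓ y → p ⊢ e · xs ⇓ z → y ≡ z
⇓-functional zero⇓ zero⇓ = refl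
⇓-functional suc⇓ suc⇓ = refl
⇓-functional (proj⇓ i) (proj⇓ .i) = refl
⇓-functional oracle⇓ oracle⇓ = refl
⇓-functional (comp⇓ ys gs⇓ f⇓) (comp⇓ zs gs⇓′ f⇓′)
  with refl ← lookup-injective ys zs (λ i → ⇓-functional (gs⇓ i) (gs⇓′ i)) = ⇓-functional f⇓ f⇓′
⇓-functional (prec0⇓ f⇓) (prec0⇓ f⇓′) = ⇓-functional f⇓ f⇓′
⇓-functional (precS⇓ h⇓ g⇓) (precS⇓ h⇓′ g⇓′)
  with refl ← ⇓-functional h⇓ h⇓′ = ⇓-functional g⇓ g⇓′
⇓-functional {y = y} {z = z} (min⇓ below f⇓) (min⇓ below′ f⇓′) with <-cmp y z
... | tri< y<z _ _ = contradiction (⇓-functional f⇓ (proj₂ (below′ y<z))) λ ()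
... | tri≈ _ y≡z _ = y≡z
... | tri> _ _ z<y = contradiction (⇓-functional f⇓′ (proj₂ (below z<y))) λ ()

-- This is composition of realizers: each oracle query is replaced by a run of `s`, which recomputes
-- the requested digit of the intermediate name.
relativize  : Prog n → Prog 1 → Prog n
relativize* : Vec (Prog n) m → Prog 1 → Vec (Prog n) m
relativize zero        s = zero
relativize suc         s = suc
relativize (proj i)    s = proj i
relativize oracle      s = s
relativize (comp f gs) s = comp (relativize f s) (relativize* gs s)
relativize (prec f g)  s = prec (relativize f s) (relativize g s)
relativize (min f)     s = min (relativize f s)
relativize* []       s = []
relativize* (g ∷ gs) s = relativize g s ∷ relativize* gs s

lookup-relativize : (gs : Vec (Prog n) m) (s : Prog 1) (i : Fin m) →
                    lookup (relativize* gs s) i ≡ relativize (lookup gs i) s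
lookup-relativize (g ∷ gs) s zero    = refl
lookup-relativize (g ∷ gs) s (suc i) = lookup-relativize gs s i

module _ {p q : Baire} {s : Prog 1} (s⇓ : ⟦ s ⟧ p q) where

  relativize⁺ : {e : Prog n} {xs : Vec ℕ n} → q ⊢ e · xs ⇓ y → p ⊢ relativize e s · xs ⇓ y
  relativize⁺ zero⇓ = zero⇓
  relativize⁺ suc⇓ = suc⇓
  relativize⁺ (proj⇓ i) = proj⇓ i
  relativize⁺ oracle⇓ = s⇓ _
  relativize⁺ {e = comp f gs} {xs} (comp⇓ ys gs⇓ f⇓) = comp⇓ ys
    (λ i → subst (λ g → p ⊢ g · xs ⇓ lookup ys i) (sym (lookup-relativize gs s i))
             (relativize⁺ (gs⇓ i)))
    (relativize⁺ f⇓)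
  relativize⁺ (prec0⇓ f⇓) = prec0⇓ (relativize⁺ f⇓)
  relativize⁺ (precS⇓ h⇓ g⇓) = precS⇓ (relativize⁺ h⇓) (relativize⁺ g⇓)
  relativize⁺ (min⇓ below f⇓) =
    min⇓ (λ x<y → let z , h = below x<y in z , relativize⁺ h) (relativize⁺ f⇓)

  -- Needed for preimages of semidecidable relations, where halting must be reflected as well. At a
  -- query, determinism identifies the result of `s` with the digit of `q`. The recursion is on `e`,
  -- because `relativize e s` reduces only when `e` is known.
  relativize⁻  : (e : Prog n) {xs : Vec ℕ n} → p ⊢ relativize e s · xs ⇓ y → q ⊢ e · xs ⇓ y
  relativize⁻* : (gs : Vec (Prog n) m) {xs : Vec ℕ n} (ys : Vec ℕ m) →
                 (∀ i → p ⊢ lookup (relativize* gs s) i · xs ⇓ lookup ys i) →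
                 ∀ i → q ⊢ lookup gs i · xs ⇓ lookup ys i
  relativize⁻ zero zero⇓ = zero⇓
  relativize⁻ suc suc⇓ = suc⇓
  relativize⁻ (proj i) (proj⇓ i) = proj⇓ i
  relativize⁻ oracle {x ∷ []} h =
    subst (q ⊢ oracle · x ∷ [] ⇓_) (⇓-functional (s⇓ x) h) oracle⇓
  relativize⁻ (comp f gs) (comp⇓ ys gs⇓ f⇓) =
    comp⇓ ys (relativize⁻* gs ys gs⇓) (relativize⁻ f f⇓)
  relativize⁻ (prec f g) (prec0⇓ f⇓) = prec0⇓ (relativize⁻ f f⇓)
  relativize⁻ (prec f g) (precS⇓ h⇓ g⇓) =
    precS⇓ (relativize⁻ (prec f g) h⇓) (relativize⁻ g g⇓)
  relativize⁻ (min f) (min⇓ below f⇓) =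
    min⇓ (λ x<y → let z , h = below x<y in z , relativize⁻ f h) (relativize⁻ f f⇓)
  relativize⁻* (g ∷ gs) (_ ∷ ys) gs⇓ zero    = relativize⁻ g (gs⇓ zero)
  relativize⁻* (g ∷ gs) (_ ∷ ys) gs⇓ (suc i) = relativize⁻* gs ys (gs⇓ ∘ suc) i

-- Total oracle computations

record Total (F : Baire → Vec ℕ n → ℕ) : Set where
  constructor total
  field
    program : Prog n
    correct : ∀ p xs → p ⊢ program · xs ⇓ F p xs

record Totals (G : Baire → Vec ℕ n → Vec ℕ m) : Set where
  constructor totals
  field
    programs : Vec (Prog n) m
    correct  : ∀ p xs i → p ⊢ lookup programs i · xs ⇓ lookup (G p xs) i

open Total
open Totals

private variable
  B F H N : Baire → Vec ℕ n → ℕ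
  G : Baire → Vec ℕ n → Vec ℕ m

Total-≗ : (∀ p xs → F p xs ≡ H p xs) → Total F → Total H
Total-≗ F≗H (total e e⇓) = total e λ p xs → subst (p ⊢ e · xs ⇓_) (F≗H p xs) (e⇓ p xs)

[]ᵗ : Totals {n} (λ p xs → [])
[]ᵗ = totals [] λ p xs ()

infixr 5 _∷ᵗ_

_∷ᵗ_ : Total F → Totals G → Totals (λ p xs → F p xs ∷ G p xs)
total e e⇓ ∷ᵗ totals es es⇓ =
  totals (e ∷ es) λ { p xs zero → e⇓ p xs ; p xs (suc i) → es⇓ p xs i }

app : {F : Baire → Vec ℕ m → ℕ} → Total F → Totals {n} G → Total (λ p xs → F p (G p xs))
app {G = G} (total e e⇓) (totals es es⇓) =
  total (comp e es) λ p xs → comp⇓ (G p xs) (es⇓ p xs) (e⇓ p (G p xs))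

idᵗ : Totals {n} (λ p xs → xs)
idᵗ = totals (tabulate proj) λ p xs i →
  subst (λ e → p ⊢ e · xs ⇓ lookup xs i) (sym (lookup∘tabulate proj i)) (proj⇓ i)

tailᵗ : {G : Baire → Vec ℕ n → Vec ℕ (suc m)} → Totals G → Totals (λ p xs → tail (G p xs))
tailᵗ {G = G} (totals (e ∷ es) es⇓) = totals es λ p xs i →
  subst (p ⊢ lookup es i · xs ⇓_) (lookup-tail (G p xs) i) (es⇓ p xs (suc i))
  where
  lookup-tail : (ys : Vec ℕ (suc m)) (i : Fin m) → lookup ys (suc i) ≡ lookup (tail ys) i
  lookup-tail (_ ∷ _) i = refl

var : (i : Fin n) → Total (λ p xs → lookup xs i)
var i = total (proj i) λ p xs → proj⇓ i

v₀ : Total {suc n} (λ p xs → lookup xs zero)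
v₀ = var zero
v₁ : Total {suc (suc n)} (λ p xs → lookup xs (suc zero))
v₁ = var (suc zero)
v₂ : Total {suc (suc (suc n))} (λ p xs → lookup xs (suc (suc zero)))
v₂ = var (suc (suc zero))
v₃ : Total {suc (suc (suc (suc n)))} (λ p xs → lookup xs (suc (suc (suc zero))))
v₃ = var (suc (suc (suc zero)))

query : Total F → Total (λ p xs → p (F p xs))
query {F = F} (total e e⇓) = total (comp oracle (e ∷ []))
  λ p xs → comp⇓ (F p xs ∷ []) (λ { zero → e⇓ p xs }) oracle⇓

sucᵗ : Total F → Total (λ p xs → suc (F p xs))
sucᵗ {F = F} (total e e⇓) = total (comp suc (e ∷ []))
  λ p xs → comp⇓ (F p xs ∷ []) (λ { zero → e⇓ p xs }) suc⇓

lit : ∀ c → Total {n} (λ p xs → c)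
lit zero    = total zero λ p xs → zero⇓
lit (suc c) = sucᵗ (lit c)

natrec : ℕ → (ℕ → ℕ → ℕ) → ℕ → ℕ
natrec b s zero    = b
natrec b s (suc n) = s n (natrec b s n)

rec : {S : Baire → Vec ℕ (suc (suc n)) → ℕ} → Total B → Total S → Total N →
      Total (λ p xs → natrec (B p xs) (λ i a → S p (i ∷ a ∷ xs)) (N p xs))
rec {n} {B} {N = N} {S} (total b b⇓) (total s s⇓) N′ =
  app (total {F = run} (prec b s) prec⇓) (N′ ∷ᵗ idᵗ)
  where
  run : Baire → Vec ℕ (suc n) → ℕ
  run p ys = natrec (B p (tail ys)) (λ i a → S p (i ∷ a ∷ tail ys)) (head ys)
  prec⇓ : ∀ p ys → p ⊢ prec b s · ys ⇓ run p ys
  prec⇓ p (zero ∷ xs)  = prec0⇓ (b⇓ p xs)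
  prec⇓ p (suc i ∷ xs) = precS⇓ (prec⇓ p (i ∷ xs)) (s⇓ p _)

nonzero-suc : ∀ n → n ≢ 0 → ∃[ k ] n ≡ suc k
nonzero-suc zero    n≢0 = contradiction refl n≢0
nonzero-suc (suc n) _   = n , refl

μᵗ : {T : Baire → Vec ℕ (suc n) → ℕ} → Total T → (F : Baire → Vec ℕ n → ℕ) →
     (∀ p xs → T p (F p xs ∷ xs) ≡ 0) →
     (∀ p xs {y} → y < F p xs → T p (y ∷ xs) ≢ 0) → Total F
μᵗ {T = T} (total e e⇓) F hit miss = total (min e) λ p xs → min⇓
  (λ {x} x<y → let z , eq = nonzero-suc (T p (x ∷ xs)) (miss p xs x<y)
               in z , subst (p ⊢ e · x ∷ xs ⇓_) eq (e⇓ p (x ∷ xs)))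
  (subst (p ⊢ e · F p xs ∷ xs ⇓_) (hit p xs) (e⇓ p (F p xs ∷ xs)))

relativizeᵗ : {F : Baire → Vec ℕ n → ℕ} {Q : Baire → Vec ℕ 1 → ℕ} → Total F → Total Q →
              Total (λ p xs → F (λ i → Q p (i ∷ [])) xs)
relativizeᵗ (total e e⇓) (total s s⇓) = total (relativize e s) λ p xs →
  relativize⁺ (λ n → s⇓ p (n ∷ [])) (e⇓ _ xs)

-- Arithmetic and the decoding of pairs

record Total₁ (f : ℕ → ℕ) : Set where
  constructor total₁
  field unary : Total {1} λ _ xs → f (lookup xs zero)

record Total₂ (f : ℕ → ℕ → ℕ) : Set where
  constructor total₂
  field binary : Total {2} λ _ xs → f (lookup xs zero) (lookup xs (suc zero))

open Total₁
open Total₂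

call₁ : {f : ℕ → ℕ} → Total₁ f → Total F → Total (λ p xs → f (F p xs))
call₁ f F = app (unary f) (F ∷ᵗ []ᵗ)

call₂ : {f : ℕ → ℕ → ℕ} → Total₂ f → Total F → Total H → Total (λ p xs → f (F p xs) (H p xs))
call₂ f F H = app (binary f) (F ∷ᵗ H ∷ᵗ []ᵗ)

natrec-cong : ∀ {b s b′ s′} → b ≡ b′ → (∀ i a → s i a ≡ s′ i a) → ∀ n →
              natrec b s n ≡ natrec b′ s′ n
natrec-cong b≡ s≡ zero = b≡
natrec-cong {s′ = s′} b≡ s≡ (suc n) = trans (s≡ n _) (cong (s′ n) (natrec-cong b≡ s≡ n))

predᵗ : Total₁ pred
predᵗ = total₁ (Total-≗ (λ p xs → eq (lookup xs zero)) (rec (lit 0) v₀ v₀))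
  where
  eq : ∀ n → natrec 0 (λ i _ → i) n ≡ pred n
  eq zero    = refl
  eq (suc n) = refl

plusᵗ : Total₂ _+_
plusᵗ = total₂ (Total-≗ (λ p xs → eq (lookup xs zero) _) (rec v₁ (sucᵗ v₁) v₀))
  where
  eq : ∀ m n → natrec n (λ _ a → suc a) m ≡ m + n
  eq zero    n = refl
  eq (suc m) n = cong suc (eq m n)

timesᵗ : Total₂ _*_
timesᵗ = total₂ (Total-≗ (λ p xs → eq (lookup xs zero) _) (rec (lit 0) (call₂ plusᵗ v₃ v₁) v₀))
  where
  eq : ∀ m n → natrec 0 (λ _ a → n + a) m ≡ m * n
  eq zero    n = refl
  eq (suc m) n = cong (n +_) (eq m n)

monusᵗ : Total₂ _∸_
monusᵗ = total₂ (Total-≗ (λ p xs → eq (lookup xs zero) (lookup xs (suc zero)))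
                 (rec v₀ (call₁ predᵗ v₁) v₁))
  where
  eq : ∀ m n → natrec m (λ _ a → pred a) n ≡ m ∸ n
  eq m zero    = refl
  eq m (suc n) = trans (cong pred (eq m n)) (pred[m∸n]≡m∸[1+n] m n)

-- The recursion ⌊(n+1)/2⌋ = n ∸ ⌊n/2⌋ avoids a case distinction on parity.
halfᵗ : Total₁ ⌊_/2⌋
halfᵗ = total₁ (Total-≗ (λ p xs → eq (lookup xs zero)) (rec (lit 0) (call₂ monusᵗ v₀ v₁) v₀))
  where
  eq : ∀ n → natrec 0 (λ i a → i ∸ a) n ≡ ⌊ n /2⌋
  eq zero    = refl
  eq (suc n) = begin
    n ∸ natrec 0 (λ i a → i ∸ a) n      ≡⟨ cong (n ∸_) (eq n) ⟩
    n ∸ ⌊ n /2⌋                         ≡⟨ cong (_∸ ⌊ n /2⌋) (⌊n/2⌋+⌈n/2⌉≡n n) ⟨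
    ⌊ n /2⌋ + ⌈ n /2⌉ ∸ ⌊ n /2⌋         ≡⟨ m+n∸m≡n ⌊ n /2⌋ ⌈ n /2⌉ ⟩
    ⌈ n /2⌉                             ∎
    where open ≡-Reasoning

pairᵗ : Total₂ ⟪_,_⟫
pairᵗ = total₂ (Total-≗ (λ p xs → eq (lookup xs zero) _)
  (rec (sucᵗ (call₂ timesᵗ (lit 2) v₁)) (call₂ timesᵗ (lit 2) v₁) v₀))
  where
  eq : ∀ x y → natrec (suc (2 * y)) (λ _ a → 2 * a) x ≡ ⟪ x , y ⟫
  eq zero    y = refl
  eq (suc x) y = cong (2 *_) (eq x y)

⌊2*n/2⌋ : ∀ n → ⌊ 2 * n /2⌋ ≡ n
⌊2*n/2⌋ n = trans (cong (λ m → ⌊ n + m /2⌋) (+-identityʳ n)) (sym (n≡⌊n+n/2⌋ n))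

⌊1+2*n/2⌋ : ∀ n → ⌊ suc (2 * n) /2⌋ ≡ n
⌊1+2*n/2⌋ n = trans (cong (λ m → ⌊ suc (n + m) /2⌋) (+-identityʳ n)) (sym (n≡⌈n+n/2⌉ n))

<⟪⟫ : ∀ x y → y < ⟪ x , y ⟫
<⟪⟫ zero    y = s≤s (m≤m+n y _)
<⟪⟫ (suc x) y = ≤-trans (<⟪⟫ x y) (m≤m+n _ _)

even∨odd : ∀ n → ∃[ d ] (n ≡ 2 * d ⊎ n ≡ suc (2 * d))
even∨odd zero = 0 , inj₁ refl
even∨odd (suc n) with even∨odd n
... | d , inj₁ eq = d , inj₂ (cong suc eq)
... | d , inj₂ eq = suc d , inj₁ (trans (cong suc eq) (sym (*-suc 2 d)))

opaque
  -- Only the existence of a decomposition matters here; `hd` gets its program later by a search,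
  -- and `tl` from that of `hd`.
  unpair : ∀ c → c ≡ 0 ⊎ ∃₂ λ x y → c ≡ ⟪ x , y ⟫
  unpair = <-rec _ step
    where
    step : ∀ c → (∀ {d} → d < c → d ≡ 0 ⊎ ∃₂ λ x y → d ≡ ⟪ x , y ⟫) →
           c ≡ 0 ⊎ ∃₂ λ x y → c ≡ ⟪ x , y ⟫
    step zero    _  = inj₁ refl
    step (suc c) ih with even∨odd (suc c)
    ... | d , inj₂ eq = inj₂ (0 , d , eq)
    ... | suc d , inj₁ eq with ih (subst (suc d <_) (sym eq) (m<m+n (suc d) (s≤s z≤n)))
    ...   | inj₂ (x , y , eq′) = inj₂ (suc x , y , trans eq (cong (2 *_) eq′))

hd tl : ℕ → ℕ
hd c with unpair c
... | inj₁ _           = 0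
... | inj₂ (x , _ , _) = x
tl c with unpair c
... | inj₁ _           = 0
... | inj₂ (_ , y , _) = y

hd-⟪⟫ : ∀ x y → hd ⟪ x , y ⟫ ≡ x
hd-⟪⟫ x y with unpair ⟪ x , y ⟫
... | inj₁ eq             = contradiction eq (⟪⟫≢0 x y)
... | inj₂ (x′ , y′ , eq) = sym (proj₁ (⟪⟫-injective x x′ eq))

tl-⟪⟫ : ∀ x y → tl ⟪ x , y ⟫ ≡ y
tl-⟪⟫ x y with unpair ⟪ x , y ⟫
... | inj₁ eq             = contradiction eq (⟪⟫≢0 x y)
... | inj₂ (x′ , y′ , eq) = sym (proj₂ (⟪⟫-injective x x′ eq))

halve : ℕ → ℕ → ℕ
halve a c = natrec c (λ _ → ⌊_/2⌋) a

halveᵗ : Total₂ halve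
halveᵗ = total₂ (rec v₁ (call₁ halfᵗ v₁) v₀)

halve-⟪⟫ : ∀ a i y → halve a ⟪ a + i , y ⟫ ≡ ⟪ i , y ⟫
halve-⟪⟫ zero    i y = refl
halve-⟪⟫ (suc a) i y = begin
  ⌊ halve a ⟪ suc (a + i) , y ⟫ /2⌋  ≡⟨ cong (λ j → ⌊ halve a ⟪ j , y ⟫ /2⌋) (+-suc a i) ⟨
  ⌊ halve a ⟪ a + suc i , y ⟫ /2⌋    ≡⟨ cong ⌊_/2⌋ (halve-⟪⟫ a (suc i) y) ⟩
  ⌊ 2 * ⟪ i , y ⟫ /2⌋                ≡⟨ ⌊2*n/2⌋ ⟪ i , y ⟫ ⟩
  ⟪ i , y ⟫                          ∎
  where open ≡-Reasoning

halve-hd : ∀ x y → halve x ⟪ x , y ⟫ ≡ suc (2 * y)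
halve-hd x y = trans (cong (λ j → halve x ⟪ j , y ⟫) (sym (+-identityʳ x))) (halve-⟪⟫ x 0 y)

isEven : ℕ → ℕ
isEven n = 1 ∸ (n ∸ 2 * ⌊ n /2⌋)

isEvenᵗ : Total₁ isEven
isEvenᵗ = total₁ (call₂ monusᵗ (lit 1)
  (call₂ monusᵗ v₀ (call₂ timesᵗ (lit 2) (call₁ halfᵗ v₀))))

isEven-even : ∀ d → isEven (2 * d) ≡ 1
isEven-even d = cong (1 ∸_)
  (trans (cong (λ e → 2 * d ∸ 2 * e) (⌊2*n/2⌋ d)) (n∸n≡0 (2 * d)))

isEven-odd : ∀ d → isEven (suc (2 * d)) ≡ 0
isEven-odd d = cong (1 ∸_)
  (trans (cong (λ e → suc (2 * d) ∸ 2 * e) (⌊1+2*n/2⌋ d)) (m+n∸n≡m 1 (2 * d)))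

-- hd c is the number of halvings that make c odd; the factor c stops the
-- search at once for c = 0.
hdᵗ : Total₁ hd
hdᵗ = total₁ (μᵗ (call₂ timesᵗ v₁ (call₁ isEvenᵗ (call₂ halveᵗ v₀ v₁)))
  (λ p xs → hd (lookup xs zero))
  (λ p xs → hit (lookup xs zero))
  (λ p xs → miss (lookup xs zero)))
  where
  hit : ∀ c → c * isEven (halve (hd c) c) ≡ 0
  hit c with unpair c
  ... | inj₁ refl = refl
  ... | inj₂ (x , y , refl) = trans
    (cong (⟪ x , y ⟫ *_) (trans (cong isEven (halve-hd x y)) (isEven-odd y)))
    (*-zeroʳ ⟪ x , y ⟫)
  miss : ∀ c {a} → a < hd c → c * isEven (halve a c) ≢ 0
  miss c {a} a<x eq with unpair c
  ... | inj₂ (x , y , refl)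
    with d , refl ← m≤n⇒∃[o]m+o≡n a<x =
    ⟪⟫≢0 (suc a + d) y (begin
      ⟪ suc a + d , y ⟫                                   ≡⟨ *-identityʳ _ ⟨
      ⟪ suc a + d , y ⟫ * 1                               ≡⟨ cong (⟪ suc a + d , y ⟫ *_) even ⟨
      ⟪ suc a + d , y ⟫ * isEven (halve a ⟪ suc a + d , y ⟫) ≡⟨ eq ⟩
      0                                                   ∎)
    where
    open ≡-Reasoning
    even : isEven (halve a ⟪ suc a + d , y ⟫) ≡ 1
    even = trans (cong (λ j → isEven (halve a ⟪ j , y ⟫)) (sym (+-suc a d)))
      (trans (cong isEven (halve-⟪⟫ a (suc d) y)) (isEven-even ⟪ d , y ⟫))

tlᵗ : Total₁ tl
tlᵗ = total₁ (Total-≗ (λ p xs → eq (lookup xs zero))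
  (call₁ halfᵗ (call₂ halveᵗ (call₁ hdᵗ v₀) v₀)))
  where
  eq : ∀ c → ⌊ halve (hd c) c /2⌋ ≡ tl c
  eq c with unpair c
  ... | inj₁ refl = refl
  ... | inj₂ (x , y , refl) = trans (cong ⌊_/2⌋ (halve-hd x y)) (⌊1+2*n/2⌋ y)

-- Strings

↾-cong : ∀ k → p ≈[ k ] q → p ↾ k ≡ q ↾ k
↾-cong zero    _   = refl
↾-cong (suc k) p≈q = cong₂ ⟪_,_⟫ (p≈q ≤-refl) (↾-cong k (p≈q ∘ m≤n⇒m≤1+n))

restrictᵗ : {F : Baire → Vec ℕ (suc n) → ℕ} → Total F → Total N →
            Total (λ p xs → (λ i → F p (i ∷ xs)) ↾ N p xs)
restrictᵗ {n} {N} {F} F′ N′ = Total-≗ (λ p xs → eq p xs (N p xs))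
  (rec (lit 0) (call₂ pairᵗ (app F′ (v₀ ∷ᵗ tailᵗ (tailᵗ idᵗ))) v₁) N′)
  where
  eq : ∀ p xs k → natrec 0 (λ i a → ⟪ F p (i ∷ xs) , a ⟫) k ≡ (λ i → F p (i ∷ xs)) ↾ k
  eq p xs zero    = refl
  eq p xs (suc k) = cong ⟪ F p (k ∷ xs) ,_⟫ (eq p xs k)

opaque
  -- Every number is a code: 0 is the empty string, and any other number is a pair of a last digit
  -- and a smaller code. Quantifiers over strings can therefore range over all numbers.
  string : ∀ w → ∃₂ λ k q → w ≡ q ↾ k
  string = <-rec _ step
    where
    step : ∀ w → (∀ {v} → v < w → ∃₂ λ k q → v ≡ q ↾ k) → ∃₂ λ k q → w ≡ q ↾ k
    step w ih with unpair w
    ... | inj₁ refl = 0 , const 0 , refl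
    ... | inj₂ (x , v , refl)
      with k , q , eq ← ih (<⟪⟫ x v) =
      suc k , q′ , cong₂ ⟪_,_⟫ (sym at-k) (trans eq (↾-cong k below))
      where
      q′ : Baire
      q′ i with i ≟ k
      ... | yes _ = x
      ... | no _  = q i
      at-k : q′ k ≡ x
      at-k with k ≟ k
      ... | yes _  = refl
      ... | no k≢k = contradiction refl k≢k
      below : q ≈[ k ] q′
      below {i} i<k with i ≟ k
      ... | yes i≡k = contradiction i≡k (<⇒≢ i<k)
      ... | no _    = refl

len : ℕ → ℕ
len w = proj₁ (string w)

len-↾ : ∀ q k → len (q ↾ k) ≡ k
len-↾ q k = let j , r , eq = string (q ↾ k)
            in sym (proj₁ (↾-injective {q} {r} k j eq))

tails : ℕ → ℕ → ℕ
tails j w = natrec w (λ _ → tl) j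

tailsᵗ : Total₂ tails
tailsᵗ = total₂ (rec v₁ (call₁ tlᵗ v₁) v₀)

tails-↾ : ∀ q j k → tails j (q ↾ (j + k)) ≡ q ↾ k
tails-↾ q zero    k = refl
tails-↾ q (suc j) k = begin
  tl (tails j (q ↾ suc (j + k)))  ≡⟨ cong (λ i → tl (tails j (q ↾ i))) (+-suc j k) ⟨
  tl (tails j (q ↾ (j + suc k)))  ≡⟨ cong tl (tails-↾ q j (suc k)) ⟩
  tl ⟪ q k , q ↾ k ⟫              ≡⟨ tl-⟪⟫ (q k) (q ↾ k) ⟩
  q ↾ k                           ∎
  where open ≡-Reasoning

-- Only the empty string has code 0, so the length is the first number of `tl` steps that leads to
-- 0.
lenᵗ : Total₁ len
lenᵗ = total₁ (μᵗ (Total₂.binary tailsᵗ) (λ p xs → len (lookup xs zero))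
  (λ p xs → hit (lookup xs zero)) (λ p xs → miss (lookup xs zero)))
  where
  hit : ∀ w → tails (len w) w ≡ 0
  hit w with string w
  ... | k , q , refl = trans (cong (λ j → tails k (q ↾ j)) (sym (+-identityʳ k))) (tails-↾ q k 0)
  miss : ∀ w {j} → j < len w → tails j w ≢ 0
  miss w {j} j<k eq with string w
  ... | k , q , refl
    with d , refl ← m≤n⇒∃[o]m+o≡n j<k = ⟪⟫≢0 (q d) (q ↾ d)
      (trans (sym (tails-↾ q j (suc d)))
        (trans (cong (λ i → tails j (q ↾ i)) (+-suc j d)) eq))

-- Beyond the end of a string its last digit is repeated.
digit : ℕ → Baire
digit w i = hd (tails (len w ∸ suc i) w)

digitᵗ : Total₂ digit
digitᵗ = total₂ (call₁ hdᵗ (call₂ tailsᵗ (call₂ monusᵗ (call₁ lenᵗ v₀) (sucᵗ v₁)) v₀))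

digit-↾ : ∀ q k → digit (q ↾ k) ≈[ k ] q
digit-↾ q k {i} i<k = begin
  hd (tails (len (q ↾ k) ∸ suc i) (q ↾ k))   ≡⟨ cong (λ l → hd (tails (l ∸ suc i) (q ↾ k))) (len-↾ q k) ⟩
  hd (tails (k ∸ suc i) (q ↾ k))             ≡⟨ cong (λ j → hd (tails (k ∸ suc i) (q ↾ j))) (m∸n+n≡m i<k) ⟨
  hd (tails (k ∸ suc i) (q ↾ (k ∸ suc i + suc i))) ≡⟨ cong hd (tails-↾ q (k ∸ suc i) (suc i)) ⟩
  hd ⟪ q i , q ↾ i ⟫                         ≡⟨ hd-⟪⟫ (q i) (q ↾ i) ⟩
  q i                                        ∎
  where open ≡-Reasoning

digit-↾-id : ∀ w → digit w ↾ len w ≡ w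
digit-↾-id w = unfold (string w) refl
  where
  unfold : ((j , r , _) : ∃₂ λ j r → w ≡ r ↾ j) → len w ≡ j → digit w ↾ len w ≡ w
  unfold (j , r , refl) eq = trans (cong (digit (r ↾ j) ↾_) eq) (↾-cong j (digit-↾ r j))

headᵗ : {G : Baire → Vec ℕ n → Vec ℕ (suc m)} → Totals G → Total (λ p xs → head (G p xs))
headᵗ {G = G} Gs = Total-≗ (λ p xs → lookup-head (G p xs)) (app v₀ Gs)
  where
  lookup-head : (ys : Vec ℕ (suc m)) → lookup ys zero ≡ head ys
  lookup-head (_ ∷ _) = refl

-- Partial values, and runs of programs on finite parts of the oracle

≢0-suc : n ≡ suc k → n ≢ 0
≢0-suc refl ()

pred-suc : ∀ m → pred m ≡ suc y → m ≡ suc (suc y)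
pred-suc (suc m) refl = refl

-- The value 0 stands both for "false" and for "undefined"; `gate` serves as conjunction and as
-- strict sequencing.
gate : ℕ → ℕ → ℕ
gate a b = natrec 0 (λ _ _ → b) a

gateᵗ : Total₂ gate
gateᵗ = total₂ (rec (lit 0) v₃ v₀)

gate-≢0 : ∀ a b → gate a b ≢ 0 ⇔ (a ≢ 0 × b ≢ 0)
gate-≢0 zero    b = mk⇔ (λ h → contradiction refl h) (λ (h , _) → contradiction refl h)
gate-≢0 (suc a) b = mk⇔ (λ h → (λ ()) , h) proj₂

gate-open : ∀ a b → a ≢ 0 → gate a b ≡ b
gate-open zero    b a≢0 = contradiction refl a≢0
gate-open (suc a) b _   = refl

gate-suc : ∀ a b → gate a b ≡ suc y → a ≢ 0 × b ≡ suc y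
gate-suc (suc a) b eq = (λ ()) , eq

-- Finitely many properties of this kind hold at a common prefix length, which replaces any appeal
-- to monotonicity.
Eventually : ∀ {a} → (ℕ → Set a) → Set a
Eventually P = ∃[ K ] ∀ k → K ≤ k → P k

eventually-map : (∀ k → P k → Q k) → Eventually P → Eventually Q
eventually-map f (K , h) = K , λ k K≤k → f k (h k K≤k)

eventually-× : Eventually P → Eventually Q → Eventually (λ k → P k × Q k)
eventually-× (K , h) (L , g) =
  K + L , λ k KL≤k → h k (≤-trans (m≤m+n K L) KL≤k) , g k (≤-trans (m≤n+m L K) KL≤k)

eventually-Fin : {P : Fin n → ℕ → Set a} → (∀ i → Eventually (P i)) →
                 Eventually (λ k → ∀ i → P i k)
eventually-Fin {n = zero}  h = 0 , λ _ _ ()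
eventually-Fin {n = suc n} h = eventually-map
  (λ { k (P₀ , _) zero → P₀ ; k (_ , Pₛ) (suc i) → Pₛ i })
  (eventually-× (h zero) (eventually-Fin (h ∘ suc)))

eventually-< : {P : ℕ → ℕ → Set a} → ∀ n → (∀ {i} → i < n → Eventually (P i)) →
               Eventually (λ k → ∀ {i} → i < n → P i k)
eventually-< zero    h = 0 , λ _ _ ()
eventually-< {P = P} (suc n) h = eventually-map combine
  (eventually-× (h ≤-refl) (eventually-< n (h ∘ m≤n⇒m≤1+n)))
  where
  combine : ∀ k → P n k × (∀ {i} → i < n → P i k) → ∀ {i} → i < suc n → P i k
  combine k (Pₙ , below) (s≤s i≤n) with m≤n⇒m<n∨m≡n i≤n
  ... | inj₁ i<n  = below i<n
  ... | inj₂ refl = Pₙ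

-- Unbounded search cut off after k steps.  The state is 0 while searching,
-- 1 after meeting an undefined value and 2 + y after success at y.

stage : ℕ → ℕ → ℕ → ℕ
stage a i b = natrec (natrec 1 (λ j _ → natrec (suc (suc i)) (λ _ _ → 0) j) b) (λ j _ → suc j) a

scan : (ℕ → ℕ) → ℕ → ℕ
scan g = natrec 0 (λ i a → stage a i (g i))

module _ (g : ℕ → ℕ) where

  Positive : ℕ → Set
  Positive i = ∃[ z ] g i ≡ suc (suc z)

  below-suc : (∀ {i} → i < k → Positive i) → Positive k → ∀ {i} → i < suc k → Positive i
  below-suc below here (s≤s i≤k) with m≤n⇒m<n∨m≡n i≤k
  ... | inj₁ i<k  = below i<k
  ... | inj₂ refl = here

  scan-zero : ∀ k → scan g k ≡ 0 → ∀ {i} → i < k → Positive i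
  scan-zero (suc k) eq with scan g k in eqₖ | g k in eqg
  ... | zero | suc (suc z) = below-suc (scan-zero k eqₖ) (z , eqg)

  scan-sound : ∀ k → scan g k ≡ suc (suc y) → g y ≡ 1 × (∀ {i} → i < y → Positive i)
  scan-sound (suc k) eq with scan g k in eqₖ
  scan-sound (suc k) refl | suc (suc y) = scan-sound k eqₖ
  ... | zero with g k in eqg
  scan-sound (suc k) refl | zero | 1 = eqg , scan-zero k eqₖ

  scan-searching : ∀ k → (∀ {i} → i < k → Positive i) → scan g k ≡ 0
  scan-searching zero    _ = refl
  scan-searching (suc k) h
    rewrite scan-searching k (h ∘ m≤n⇒m≤1+n) | proj₂ (h {k} ≤-refl) = refl

  scan-complete : ∀ k → y < k → g y ≡ 1 → (∀ {i} → i < y → Positive i) →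
                  scan g k ≡ suc (suc y)
  scan-complete (suc k) (s≤s y≤k) hit below with m≤n⇒m<n∨m≡n y≤k
  ... | inj₁ y<k  rewrite scan-complete k y<k hit below = refl
  ... | inj₂ refl rewrite scan-searching k below | hit = refl

-- ev e w xs runs e with the string w as oracle and with searches of at most
-- len w steps.  It is 0 if this leads to no result and suc y if the result is y.

ev      : Prog n → ℕ → Vec ℕ n → ℕ
evs     : Vec (Prog n) m → ℕ → Vec ℕ n → Vec ℕ m
defined : Vec (Prog n) m → ℕ → Vec ℕ n → ℕ
ev zero        w xs = 1
ev suc         w xs = suc (suc (head xs))
ev (proj i)    w xs = suc (lookup xs i)
ev oracle      w xs = gate (len w ∸ head xs) (suc (digit w (head xs)))
ev (comp f gs) w xs = gate (defined gs w xs) (ev f w (evs gs w xs))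
ev (prec f g)  w xs = natrec (ev f w (tail xs))
                             (λ i a → gate a (ev g w (i ∷ pred a ∷ tail xs))) (head xs)
ev (min f)     w xs = pred (scan (λ i → ev f w (i ∷ xs)) (len w))
evs []       w xs = []
evs (g ∷ gs) w xs = pred (ev g w xs) ∷ evs gs w xs
defined []       w xs = 1
defined (g ∷ gs) w xs = gate (ev g w xs) (defined gs w xs)

evᵗ      : (e : Prog n) → Total {suc n} (λ _ xs → ev e (head xs) (tail xs))
evsᵗ     : (gs : Vec (Prog n) m) → Totals {suc n} (λ _ xs → evs gs (head xs) (tail xs))
definedᵗ : (gs : Vec (Prog n) m) → Total {suc n} (λ _ xs → defined gs (head xs) (tail xs))
evᵗ zero        = lit 1
evᵗ suc         = sucᵗ (sucᵗ (headᵗ (tailᵗ idᵗ)))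
evᵗ (proj i)    = sucᵗ (app (var i) (tailᵗ idᵗ))
evᵗ oracle      = call₂ gateᵗ
  (call₂ monusᵗ (call₁ lenᵗ (headᵗ idᵗ)) (headᵗ (tailᵗ idᵗ)))
  (sucᵗ (call₂ digitᵗ (headᵗ idᵗ) (headᵗ (tailᵗ idᵗ))))
evᵗ (comp f gs) = call₂ gateᵗ (definedᵗ gs) (app (evᵗ f) (headᵗ idᵗ ∷ᵗ evsᵗ gs))
evᵗ (prec f g)  = rec
  (app (evᵗ f) (headᵗ idᵗ ∷ᵗ tailᵗ (tailᵗ idᵗ)))
  (call₂ gateᵗ v₁ (app (evᵗ g)
    (headᵗ (tailᵗ (tailᵗ idᵗ)) ∷ᵗ v₀ ∷ᵗ call₁ predᵗ v₁ ∷ᵗ tailᵗ (tailᵗ (tailᵗ (tailᵗ idᵗ))))))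
  (headᵗ (tailᵗ idᵗ))
evᵗ (min f)     = call₁ predᵗ (rec (lit 0)
  (app stageᵗ (v₁ ∷ᵗ v₀ ∷ᵗ
    app (evᵗ f) (headᵗ (tailᵗ (tailᵗ idᵗ)) ∷ᵗ v₀ ∷ᵗ tailᵗ (tailᵗ (tailᵗ idᵗ))) ∷ᵗ []ᵗ))
  (call₁ lenᵗ (headᵗ idᵗ)))
  where
  stageᵗ : Total {3} λ _ xs →
           stage (lookup xs zero) (lookup xs (suc zero)) (lookup xs (suc (suc zero)))
  stageᵗ = rec (rec (lit 1) (rec (sucᵗ (sucᵗ v₃)) (lit 0) v₀) v₂) (sucᵗ v₀) v₀
evsᵗ []       = []ᵗ
evsᵗ (g ∷ gs) = call₁ predᵗ (evᵗ g) ∷ᵗ evsᵗ gs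
definedᵗ []       = lit 1
definedᵗ (g ∷ gs) = call₂ gateᵗ (evᵗ g) (definedᵗ gs)

module _ (p : Baire) where

  -- Separates the recursion on the number `x` from the recursion on programs: soundness of `f` and
  -- `g` enters as a hypothesis.
  prec-sound : {f : Prog n} {g : Prog (suc (suc n))} → ∀ k →
    (∀ {y} xs → ev f (p ↾ k) xs ≡ suc y → p ⊢ f · xs ⇓ y) →
    (∀ {y} xs → ev g (p ↾ k) xs ≡ suc y → p ⊢ g · xs ⇓ y) →
    ∀ {y} x xs → ev (prec f g) (p ↾ k) (x ∷ xs) ≡ suc y → p ⊢ prec f g · x ∷ xs ⇓ y
  prec-sound k f-sound g-sound zero xs eq = prec0⇓ (f-sound xs eq)
  prec-sound {f = f} {g} k f-sound g-sound (suc x) xs eq =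
    let h≢0 , eq′ = gate-suc (ev (prec f g) (p ↾ k) (x ∷ xs)) _ eq
        y , eqₕ = nonzero-suc _ h≢0
    in precS⇓ (prec-sound k f-sound g-sound x xs eqₕ)
         (g-sound (x ∷ y ∷ xs)
           (trans (cong (λ a → ev g (p ↾ k) (x ∷ pred a ∷ xs)) (sym eqₕ)) eq′))

  ev-sound  : (e : Prog n) → ∀ k xs → ev e (p ↾ k) xs ≡ suc y → p ⊢ e · xs ⇓ y
  evs-sound : (gs : Vec (Prog n) m) → ∀ k xs → defined gs (p ↾ k) xs ≢ 0 →
              ∀ i → p ⊢ lookup gs i · xs ⇓ lookup (evs gs (p ↾ k) xs) i
  ev-sound zero k xs refl = zero⇓
  ev-sound suc k (x ∷ []) refl = suc⇓
  ev-sound (proj i) k xs refl = proj⇓ i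
  ev-sound oracle k (x ∷ []) eq
    with l∸x≢0 , eq′ ← gate-suc (len (p ↾ k) ∸ x) _ eq =
    subst (p ⊢ oracle · x ∷ [] ⇓_) (trans (sym (digit-↾ p k x<k)) (suc-injective eq′)) oracle⇓
    where
    x<k : x < k
    x<k = ≰⇒> λ k≤x → l∸x≢0 (m≤n⇒m∸n≡0 (subst (_≤ x) (sym (len-↾ p k)) k≤x))
  ev-sound (comp f gs) k xs eq
    with gs≢0 , eq′ ← gate-suc (defined gs (p ↾ k) xs) _ eq =
    comp⇓ (evs gs (p ↾ k) xs) (evs-sound gs k xs gs≢0) (ev-sound f k _ eq′)
  ev-sound (prec f g) k (x ∷ xs) eq = prec-sound k (ev-sound f k) (ev-sound g k) x xs eq
  ev-sound {y = y} (min f) k xs eq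
    with hit , below ← scan-sound (λ i → ev f (p ↾ k) (i ∷ xs)) (len (p ↾ k)) (pred-suc _ eq) =
    min⇓ (λ i<y → let z , eq′ = below i<y in z , ev-sound f k _ eq′) (ev-sound f k _ hit)
  evs-sound (g ∷ gs) k xs gs≢0 zero =
    let y , eq = nonzero-suc _ (proj₁ (Equivalence.to (gate-≢0 _ _) gs≢0))
    in subst (p ⊢ g · xs ⇓_) (sym (cong pred eq)) (ev-sound g k xs eq)
  evs-sound (g ∷ gs) k xs gs≢0 (suc i) =
    evs-sound gs k xs (proj₂ (Equivalence.to (gate-≢0 (ev g (p ↾ k) xs) _) gs≢0)) i

  evs-complete : (gs : Vec (Prog n) m) → ∀ w xs (ys : Vec ℕ m) →
                 (∀ i → ev (lookup gs i) w xs ≡ suc (lookup ys i)) →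
                 defined gs w xs ≢ 0 × evs gs w xs ≡ ys
  evs-complete [] w xs [] h = (λ ()) , refl
  evs-complete (g ∷ gs) w xs (y ∷ ys) h =
    let gs≢0 , eq = evs-complete gs w xs ys (h ∘ suc)
    in Equivalence.from (gate-≢0 (ev g w xs) _) (≢0-suc (h zero) , gs≢0)
     , cong₂ _∷_ (cong pred (h zero)) eq

  -- A derivation makes finitely many queries and searches, so all long enough prefixes contain the
  -- digits and allow the search steps that it needs.
  ev-complete : {e : Prog n} {xs : Vec ℕ n} → p ⊢ e · xs ⇓ y →
                Eventually λ k → ev e (p ↾ k) xs ≡ suc y
  ev-complete zero⇓ = 0 , λ _ _ → refl
  ev-complete suc⇓ = 0 , λ _ _ → refl
  ev-complete (proj⇓ i) = 0 , λ _ _ → refl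
  ev-complete (oracle⇓ {x = x}) = suc x , λ k x<k → trans
    (gate-open _ _ (m>n⇒m∸n≢0 (subst (x <_) (sym (len-↾ p k)) x<k)))
    (cong suc (digit-↾ p k x<k))
  ev-complete {e = comp f gs} {xs} (comp⇓ ys gs⇓ f⇓) = eventually-map
    (λ k (hs , h) →
      let gs≢0 , eq = evs-complete gs (p ↾ k) xs ys hs
      in trans (gate-open _ _ gs≢0) (trans (cong (ev f (p ↾ k)) eq) h))
    (eventually-× (eventually-Fin λ i → ev-complete (gs⇓ i)) (ev-complete f⇓))
  ev-complete (prec0⇓ f⇓) = ev-complete f⇓
  ev-complete {e = prec f g} {suc x ∷ xs} (precS⇓ h⇓ g⇓) = eventually-map
    (λ k (h , h′) → trans (gate-open _ _ (≢0-suc h))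
      (trans (cong (λ a → ev g (p ↾ k) (x ∷ pred a ∷ xs)) h) h′))
    (eventually-× (ev-complete h⇓) (ev-complete g⇓))
  ev-complete {y = y} {e = min f} {xs} (min⇓ below f⇓) = eventually-map
    (λ k (y<k , hs , h) → cong pred
      (scan-complete (λ i → ev f (p ↾ k) (i ∷ xs)) (len (p ↾ k))
        (subst (y <_) (sym (len-↾ p k)) y<k) h
        (λ i<y → hs i<y)))
    -- The search bound is the length of the prefix, which must therefore exceed the result `y`.
    (eventually-× (suc y , λ k y<k → y<k) (eventually-×
      (eventually-< y λ i<y → let z , d = below i<y
                              in eventually-map (λ k eq → z , eq) (ev-complete d))
      (ev-complete f⇓)))

-- Bounded tests and unbounded search

allB : (ℕ → ℕ) → ℕ → ℕ
allB f = natrec 1 (λ i a → gate a (f i))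

allBᵗ : {F : Baire → Vec ℕ (suc n) → ℕ} → Total F → Total N →
        Total (λ p xs → allB (λ i → F p (i ∷ xs)) (N p xs))
allBᵗ F N = rec (lit 1) (call₂ gateᵗ v₁ (app F (v₀ ∷ᵗ tailᵗ (tailᵗ idᵗ)))) N

allB-≢0 : ∀ f n → allB f n ≢ 0 ⇔ (∀ {i} → i < n → f i ≢ 0)
allB-≢0 f n = mk⇔ (to n) (from n)
  where
  to : ∀ n → allB f n ≢ 0 → ∀ {i} → i < n → f i ≢ 0
  to (suc n) h (s≤s i≤n)
    with below , here ← Equivalence.to (gate-≢0 (allB f n) (f n)) h
    with m≤n⇒m<n∨m≡n i≤n
  ... | inj₁ i<n  = to n below i<n
  ... | inj₂ refl = here
  from : ∀ n → (∀ {i} → i < n → f i ≢ 0) → allB f n ≢ 0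
  from zero    _ = λ ()
  from (suc n) h = Equivalence.from (gate-≢0 (allB f n) (f n))
    (from n (h ∘ m≤n⇒m≤1+n) , h ≤-refl)

isZero : ℕ → ℕ
isZero n = 1 ∸ n

isZeroᵗ : Total₁ isZero
isZeroᵗ = total₁ (call₂ monusᵗ (lit 1) v₀)

isZero-≢0 : ∀ n → isZero n ≢ 0 ⇔ n ≡ 0
isZero-≢0 zero    = mk⇔ (λ _ → refl) (λ _ ())
isZero-≢0 (suc n) = mk⇔ (λ h → contradiction (0∸n≡0 n) h) (λ ())

least : ∀ (f : ℕ → ℕ) t → f t ≢ 0 → ∃[ s ] f s ≢ 0 × (∀ {j} → j < s → f j ≡ 0)
least f t ft≢0 = found (search (suc t))
  where
  search : ∀ n → (∃[ s ] f s ≢ 0 × (∀ {j} → j < s → f j ≡ 0)) ⊎ (∀ {j} → j < n → f j ≡ 0)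
  search zero = inj₂ λ ()
  search (suc n) with search n
  ... | inj₁ s = inj₁ s
  ... | inj₂ none with f n ≟ 0
  ...   | no fn≢0  = inj₁ (n , fn≢0 , none)
  ...   | yes fn≡0 = inj₂ λ { (s≤s j≤n) → step (m≤n⇒m<n∨m≡n j≤n) }
    where
    step : j < n ⊎ j ≡ n → f j ≡ 0
    step (inj₁ j<n)  = none j<n
    step (inj₂ refl) = fn≡0
  found : (∃[ s ] f s ≢ 0 × (∀ {j} → j < s → f j ≡ 0)) ⊎ (∀ {j} → j < suc t → f j ≡ 0) →
          ∃[ s ] f s ≢ 0 × (∀ {j} → j < s → f j ≡ 0)
  found (inj₁ s)    = s
  found (inj₂ none) = contradiction (none ≤-refl) ft≢0

searchᵖ : {F : Baire → Vec ℕ (suc n) → ℕ} → Total F → Prog n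
searchᵖ F = min (program (call₁ isZeroᵗ F))

-- As `F` is total, `min` cannot get stuck before the first witness.
search-halts : {F : Baire → Vec ℕ (suc n) → ℕ} (Fᵗ : Total F) → ∀ p xs →
               (∃[ t ] F p (t ∷ xs) ≢ 0) ⇔ (∃[ y ] p ⊢ searchᵖ Fᵗ · xs ⇓ y)
search-halts {F = F} Fᵗ p xs = mk⇔ halts found
  where
  test : Prog _
  test = program (call₁ isZeroᵗ Fᵗ)
  test⇓ : ∀ ys → p ⊢ test · ys ⇓ isZero (F p ys)
  test⇓ = correct (call₁ isZeroᵗ Fᵗ) p
  halts : ∃[ t ] F p (t ∷ xs) ≢ 0 → ∃[ y ] p ⊢ searchᵖ Fᵗ · xs ⇓ y
  halts (t , Ft≢0) =
    let s , Fs≢0 , below = least (λ t → F p (t ∷ xs)) t Ft≢0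
        k , Fs≡ = nonzero-suc _ Fs≢0
    in s , min⇓
      (λ {i} i<s → 0 , subst (p ⊢ test · i ∷ xs ⇓_) (cong isZero (below i<s)) (test⇓ (i ∷ xs)))
      (subst (p ⊢ test · s ∷ xs ⇓_) (trans (cong isZero Fs≡) (0∸n≡0 k)) (test⇓ (s ∷ xs)))
  found : ∃[ y ] p ⊢ searchᵖ Fᵗ · xs ⇓ y → ∃[ t ] F p (t ∷ xs) ≢ 0
  found (t , min⇓ _ h) = t , λ Ft≡0 →
    contradiction (trans (sym (⇓-functional (test⇓ (t ∷ xs)) h)) (cong isZero Ft≡0)) λ ()

-- Products

infixr 6 _⊕_

_⊕_ : Baire → Baire → Baire
(p ⊕ q) i = ⟪ p i , q i ⟫

left right : Baire → Baire
left  r i = hd (r i)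
right r i = tl (r i)

left-⊕ : ∀ p q → p ≗ left (p ⊕ q)
left-⊕ p q i = sym (hd-⟪⟫ (p i) (q i))

right-⊕ : ∀ p q → q ≗ right (p ⊕ q)
right-⊕ p q i = sym (tl-⟪⟫ (p i) (q i))

-- Defined by copatterns, so that X and Y can be inferred from X ⊗ Y.
infixr 6 _⊗_

_⊗_ : RepresentedSpace ℓ → RepresentedSpace ℓ′ → RepresentedSpace (ℓ ⊔ ℓ′)
(X ⊗ Y) .RepresentedSpace.points = ×-setoid X.points Y.points
  where
  module X = RepresentedSpace X
  module Y = RepresentedSpace Y
(X ⊗ Y) .RepresentedSpace.representation = record
  { δ          = λ r (x , y) → X.δ (left r) x × Y.δ (right r) y
  ; respects   = λ r≗s (x≈ , y≈) (rx , ry) →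
      X.respects (cong hd ∘ r≗s) x≈ rx , Y.respects (cong tl ∘ r≗s) y≈ ry
  ; functional = λ (rx , ry) (rx′ , ry′) → X.functional rx rx′ , Y.functional ry ry′
  ; surjective = λ (x , y) →
      let p , px = X.surjective x
          q , qy = Y.surjective y
      in p ⊕ q , X.respects (left-⊕ p q) X.≈.refl px , Y.respects (right-⊕ p q) Y.≈.refl qy
  }
  where
  module X = RepresentedSpace X
  module Y = RepresentedSpace Y

δ-⊕ : ∀ (X : RepresentedSpace ℓ) (Y : RepresentedSpace ℓ′) {p q x y} →
      RepresentedSpace.δ X p x → RepresentedSpace.δ Y q y →
      RepresentedSpace.δ (X ⊗ Y) (p ⊕ q) (x , y)
δ-⊕ X Y {p} {q} px qy =
  X.respects (left-⊕ p q) X.≈.refl px , Y.respects (right-⊕ p q) Y.≈.refl qy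
  where
  module X = RepresentedSpace X
  module Y = RepresentedSpace Y

-- Record types, so that the spaces and the map or relation can be inferred.

record Map (X : RepresentedSpace ℓ) (Y : RepresentedSpace ℓ′) (f : Carrier X → Carrier Y) :
           Set (ℓ ⊔ ℓ′) where
  constructor realizedBy
  private
    module X = RepresentedSpace X
    module Y = RepresentedSpace Y
  field
    realizer : Prog 1
    realizes : ∀ p x → X.δ p x → ∃[ q ] ⟦ realizer ⟧ p q × Y.δ q (f x)

  toComputable : ComputableMap X Y f
  toComputable = realizer , λ p x px _ →
    let q , pq , qy = realizes p x px in q , pq , f x , qy , Y.≈.refl

open Map

fromComputable : (X : RepresentedSpace ℓ) (Y : RepresentedSpace ℓ′) {f : Carrier X → Carrier Y} →
                 ComputableMap X Y f → Map X Y f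
fromComputable X Y {f} (e , h) = realizedBy e λ p x px →
  let q , pq , y , qy , fx≈y = h p x px (f x , Y.≈.refl)
  in q , pq , Y.respects (λ _ → refl) (Y.≈.sym fx≈y) qy
  where module Y = RepresentedSpace Y

record SemiDec (X : RepresentedSpace ℓ) (R : Pred (Carrier X) a) : Set (ℓ ⊔ a) where
  constructor acceptedBy
  private module X = RepresentedSpace X
  field
    acceptor : Prog 0
    accepts  : ∀ p x → X.δ p x → R x ⇔ (∃[ y ] p ⊢ acceptor · [] ⇓ y)

open SemiDec

-- Combinators for computable maps and semidecidable relations

totalᵐ : {f : Carrier X → Carrier Y} {F : Baire → Vec ℕ 1 → ℕ} → Total F →
         (∀ p x → RepresentedSpace.δ X p x →
          RepresentedSpace.δ Y (λ n → F p (n ∷ [])) (f x)) → Map X Y f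
totalᵐ {F = F} (total e e⇓) h = realizedBy e λ p x px →
  (λ n → F p (n ∷ [])) , (λ n → e⇓ p (n ∷ [])) , h p x px

infixr 9 _∘ᵐ_

_∘ᵐ_ : {f : Carrier Y → Carrier Z} {g : Carrier X → Carrier Y} →
       Map Y Z f → Map X Y g → Map X Z (f ∘ g)
realizedBy e h ∘ᵐ realizedBy e′ h′ = realizedBy (relativize e e′) λ p x px →
  let q , pq , qy = h′ p x px
      r , qr , rz = h q _ qy
  in r , (λ n → relativize⁺ pq (qr n)) , rz

fstᵐ : Map (X ⊗ Y) X proj₁
fstᵐ = totalᵐ (call₁ hdᵗ (query v₀)) λ p _ (px , _) → px

sndᵐ : Map (X ⊗ Y) Y proj₂
sndᵐ = totalᵐ (call₁ tlᵗ (query v₀)) λ p _ (_ , py) → py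

infixr 4 _,ᵐ_

_,ᵐ_ : {f : Carrier W → Carrier X} {g : Carrier W → Carrier Y} →
       Map W X f → Map W Y g → Map W (X ⊗ Y) (λ w → f w , g w)
_,ᵐ_ {X = X} {Y = Y} (realizedBy e h) (realizedBy e′ h′) =
  realizedBy (comp (program (binary pairᵗ)) (e ∷ e′ ∷ [])) λ p x px →
  let q , pq , qx = h p x px
      r , pr , rx = h′ p x px
  in q ⊕ r
   , (λ n → comp⇓ (q n ∷ r n ∷ []) (λ { zero → pq n ; (suc zero) → pr n })
              (correct (binary pairᵗ) p _))
   , δ-⊕ X Y qx rx

numᵐ : {f : ℕ → ℕ} {g : Carrier W → ℕ} → Total₁ f → Map W ℕₛ g → Map W ℕₛ (f ∘ g)
numᵐ {f = f} f′ g′ = totalᵐ (call₁ f′ (query v₀)) (λ p n pn → cong f pn) ∘ᵐ g′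

searchˢ : {R : Pred (Carrier X) a} {F : Baire → Vec ℕ 1 → ℕ} → Total F →
          (∀ p x → RepresentedSpace.δ X p x → R x ⇔ (∃[ t ] F p (t ∷ []) ≢ 0)) → SemiDec X R
searchˢ F h = acceptedBy (searchᵖ F) λ p x px → mk⇔
  (Equivalence.to (search-halts F p []) ∘ Equivalence.to (h p x px))
  (Equivalence.from (h p x px) ∘ Equivalence.from (search-halts F p []))

decideˢ : {R : Pred (Carrier X) a} {F : Baire → Vec ℕ 0 → ℕ} → Total F →
          (∀ p x → RepresentedSpace.δ X p x → R x ⇔ F p [] ≢ 0) → SemiDec X R
decideˢ F h = searchˢ (app F []ᵗ) λ p x px → mk⇔
  (λ Rx → 0 , Equivalence.to (h p x px) Rx)
  (λ (_ , Fp≢0) → Equivalence.from (h p x px) Fp≢0)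

infixl 8 _∘ˢ_

_∘ˢ_ : {R : Pred (Carrier Y) a} {f : Carrier X → Carrier Y} →
       SemiDec Y R → Map X Y f → SemiDec X (R ∘ f)
acceptedBy e h ∘ˢ realizedBy s g = acceptedBy (relativize e s) λ p x px →
  let q , pq , qy = g p x px in mk⇔
  (λ Rfx → let y , e⇓ = Equivalence.to (h q _ qy) Rfx in y , relativize⁺ pq e⇓)
  (λ (y , e⇓) → Equivalence.from (h q _ qy) (y , relativize⁻ pq e e⇓))

⇔ˢ : {R : Pred (Carrier X) a} {S : Pred (Carrier X) b} →
     (∀ x → R x ⇔ S x) → SemiDec X R → SemiDec X S
⇔ˢ R⇔S (acceptedBy e h) = acceptedBy e λ p x px → mk⇔
  (Equivalence.to (h p x px) ∘ Equivalence.from (R⇔S x))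
  (Equivalence.to (R⇔S x) ∘ Equivalence.from (h p x px))

infixr 5 _×ˢ_

_×ˢ_ : {R : Pred (Carrier X) a} {S : Pred (Carrier X) b} →
       SemiDec X R → SemiDec X S → SemiDec X (λ x → R x × S x)
-- `comp zero` discards the values of its arguments but still requires both to converge.
acceptedBy e h ×ˢ acceptedBy e′ h′ = acceptedBy (comp zero (e ∷ e′ ∷ [])) λ p x px → mk⇔
  (λ (Rx , Sx) → let y , e⇓  = Equivalence.to (h p x px) Rx
                     z , e′⇓ = Equivalence.to (h′ p x px) Sx
                 in 0 , comp⇓ (y ∷ z ∷ []) (λ { zero → e⇓ ; (suc zero) → e′⇓ }) zero⇓)
  (λ { (_ , comp⇓ ys es⇓ _) → Equivalence.from (h p x px) (_ , es⇓ zero)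
                            , Equivalence.from (h′ p x px) (_ , es⇓ (suc zero)) })

-- Whether a semidecision succeeds on a given finite part of a name is decidable.

module _ {X : RepresentedSpace ℓ} {R : Pred (Carrier X) a} (s : SemiDec X R) where
  private module X = RepresentedSpace X

  opaque
    run : ℕ → ℕ
    run w = ev (acceptor s) w []

    runᵗ : Total₁ run
    runᵗ = total₁ (app (evᵗ (acceptor s)) (v₀ ∷ᵗ []ᵗ))

    run-sound : ∀ {p x} → X.δ p x → ∀ k → run (p ↾ k) ≢ 0 → R x
    run-sound {p} {x} px k h =
      let y , eq = nonzero-suc _ h
      in Equivalence.from (accepts s p x px) (y , ev-sound p (acceptor s) k [] eq)

    run-complete : ∀ {p x} → X.δ p x → R x → Eventually (λ k → run (p ↾ k) ≢ 0)
    run-complete {p} {x} px Rx =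
      let y , e⇓ = Equivalence.to (accepts s p x px) Rx
      in eventually-map (λ k → ≢0-suc) (ev-complete p e⇓)

⊕-digit : ∀ p q k → (p ⊕ digit (q ↾ k)) ↾ k ≡ (p ⊕ q) ↾ k
⊕-digit p q k = ↾-cong k λ {i} i<k → cong ⟪ p i ,_⟫ (digit-↾ q k i<k)

-- The part of a name p ⊕ q that can be written down when p is given completely and q only up to the
-- string `w`.
⊕-string : Baire → ℕ → ℕ
⊕-string p w = (p ⊕ digit w) ↾ len w

⊕-string-↾ : ∀ p q k → ⊕-string p (q ↾ k) ≡ (p ⊕ q) ↾ k
⊕-string-↾ p q k = trans (cong ((p ⊕ digit (q ↾ k)) ↾_) (len-↾ q k)) (⊕-digit p q k)

⊕-stringᵗ : {F : Baire → Vec ℕ (suc n) → ℕ} → Total F → Total N →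
            Total (λ p xs → ⊕-string (λ i → F p (i ∷ xs)) (N p xs))
⊕-stringᵗ {N = N} F Nᵗ =
  restrictᵗ (call₂ pairᵗ F (call₂ digitᵗ (app Nᵗ (tailᵗ idᵗ)) v₀)) (call₁ lenᵗ Nᵗ)

module _ {X : RepresentedSpace ℓ} {R : Pred (ℕ × Carrier X) a} (s : SemiDec (ℕₛ ⊗ X) R) where
  private module X = RepresentedSpace X

  -- A constant sequence names its value, so a number and a string determine a finite part of a name
  -- of the pair.
  run₂ : ℕ → ℕ → ℕ
  run₂ n w = run s (⊕-string (const n) w)

  run₂ᵗ : Total₂ run₂
  run₂ᵗ = total₂ (call₁ (runᵗ s) (⊕-stringᵗ v₁ v₁))

  run₂-sound : ∀ {p x} → X.δ p x → ∀ n k → run₂ n (p ↾ k) ≢ 0 → R (n , x)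
  run₂-sound {p} px n k h = run-sound s {const n ⊕ p} (δ-⊕ ℕₛ X {const n} refl px) k
    (h ∘ trans (cong (run s) (⊕-string-↾ (const n) p k)))

  run₂-complete : ∀ {p x} → X.δ p x → ∀ n → R (n , x) → Eventually (λ k → run₂ n (p ↾ k) ≢ 0)
  run₂-complete {p} px n Rnx = eventually-map
    (λ k h → h ∘ trans (cong (run s) (sym (⊕-string-↾ (const n) p k))))
    (run-complete s {const n ⊕ p} (δ-⊕ ℕₛ X {const n} refl px) Rnx)

-- Dovetailing: `t` codes a candidate together with the length of the prefix on which it is tested.
∃ˢ : {R : Pred (ℕ × Carrier X) a} → SemiDec (ℕₛ ⊗ X) R → SemiDec X (λ x → ∃[ n ] R (n , x))
∃ˢ s = searchˢ {F = λ p xs → run₂ s (hd (lookup xs zero)) (p ↾ tl (lookup xs zero))}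
  (call₂ (run₂ᵗ s) (call₁ hdᵗ v₀) (restrictᵗ (query v₀) (call₁ tlᵗ v₀)))
  λ p x px → mk⇔
    (λ (n , Rnx) → let K , h = run₂-complete s px n Rnx in
      ⟪ n , K ⟫ , λ eq → h K ≤-refl
        (trans (cong₂ (λ n k → run₂ s n (p ↾ k)) (sym (hd-⟪⟫ n K)) (sym (tl-⟪⟫ n K))) eq))
    (λ (t , h) → hd t , run₂-sound s px (hd t) (tl t) h)

infixr 4 _⊎ˢ_

-- Both acceptors are run on the same growing prefixes, so that neither can block the other.
_⊎ˢ_ : {R : Pred (Carrier X) a} {S : Pred (Carrier X) b} →
       SemiDec X R → SemiDec X S → SemiDec X (λ x → R x ⊎ S x)
_⊎ˢ_ {X = X} {R = R} {S = S} s s′ =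
  searchˢ {F = λ p xs → run s (p ↾ lookup xs zero) + run s′ (p ↾ lookup xs zero)}
    (call₂ plusᵗ (call₁ (runᵗ s) prefix) (call₁ (runᵗ s′) prefix))
    λ p x px → mk⇔
      (λ { (inj₁ Rx) → let K , h = run-complete s px Rx
                       in K , λ eq → h K ≤-refl (m+n≡0⇒m≡0 _ eq)
         ; (inj₂ Sx) → let K , h = run-complete s′ px Sx
                       in K , λ eq → h K ≤-refl (m+n≡0⇒n≡0 (run s (p ↾ K)) eq) })
      (λ (t , h) → split px t h)
  where
  prefix : Total {1} λ p xs → p ↾ lookup xs zero
  prefix = restrictᵗ (query v₀) v₀
  split : ∀ {p x} → RepresentedSpace.δ X p x → ∀ t →
          run s (p ↾ t) + run s′ (p ↾ t) ≢ 0 → R x ⊎ S x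
  split {p} px t h with run s (p ↾ t) ≟ 0
  ... | no R≢0  = inj₁ (run-sound s px t R≢0)
  ... | yes R≡0 = inj₂ (run-sound s′ px t λ S≡0 → h (cong₂ _+_ R≡0 S≡0))

-- The digit suc n enumerates n, and the digit 0 enumerates nothing.

_enumerates_ : Baire → Pred ℕ a → Set a
p enumerates A = ∀ n → A n ⇔ (∃[ i ] p i ≡ suc n)

module _ {X : RepresentedSpace ℓ} {R : Pred (ℕ × Carrier X) a} (s : SemiDec (ℕₛ ⊗ X) R) where

  opaque
    -- Step ⟪ n , k ⟫ tests n on the first k digits of the name; a failed test is reported by the
    -- idle digit 0, which keeps the sequence total.
    enumeration : Baire → Baire
    enumeration p i = gate (run₂ s (hd i) (p ↾ tl i)) (suc (hd i))

    enumerationᵗ : Total {1} (λ p xs → enumeration p (lookup xs zero))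
    enumerationᵗ = call₂ gateᵗ
      (call₂ (run₂ᵗ s) (call₁ hdᵗ v₀) (restrictᵗ (query v₀) (call₁ tlᵗ v₀)))
      (sucᵗ (call₁ hdᵗ v₀))

    enumeration-enumerates : ∀ {p x} → RepresentedSpace.δ X p x →
                             enumeration p enumerates (λ n → R (n , x))
    enumeration-enumerates {p} {x} px n = mk⇔ to from
      where
      to : R (n , x) → ∃[ i ] enumeration p i ≡ suc n
      to Rnx with K , h ← run₂-complete s px n Rnx =
        ⟪ n , K ⟫ , trans
          (cong₂ (λ m k → gate (run₂ s m (p ↾ k)) (suc m)) (hd-⟪⟫ n K) (tl-⟪⟫ n K))
          (gate-open _ _ (h K ≤-refl))
      from : ∃[ i ] enumeration p i ≡ suc n → R (n , x)
      from (i , eq) =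
        let h , eq′ = gate-suc (run₂ s (hd i) (p ↾ tl i)) (suc (hd i)) eq
        in subst (λ m → R (m , x)) (suc-injective eq′) (run₂-sound s px (hd i) (tl i) h)

swapᵐ : Map (X ⊗ Y) (Y ⊗ X) (λ (x , y) → y , x)
swapᵐ = sndᵐ ,ᵐ fstᵐ

-- probe Q q n k ≢ 0 iff the universal machine with oracle Q and input q reads
-- exactly k digits before printing a nonzero n-th digit.
probe : Baire → Baire → ℕ → ℕ → ℕ
probe Q q n k = gate (allB (λ j → isZero (Q ⟪ n , q ↾ j ⟫)) k) (pred (Q ⟪ n , q ↾ k ⟫))

probeᵗ : Total {1} (λ s xs → probe (left s) (right s) (hd (lookup xs zero)) (tl (lookup xs zero)))
probeᵗ = call₂ gateᵗ
  (allBᵗ (call₁ isZeroᵗ (ask (call₁ hdᵗ v₁) v₀)) (call₁ tlᵗ v₀))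
  (call₁ predᵗ (ask (call₁ hdᵗ v₀) (call₁ tlᵗ v₀)))
  where
  ask : {N K : Baire → Vec ℕ n → ℕ} → Total N → Total K →
        Total (λ s xs → left s ⟪ N s xs , right s ↾ K s xs ⟫)
  ask N K = call₁ hdᵗ (query (call₂ pairᵗ N (restrictᵗ (call₁ tlᵗ (query v₀)) K)))

-- Since `probe` also checks that all earlier answers are 0, uniqueness of the first nonzero answer
-- identifies the digit it sees with the one the machine prints.
probe-η : ∀ Q q r → η Q q r → (∃[ n ] r n ≢ 0) ⇔ (∃[ t ] probe Q q (hd t) (tl t) ≢ 0)
probe-η Q q r Qqr = mk⇔ to from
  where
  to : ∃[ n ] r n ≢ 0 → ∃[ t ] probe Q q (hd t) (tl t) ≢ 0
  to (n , rn≢0) =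
    let k , hit , miss = Qqr n
    in ⟪ n , k ⟫ , subst₂ (λ n k → probe Q q n k ≢ 0) (sym (hd-⟪⟫ n k)) (sym (tl-⟪⟫ n k))
         (Equivalence.from (gate-≢0 _ _)
           ( Equivalence.from (allB-≢0 _ k) (λ j<k → Equivalence.from (isZero-≢0 _) (miss j<k))
           , subst (_≢ 0) (sym (cong pred hit)) rn≢0 ))
  from : ∃[ t ] probe Q q (hd t) (tl t) ≢ 0 → ∃[ n ] r n ≢ 0
  from (t , h) =
    let n = hd t
        k = tl t
        miss , hit = Equivalence.to (gate-≢0 _ (pred (Q ⟪ n , q ↾ k ⟫))) h
        m , eq     = nonzero-suc _ hit
        k′ , hit′ , miss′ = Qqr n
    in n , ≢0-suc (first-unique (λ j → Q ⟪ n , q ↾ j ⟫) hit′ miss′ (pred-suc _ eq)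
             (λ j<k → Equivalence.to (isZero-≢0 _) (Equivalence.to (allB-≢0 _ k) miss j<k)))

-- Open sets as semidecidable relations, and Π⁰₂ sets

module _ (em : ∀ {ℓ} → ExcludedMiddle ℓ) where
  open Classical em

  true⇔ : ∀ {a} {P : Set a} → does (em {P = P}) ≡ true ⇔ P
  true⇔ = mk⇔ true-does does-true

  -- Names in Sierpinski space are specified through ⊥; excluded middle turns "not all digits are 0"
  -- into a nonzero digit.
  δΣ-true : ∀ {p b} → δΣ p b → b ≡ true ⇔ (∃[ n ] p n ≢ 0)
  δΣ-true {p} {true} pb = mk⇔
    (λ _ → decidable-stable em λ none → contradiction
      (Equivalence.from pb λ n → decidable-stable (p n ≟ 0) λ pn≢0 → none (n , pn≢0)) λ ())
    (λ _ → refl)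
  δΣ-true {p} {false} pb = mk⇔ (λ ())
    (λ (n , pn≢0) → contradiction (Equivalence.to pb refl n) pn≢0)

  true-δΣ : ∀ {p b} → b ≡ true ⇔ (∃[ n ] p n ≢ 0) → δΣ p b
  true-δΣ {p} {true} h = mk⇔ (λ ()) (λ p≡0 →
    let n , pn≢0 = Equivalence.to h refl in contradiction (p≡0 n) pn≢0)
  true-δΣ {p} {false} h = mk⇔
    (λ _ n → decidable-stable (p n ≟ 0) λ pn≢0 → contradiction (Equivalence.from h (n , pn≢0)) λ ())
    (λ _ → refl)

  module _ {X : RepresentedSpace ℓ} {Z : RepresentedSpace ℓ′} {R : Pred (Carrier X × Carrier Z) a}
           (s : SemiDec (X ⊗ Z) R) where
    private
      module X = RepresentedSpace X
      module Z = RepresentedSpace Z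

      run-⊕ : ∀ {p q x z} → X.δ p x → Z.δ q z → (∃[ k ] run s ((p ⊕ q) ↾ k) ≢ 0) ⇔ R (x , z)
      run-⊕ {p} {q} {x} {z} px qz = mk⇔
        (λ (k , h) → run-sound s {p ⊕ q} pq k h)
        (λ Rxz → let K , h = run-complete s {p ⊕ q} pq Rxz in K , h K ≤-refl)
        where
        pq : RepresentedSpace.δ (X ⊗ Z) (p ⊕ q) (x , z)
        pq = δ-⊕ X Z px qz

    opaque
      section : Carrier X → OpenSet Z
      section x = record
        { χ      = λ z → does (em {P = R (x , z)})
        ; χ-cong = λ {z} {z′} z≈z′ → does-⇔ (R-resp z≈z′) (R-resp (Z.≈.sym z≈z′))
        ; isOpen = λ q z qz z∈ →
            let p , px = X.surjective x
                k , h  = Equivalence.from (run-⊕ px qz) (true-does z∈)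
            in k , λ q′ z′ q≈q′ q′z′ → does-true (Equivalence.to (run-⊕ px q′z′)
                 (k , subst (λ w → run s w ≢ 0) (↾-cong k λ i<k → cong ⟪ p _ ,_⟫ (q≈q′ i<k)) h))
        }
        where
        -- Equal points share their names, and acceptance depends on names only.
        R-resp : ∀ {z z′} → z Z.≈ z′ → R (x , z) → R (x , z′)
        R-resp {z} {z′} z≈z′ Rxz =
          let p , px = X.surjective x
              q , qz = Z.surjective z
          in Equivalence.to (run-⊕ px (Z.respects (λ _ → refl) z≈z′ qz))
               (Equivalence.from (run-⊕ px qz) Rxz)

      ∈-section : ∀ {x z} → _∈ₒ_ {X = Z} z (section x) ⇔ R (x , z)
      ∈-section = true⇔

    sectionᵐ : Map X (𝒪 Z) section
    sectionᵐ = totalᵐ {F = λ p xs → sectionName p (lookup xs zero)}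
      (call₂ gateᵗ
        (call₁ isZeroᵗ (call₂ monusᵗ (call₁ hdᵗ v₀) (call₁ lenᵗ (call₁ tlᵗ v₀))))
        (sucᵗ (call₁ (runᵗ s)
          (restrictᵗ (call₂ pairᵗ (query v₀) (call₂ digitᵗ (call₁ tlᵗ v₁) v₀)) (call₁ hdᵗ v₀)))))
      λ p x px → δ𝒪-intro Z (sectionName p) (section x) λ q z qz →
        (λ m → run s ((p ⊕ q) ↾ m)) ,
        (λ m → m , hit p q m , λ {j} → miss p q m j) ,
        true-δΣ (mk⇔ (Equivalence.from (run-⊕ px qz) ∘ Equivalence.to ∈-section)
                     (Equivalence.from ∈-section ∘ Equivalence.to (run-⊕ px qz)))
      where
      -- The m-th digit is printed as soon as m digits w of q have been read.
      answer : Baire → ℕ → ℕ → ℕ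
      answer p m w = gate (isZero (m ∸ len w)) (suc (run s ((p ⊕ digit w) ↾ m)))
      sectionName : Baire → Baire
      sectionName p c = answer p (hd c) (tl c)
      at : ∀ p m w → sectionName p ⟪ m , w ⟫ ≡ answer p m w
      at p m w = cong₂ (answer p) (hd-⟪⟫ m w) (tl-⟪⟫ m w)
      hit : ∀ p q m → sectionName p ⟪ m , q ↾ m ⟫ ≡ suc (run s ((p ⊕ q) ↾ m))
      hit p q m = trans (at p m (q ↾ m)) (trans
        (gate-open _ _ (Equivalence.from (isZero-≢0 _)
          (trans (cong (m ∸_) (len-↾ q m)) (n∸n≡0 m))))
        (cong (suc ∘ run s) (⊕-digit p q m)))
      miss : ∀ p q m j → j < m → sectionName p ⟪ m , q ↾ j ⟫ ≡ 0
      miss p q m j j<m = trans (at p m (q ↾ j)) 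
        (cong (λ a → gate a (suc (run s ((p ⊕ digit (q ↾ j)) ↾ m))))
        (closed (subst (λ l → m ∸ l ≢ 0) (sym (len-↾ q j)) (m>n⇒m∸n≢0 j<m))))
        where
        closed : ∀ {a} → a ≢ 0 → isZero a ≡ 0
        closed {zero}  a≢0 = contradiction refl a≢0
        closed {suc a} _   = 0∸n≡0 a

  module _ (Z : RepresentedSpace ℓ) where
    private module Z = RepresentedSpace Z

    -- A name of U is an oracle for the universal machine, so z ∈ U shows in a nonzero digit printed
    -- on a name of z; `probeᵗ` searches for it.
    evaluate : SemiDec (𝒪 Z ⊗ Z) (λ (U , z) → _∈ₒ_ {X = Z} z U)
    evaluate = searchˢ probeᵗ λ s (U , z) (sU , sz) →
      let r , ηr , rz = δ𝒪-elim Z (left s) U sU (right s) z sz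
          b⇔r = δΣ-true rz
          r⇔t = probe-η (left s) (right s) r ηr
      in mk⇔ (Equivalence.to r⇔t ∘ Equivalence.to b⇔r) (Equivalence.from b⇔r ∘ Equivalence.from r⇔t)

    memberˢ : {g : Carrier W → Z.Carrier} {h : Carrier W → OpenSet Z} →
              Map W Z g → Map W (𝒪 Z) h → SemiDec W (λ w → _∈ₒ_ {X = Z} (g w) (h w))
    memberˢ g h = evaluate ∘ˢ (h ,ᵐ g)

    module _ {A : Pred Z.Carrier a} where

      isΠ⁰₂ : {R : Pred (ℕ × Z.Carrier) b} {S : Pred (ℕ × Z.Carrier) ℓ′} →
              SemiDec (ℕₛ ⊗ Z) R → SemiDec (ℕₛ ⊗ Z) S →
              (∀ z → A z ⇔ (∀ n → R (n , z) → S (n , z))) → IsΠ⁰₂ Z A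
      isΠ⁰₂ r s A⇔ =
        section r , section s , Map.toComputable (sectionᵐ r) , Map.toComputable (sectionᵐ s) ,
        λ z → mk⇔
          (λ Az n → Equivalence.from (∈-section s) ∘ Equivalence.to (A⇔ z) Az n
                    ∘ Equivalence.to (∈-section r))
          (λ h → Equivalence.from (A⇔ z) λ n →
            Equivalence.to (∈-section s) ∘ h n ∘ Equivalence.from (∈-section r))

      module Π⁰₂ (A-Π⁰₂ : IsΠ⁰₂ Z A) where

        U V : ℕ → OpenSet Z
        U = proj₁ A-Π⁰₂
        V = proj₁ (proj₂ A-Π⁰₂)

        A⇔ : ∀ z → A z ⇔ (∀ n → _∈ₒ_ {X = Z} z (U n) → _∈ₒ_ {X = Z} z (V n))
        A⇔ = proj₂ (proj₂ (proj₂ (proj₂ A-Π⁰₂)))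

        ∈U : SemiDec (ℕₛ ⊗ Z) (λ (n , z) → _∈ₒ_ {X = Z} z (U n))
        ∈U = memberˢ sndᵐ
          (fromComputable ℕₛ (𝒪 Z) {U} (proj₁ (proj₂ (proj₂ A-Π⁰₂))) ∘ᵐ fstᵐ)

        ∈V : SemiDec (ℕₛ ⊗ Z) (λ (n , z) → _∈ₒ_ {X = Z} z (V n))
        ∈V = memberˢ sndᵐ
          (fromComputable ℕₛ (𝒪 Z) {V} (proj₁ (proj₂ (proj₂ (proj₂ A-Π⁰₂)))) ∘ᵐ fstᵐ)

    -- The two lists of conditions are merged by a tag: `hd n` is 0 for the first set and nonzero
    -- for the second. Premise and conclusion both carry the tag, so they always belong to the same
    -- list.
    Π⁰₂-∩ : {A : Pred Z.Carrier a} {B : Pred Z.Carrier b} →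
            IsΠ⁰₂ Z A → IsΠ⁰₂ Z B → IsΠ⁰₂ Z (A ∩ B)
    Π⁰₂-∩ {A = A} {B} A-Π⁰₂ B-Π⁰₂ = isΠ⁰₂
      (choose A.U B.U A.∈U B.∈U) (choose A.V B.V A.∈V B.∈V) λ z → mk⇔
      (λ { (Az , Bz) n (inj₁ (eq , z∈U)) → inj₁ (eq , Equivalence.to (A.A⇔ z) Az (tl n) z∈U)
         ; (Az , Bz) n (inj₂ (eq , z∈U)) → inj₂ (eq , Equivalence.to (B.A⇔ z) Bz (tl n) z∈U) })
      (λ h → Equivalence.from (A.A⇔ z) (λ n z∈U → first h n z∈U)
           , Equivalence.from (B.A⇔ z) (λ n z∈U → second h n z∈U))
      where
      module A = Π⁰₂ A-Π⁰₂
      module B = Π⁰₂ B-Π⁰₂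
      Choose : (ℕ → OpenSet Z) → (ℕ → OpenSet Z) → Pred (ℕ × Z.Carrier) _
      Choose U V (n , z) = (isZero (hd n) ≢ 0 × _∈ₒ_ {X = Z} z (U (tl n))) ⊎
                           (hd n ≢ 0 × _∈ₒ_ {X = Z} z (V (tl n)))
      onTail : Map (ℕₛ ⊗ Z) (ℕₛ ⊗ Z) (λ (n , z) → tl n , z)
      onTail = numᵐ tlᵗ fstᵐ ,ᵐ sndᵐ
      nonzero : ∀ {f} → Total₁ f → SemiDec ℕₛ (λ n → f n ≢ 0)
      nonzero f = decideˢ (call₁ f (query (lit 0))) λ { p n refl → mk⇔ id id }
      choose : ∀ U V → SemiDec (ℕₛ ⊗ Z) (λ (n , z) → _∈ₒ_ {X = Z} z (U n)) →
               SemiDec (ℕₛ ⊗ Z) (λ (n , z) → _∈ₒ_ {X = Z} z (V n)) →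
               SemiDec (ℕₛ ⊗ Z) (Choose U V)
      choose _ _ u v = (nonzero (total₁ (call₁ isZeroᵗ (call₁ hdᵗ v₀))) ∘ˢ fstᵐ ×ˢ u ∘ˢ onTail)
                ⊎ˢ (nonzero hdᵗ ∘ˢ fstᵐ ×ˢ v ∘ˢ onTail)
      first : ∀ {z} → (∀ n → Choose A.U B.U (n , z) → Choose A.V B.V (n , z)) →
              ∀ n → _∈ₒ_ {X = Z} z (A.U n) → _∈ₒ_ {X = Z} z (A.V n)
      first h n z∈U with h ⟪ 0 , n ⟫ (inj₁
        ( subst (λ b → isZero b ≢ 0) (sym (hd-⟪⟫ 0 n)) (λ ())
        , subst (λ m → _∈ₒ_ {X = Z} _ (A.U m)) (sym (tl-⟪⟫ 0 n)) z∈U))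
      ... | inj₁ (_ , z∈V)  = subst (λ m → _∈ₒ_ {X = Z} _ (A.V m)) (tl-⟪⟫ 0 n) z∈V
      ... | inj₂ (b≢0 , _)  = contradiction (hd-⟪⟫ 0 n) b≢0
      second : ∀ {z} → (∀ n → Choose A.U B.U (n , z) → Choose A.V B.V (n , z)) →
               ∀ n → _∈ₒ_ {X = Z} z (B.U n) → _∈ₒ_ {X = Z} z (B.V n)
      second h n z∈U with h ⟪ 1 , n ⟫ (inj₂
        ( subst (_≢ 0) (sym (hd-⟪⟫ 1 n)) (λ ())
        , subst (λ m → _∈ₒ_ {X = Z} _ (B.U m)) (sym (tl-⟪⟫ 1 n)) z∈U))
      ... | inj₁ (b≢0 , _)  = contradiction (cong isZero (hd-⟪⟫ 1 n)) b≢0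
      ... | inj₂ (_ , z∈V)  = subst (λ m → _∈ₒ_ {X = Z} _ (B.V m)) (tl-⟪⟫ 1 n) z∈V

≅-trans : ∀ (X : RepresentedSpace ℓ) (Y : RepresentedSpace ℓ′) (Z : RepresentedSpace ℓ″) →
          X ≅ Y → Y ≅ Z → X ≅ Z
≅-trans X Y Z (φ , to , from) (ψ , to′ , from′) =
  inverse φ ψ ,
  Map.toComputable (fromComputable Y Z to′ ∘ᵐ fromComputable X Y to) ,
  Map.toComputable (fromComputable Y X from ∘ᵐ fromComputable Z Y from′)

-- Finite sets of numbers, coded by the strings that enumerate them.

eqB : ℕ → ℕ → ℕ
eqB m n = isZero ((m ∸ n) + (n ∸ m))

eqBᵗ : Total₂ eqB
eqBᵗ = total₂ (call₁ isZeroᵗ (call₂ plusᵗ (call₂ monusᵗ v₀ v₁) (call₂ monusᵗ v₁ v₀)))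

eqB-≢0 : ∀ m n → eqB m n ≢ 0 ⇔ m ≡ n
eqB-≢0 m n = mk⇔
  (λ h → let eq = Equivalence.to (isZero-≢0 _) h in
    ≤-antisym (m∸n≡0⇒m≤n (m+n≡0⇒m≡0 (m ∸ n) eq)) (m∸n≡0⇒m≤n (m+n≡0⇒n≡0 (m ∸ n) eq)))
  (λ { refl → Equivalence.from (isZero-≢0 _) (cong₂ _+_ (n∸n≡0 m) (n∸n≡0 m)) })

anyB : (ℕ → ℕ) → ℕ → ℕ
anyB f = natrec 0 (λ i a → a + f i)

anyBᵗ : {F : Baire → Vec ℕ (suc n) → ℕ} → Total F → Total N →
        Total (λ p xs → anyB (λ i → F p (i ∷ xs)) (N p xs))
anyBᵗ F N = rec (lit 0) (call₂ plusᵗ v₁ (app F (v₀ ∷ᵗ tailᵗ (tailᵗ idᵗ)))) N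

+-≢0 : ∀ m n → m + n ≢ 0 ⇔ (m ≢ 0 ⊎ n ≢ 0)
+-≢0 zero    n = mk⇔ inj₂ λ { (inj₁ h) → contradiction refl h ; (inj₂ h) → h }
+-≢0 (suc m) n = mk⇔ (λ _ → inj₁ λ ()) (λ _ ())

anyB-≢0 : ∀ f n → anyB f n ≢ 0 ⇔ (∃[ i ] i < n × f i ≢ 0)
anyB-≢0 f n = mk⇔ (to n) (λ (i , i<n , h) → from n i<n h)
  where
  to : ∀ n → anyB f n ≢ 0 → ∃[ i ] i < n × f i ≢ 0
  to zero    h = contradiction refl h
  to (suc n) h with Equivalence.to (+-≢0 (anyB f n) (f n)) h
  ... | inj₁ h′ = let i , i<n , fi = to n h′ in i , m≤n⇒m≤1+n i<n , fi
  ... | inj₂ h′ = n , ≤-refl , h′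
  from : ∀ n {i} → i < n → f i ≢ 0 → anyB f n ≢ 0
  from (suc n) (s≤s i≤n) h with m≤n⇒m<n∨m≡n i≤n
  ... | inj₁ i<n  = Equivalence.from (+-≢0 (anyB f n) (f n)) (inj₁ (from n i<n h))
  ... | inj₂ refl = Equivalence.from (+-≢0 (anyB f n) (f n)) (inj₂ h)

infix 4 _∈ꟳ_ _⊆ꟳ_

_∈ꟳ_ : ℕ → ℕ → Set
m ∈ꟳ w = ∃[ i ] digit w i ≡ suc m

_⊆ꟳ_ : ℕ → ℕ → Set
u ⊆ꟳ w = ∀ m → m ∈ꟳ u → m ∈ꟳ w

hd-0 : hd 0 ≡ 0
hd-0 with unpair 0
... | inj₁ _ = refl
... | inj₂ (x , y , eq) = contradiction (sym eq) (⟪⟫≢0 x y)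

digit-beyond : ∀ w i → len w ≤ i → digit w i ≡ hd w
digit-beyond w i l≤i = cong (λ j → hd (tails j w)) (m≤n⇒m∸n≡0 (m≤n⇒m≤1+n l≤i))

-- All digits beyond the end agree, so the index `len w` represents them and tests need only run up
-- to it.
digit-bounded : ∀ w i → ∃[ j ] j < suc (len w) × digit w i ≡ digit w j
digit-bounded w i with i <? suc (len w)
... | yes i<l = i , i<l , refl
... | no  i≮l = len w , ≤-refl ,
  trans (digit-beyond w i (<⇒≤ (≮⇒≥ i≮l))) (sym (digit-beyond w (len w) ≤-refl))

-- Reading past the end of a prefix adds no elements: it repeats the last digit, or gives 0 when the
-- prefix is empty.
digit-range : ∀ p k i {m} → digit (p ↾ k) i ≡ suc m → ∃[ j ] p j ≡ suc m
digit-range p k i eq with i <? k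
... | yes i<k = i , trans (sym (digit-↾ p k i<k)) eq
... | no  i≮k = last k (trans (sym (digit-beyond (p ↾ k) i
                  (subst (_≤ i) (sym (len-↾ p k)) (≮⇒≥ i≮k)))) eq)
  where
  last : ∀ k {m} → hd (p ↾ k) ≡ suc m → ∃[ j ] p j ≡ suc m
  last zero    eq = contradiction (trans (sym hd-0) eq) λ ()
  last (suc k) eq = k , trans (sym (hd-⟪⟫ (p k) (p ↾ k))) eq

within : ℕ → ℕ → ℕ
within u w = allB (λ i → isZero (digit u i) +
                         anyB (λ j → eqB (digit u i) (digit w j)) (suc (len w))) (suc (len u))

withinᵗ : Total₂ within
withinᵗ = total₂ (allBᵗ
  (call₂ plusᵗ (call₁ isZeroᵗ (call₂ digitᵗ v₁ v₀))
    (anyBᵗ (call₂ eqBᵗ (call₂ digitᵗ v₂ v₁) (call₂ digitᵗ v₃ v₀)) (sucᵗ (call₁ lenᵗ v₂))))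
  (sucᵗ (call₁ lenᵗ v₀)))

within-≢0 : ∀ u w → within u w ≢ 0 ⇔ u ⊆ꟳ w
within-≢0 u w = mk⇔ to from
  where
  to : within u w ≢ 0 → u ⊆ꟳ w
  to h m (i , eq)
    with j , j<l , i≡j ← digit-bounded u i
    with Equivalence.to (+-≢0 (isZero (digit u j)) _)
           (Equivalence.to (allB-≢0 _ (suc (len u))) h j<l)
  ... | inj₁ h′ = contradiction (trans (sym eq) (trans i≡j (Equivalence.to (isZero-≢0 _) h′))) λ ()
  ... | inj₂ h′ =
    let k , _ , h″ = Equivalence.to (anyB-≢0 _ (suc (len w))) h′
    in k , trans (sym (Equivalence.to (eqB-≢0 _ _) h″)) (trans (sym i≡j) eq)
  from : u ⊆ꟳ w → within u w ≢ 0
  from u⊆w = Equivalence.from (allB-≢0 _ (suc (len u))) λ {i} _ →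
    Equivalence.from (+-≢0 (isZero (digit u i)) _) (member (digit u i) refl)
    where
    member : ∀ {i} d → digit u i ≡ d → isZero d ≢ 0 ⊎
             anyB (λ j → eqB d (digit w j)) (suc (len w)) ≢ 0
    member zero    _  = inj₁ λ ()
    member {i} (suc m) eq =
      let j , eq′      = u⊆w m (i , eq)
          k , k<l , j≡k = digit-bounded w j
      in inj₂ (Equivalence.from (anyB-≢0 _ (suc (len w)))
           (k , k<l , Equivalence.from (eqB-≢0 _ _) (trans (sym eq′) j≡k)))

⊆ꟳ-trans : ∀ u v w → u ⊆ꟳ v → v ⊆ꟳ w → u ⊆ꟳ w
⊆ꟳ-trans u v w u⊆v v⊆w m = v⊆w m ∘ u⊆v m

≤-↾ : ∀ p k → k ≤ p ↾ k
≤-↾ p zero    = z≤n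
≤-↾ p (suc k) = ≤-trans (s≤s (≤-↾ p k)) (<⟪⟫ (p k) (p ↾ k))

-- Seen aU n w says that the set F w of all m ∈ꟳ w is seen to be in U n by stage w.

seen : (ℕ → ℕ → ℕ) → ℕ → ℕ → ℕ
seen a n w = anyB (λ u → gate (within u w) (a n u)) (suc w)

seenᵗ : {a : ℕ → ℕ → ℕ} → Total₂ a → Total₂ (seen a)
seenᵗ a = total₂ (anyBᵗ (call₂ gateᵗ (call₂ withinᵗ v₀ v₂) (call₂ a v₁ v₀)) (sucᵗ v₁))

Seen : (ℕ → ℕ → ℕ) → ℕ → ℕ → Set
Seen a n w = ∃[ u ] u ≤ w × u ⊆ꟳ w × a n u ≢ 0

seen-≢0 : ∀ a n w → seen a n w ≢ 0 ⇔ Seen a n w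
seen-≢0 a n w = mk⇔
  (λ h → let u , u<1+w , h′ = Equivalence.to (anyB-≢0 _ (suc w)) h
             u⊆w , anu = Equivalence.to (gate-≢0 (within u w) (a n u)) h′
         in u , ≤-pred u<1+w , Equivalence.to (within-≢0 u w) u⊆w , anu)
  (λ (u , u≤w , u⊆w , anu) → Equivalence.from (anyB-≢0 _ (suc w))
    (u , s≤s u≤w , Equivalence.from (gate-≢0 (within u w) (a n u))
                     (Equivalence.from (within-≢0 u w) u⊆w , anu)))

-- This is why `Seen` ranges over all u ≤ w: a string enumerating a larger set need not extend the
-- string that was accepted.
Seen-mono : ∀ a n v w → v ≤ w → v ⊆ꟳ w → Seen a n v → Seen a n w
Seen-mono a n v w v≤w v⊆w (u , u≤v , u⊆v , anu) =
  u , ≤-trans u≤v v≤w , ⊆ꟳ-trans u v w u⊆v v⊆w , anu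

-- The decidable relation on codes of finite sets

module Precedence (aU aV : ℕ → ℕ → ℕ) (aUᵗ : Total₂ aU) (aVᵗ : Total₂ aV) where

  infix 4 _≺_

  _≺_ : Rel ℕ 0ℓ
  w ≺ v = w < v × w ⊆ꟳ v × (∀ n → n < w → Seen aU n w → Seen aV n v)

  -- A request of `w` is answered at `v` already, and the answer persists at `u` by `Seen-mono`.
  ≺-trans : Transitive _≺_
  ≺-trans {w} {v} {u} (w<v , w⊆v , h) (v<u , v⊆u , _) =
    <-trans w<v v<u , ⊆ꟳ-trans w v u w⊆v v⊆u ,
    λ n n<w s → Seen-mono aV n v u (<⇒≤ v<u) v⊆u (h n n<w s)

  precedes : ℕ → ℕ → ℕ
  precedes w v = gate (v ∸ w) (gate (within w v)
    (allB (λ n → isZero (seen aU n w) + seen aV n v) w))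

  precedesᵗ : Total₂ precedes
  precedesᵗ = total₂ (call₂ gateᵗ (call₂ monusᵗ v₁ v₀) (call₂ gateᵗ (call₂ withinᵗ v₀ v₁)
    (allBᵗ (call₂ plusᵗ (call₁ isZeroᵗ (call₂ (seenᵗ aUᵗ) v₀ v₁)) (call₂ (seenᵗ aVᵗ) v₀ v₂)) v₀)))

  precedes-≢0 : ∀ w v → precedes w v ≢ 0 ⇔ w ≺ v
  precedes-≢0 w v = mk⇔ to from
    where
    to : precedes w v ≢ 0 → w ≺ v
    to h =
      let v∸w , h′ = Equivalence.to (gate-≢0 (v ∸ w) _) h
          w⊆v , h″ = Equivalence.to (gate-≢0 (within w v) _) h′
      in ≰⇒> (λ v≤w → v∸w (m≤n⇒m∸n≡0 v≤w)) , Equivalence.to (within-≢0 w v) w⊆v ,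
         λ n n<w s → case n s (Equivalence.to (+-≢0 (isZero (seen aU n w)) _)
                               (Equivalence.to (allB-≢0 _ w) h″ n<w))
      where
      case : ∀ n → Seen aU n w → isZero (seen aU n w) ≢ 0 ⊎ seen aV n v ≢ 0 → Seen aV n v
      case n s (inj₁ h) = contradiction (Equivalence.to (isZero-≢0 _) h)
                                        (Equivalence.from (seen-≢0 aU n w) s)
      case n s (inj₂ h) = Equivalence.to (seen-≢0 aV n v) h
    from : w ≺ v → precedes w v ≢ 0
    from (w<v , w⊆v , h) = Equivalence.from (gate-≢0 (v ∸ w) _)
      (m>n⇒m∸n≢0 w<v , Equivalence.from (gate-≢0 (within w v) _)
        (Equivalence.from (within-≢0 w v) w⊆v ,
         Equivalence.from (allB-≢0 _ w) λ {n} n<w →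
           Equivalence.from (+-≢0 (isZero (seen aU n w)) _) (case n n<w)))
      where
      case : ∀ n → n < w → isZero (seen aU n w) ≢ 0 ⊎ seen aV n v ≢ 0
      case n n<w with seen aU n w in eq
      ... | zero  = inj₁ λ ()
      ... | suc _ = inj₂ (Equivalence.from (seen-≢0 aV n v)
                      (h n n<w (Equivalence.to (seen-≢0 aU n w) (≢0-suc eq))))

  ≺-CE : CE _≺_
  ≺-CE = searchᵖ test , λ w v → mk⇔
    (λ w≺v → Equivalence.to (search-halts test _ _) (0 , Equivalence.from (precedes-≢0 w v) w≺v))
    (λ h → Equivalence.to (precedes-≢0 w v) (proj₂ (Equivalence.from (search-halts test _ _) h)))
    where
    test : Total {3} λ _ xs → precedes (lookup xs (suc zero)) (lookup xs (suc (suc zero)))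
    test = call₂ precedesᵗ v₁ v₂

-- Relativizing to the program `zero` restores the constant oracle of the definition; the actual
-- name only supplies the two arguments.
ceˢ : {_≺_ : Rel ℕ 0ℓ} → CE _≺_ → SemiDec (ℕₛ ⊗ ℕₛ) (λ (x , y) → x ≺ y)
ceˢ {_≺_} (e , e⇔) =
  acceptedBy (comp (relativize e zero) (program hd₀ ∷ program tl₀ ∷ [])) λ
    { p (x , y) (refl , refl) → mk⇔
        (λ x≺y → let z , h = Equivalence.to (e⇔ x y) x≺y in
          z , comp⇓ (x ∷ y ∷ []) (λ { zero → correct hd₀ p [] ; (suc zero) → correct tl₀ p [] })
                (relativize⁺ (λ _ → zero⇓) h))
        (λ { (z , comp⇓ (x′ ∷ y′ ∷ []) xs⇓ h) → Equivalence.from (e⇔ x y) (z ,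
          subst₂ (λ x y → (λ _ → 0) ⊢ e · x ∷ y ∷ [] ⇓ z)
            (⇓-functional (xs⇓ zero) (correct hd₀ p []))
            (⇓-functional (xs⇓ (suc zero)) (correct tl₀ p []))
            (relativize⁻ (λ _ → zero⇓) e h)) }) }
  where
  hd₀ : Total {0} λ p _ → hd (p 0)
  hd₀ = call₁ hdᵗ (query (lit 0))
  tl₀ : Total {0} λ p _ → tl (p 0)
  tl₀ = call₁ tlᵗ (query (lit 0))

-- Enumerations of subsets of ℕ and their finite parts

inclusionᵐ : {Y : RepresentedSpace ℓ} {P : Pred (Carrier Y) ℓ} → Map (subspace Y P) Y proj₁
inclusionᵐ {Y = Y} = totalᵐ {Y = Y} (query v₀) λ p x px → px

enumeratedˢ : {X : RepresentedSpace ℓ} {R : Pred (ℕ × Carrier X) a} →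
              (∀ p x → RepresentedSpace.δ X p x → p enumerates (λ m → R (m , x))) →
              SemiDec (ℕₛ ⊗ X) R
enumeratedˢ h = searchˢ (call₂ eqBᵗ (call₁ tlᵗ (query v₀)) (sucᵗ (call₁ hdᵗ (query (lit 0)))))
  λ { s (m , x) (refl , sx) → mk⇔
    (λ Rm → let i , eq = Equivalence.to (h (right s) x sx m) Rm
            in i , Equivalence.from (eqB-≢0 _ _) eq)
    (λ (i , e) → Equivalence.from (h (right s) x sx m) (i , Equivalence.to (eqB-≢0 _ _) e)) }

rangeˢ : SemiDec (ℕₛ ⊗ Baireₛ) (λ (m , p) → ∃[ i ] p i ≡ suc m)
rangeˢ = enumeratedˢ λ p x p≗x m → mk⇔
  (λ (i , eq) → i , trans (p≗x i) eq)
  (λ (i , eq) → i , trans (sym (p≗x i)) eq)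

digitᵐ : Map ℕₛ Baireₛ digit
digitᵐ = totalᵐ (call₂ digitᵗ (query (lit 0)) v₀) λ { p w refl i → refl }

-- The enumeration `e` is appended to `u`. Hence any string that lists elements of A only is a
-- finite part of an enumeration of A.
extension : {A : Pred ℕ a} → ∀ e → e enumerates A → ∀ u → (∀ m → m ∈ꟳ u → A m) →
            ∃[ p ] p ↾ len u ≡ u × p enumerates A
extension {A = A} e e-enum u u⊆A = e⁺ , prefix , λ m → mk⇔ (to m) (from m)
  where
  e⁺ : Baire
  e⁺ i with i <? len u
  ... | yes _ = digit u i
  ... | no  _ = e (i ∸ len u)
  e⁺< : e⁺ ≈[ len u ] digit u
  e⁺< {i} i<l with i <? len u
  ... | yes _  = refl
  ... | no i≮l = contradiction i<l i≮l
  prefix : e⁺ ↾ len u ≡ u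
  prefix = trans (↾-cong (len u) e⁺<) (digit-↾-id u)
  e⁺≥ : ∀ i → e⁺ (len u + i) ≡ e i
  e⁺≥ i with len u + i <? len u
  ... | yes h = contradiction h (≤⇒≯ (m≤m+n _ _))
  ... | no _  = cong e (m+n∸m≡n (len u) i)
  to : ∀ m → A m → ∃[ i ] e⁺ i ≡ suc m
  to m Am = let i , eq = Equivalence.to (e-enum m) Am in len u + i , trans (e⁺≥ i) eq
  from : ∀ m → ∃[ i ] e⁺ i ≡ suc m → A m
  from m (i , eq) with i <? len u
  ... | yes _ = u⊆A m (i , eq)
  ... | no  _ = Equivalence.from (e-enum m) (_ , eq)

infix 4 _⊆ᵒ_

_⊆ᵒ_ : ℕ → OpenSet ℕₛ → Set
w ⊆ᵒ x = ∀ m → m ∈ꟳ w → m ∈ₒ x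

-- Not computable from a name of x in general; it serves where some enumeration has to exist.
listing : OpenSet ℕₛ → Baire
listing x m with OpenSet.χ x m
... | true  = suc m
... | false = 0

listing-enumerates : ∀ x → listing x enumerates (_∈ₒ x)
listing-enumerates x n = mk⇔ (λ n∈x → n , to n∈x) (λ (i , eq) → from i eq)
  where
  to : n ∈ₒ x → listing x n ≡ suc n
  to n∈x with OpenSet.χ x n
  to refl | true = refl
  from : ∀ i → listing x i ≡ suc n → n ∈ₒ x
  from i eq with OpenSet.χ x i in i∈x
  from i refl | true = i∈x

prefix-⊆ᵒ : ∀ x k p → p enumerates (_∈ₒ x) → (p ↾ k) ⊆ᵒ x
prefix-⊆ᵒ x k p p-enum m (i , eq) = Equivalence.from (p-enum m) (digit-range p k i eq)

rangeˢᵒᵖ : SemiDec (Baireₛ ⊗ ℕₛ) (λ (p , m) → ∃[ i ] p i ≡ suc m)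
rangeˢᵒᵖ = rangeˢ ∘ˢ swapᵐ

-- F w is finite, so the positions at which `p` lists its elements are bounded.
⊆-eventually : ∀ x w p → p enumerates (_∈ₒ x) → w ⊆ᵒ x → Eventually (λ k → w ⊆ꟳ p ↾ k)
⊆-eventually x w p p-enum w⊆x = eventually-map
  (λ k h m (i , eq) → let j , j<l , i≡j = digit-bounded w i in h j<l m (trans (sym i≡j) eq))
  (eventually-< (suc (len w)) λ {i} _ → occurs i (digit w i) refl)
  where
  occurs : ∀ i d → digit w i ≡ d → Eventually (λ k → ∀ m → digit w i ≡ suc m → m ∈ꟳ p ↾ k)
  occurs i zero    eq = 0 , λ _ _ m eq′ → contradiction (trans (sym eq) eq′) λ ()
  occurs i (suc m) eq =
    let j , pj = Equivalence.to (p-enum m) (w⊆x m (i , eq))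
    in suc j , λ k j<k m′ eq′ → j , trans (digit-↾ p k j<k)
         (trans pj (trans (sym eq) eq′))

-- A prefix of `listing x` that reaches m is enough, even if it lists further elements of x.
singleton : ∀ x m → m ∈ₒ x → ∃[ w ] w ⊆ᵒ x × m ∈ꟳ w
singleton x m m∈x =
  let i , eq = Equivalence.to (listing-enumerates x m) m∈x
  in listing x ↾ suc i , prefix-⊆ᵒ x (suc i) (listing x) (listing-enumerates x)
   , i , trans (digit-↾ (listing x) (suc i) ≤-refl) eq

-- Rounded ideals of the relation and their unions

module Ideals (em : ∀ {ℓ} → ExcludedMiddle ℓ)
  (aU aV : ℕ → ℕ → ℕ) (aUᵗ : Total₂ aU) (aVᵗ : Total₂ aV)
  (A : Pred (OpenSet ℕₛ) 0ℓ) (U V : ℕ → Pred (OpenSet ℕₛ) 0ℓ)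
  (A⇔ : ∀ x → A x ⇔ (∀ n → U n x → V n x))
  (U-sound : ∀ x n w → w ⊆ᵒ x → Seen aU n w → U n x)
  (U-complete : ∀ x n p → p enumerates (_∈ₒ x) → U n x → Eventually (λ k → Seen aU n (p ↾ k)))
  (V-sound : ∀ x n w → w ⊆ᵒ x → Seen aV n w → V n x)
  (V-complete : ∀ x n p → p enumerates (_∈ₒ x) → V n x → Eventually (λ k → Seen aV n (p ↾ k)))
  where

  open Precedence aU aV aUᵗ aVᵗ

  -- Only the finitely many n < w with `Seen aU n w` raise a request. For these x ∈ U n, hence x ∈ V
  -- n, and every long enough prefix of `p` shows it.
  ≺-eventually : ∀ x w p → A x → p enumerates (_∈ₒ x) → w ⊆ᵒ x → Eventually (λ k → w ≺ p ↾ k)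
  ≺-eventually x w p Ax p-enum w⊆x = eventually-×
    (suc w , λ k w<k → ≤-trans w<k (≤-↾ p k))
    (eventually-× (⊆-eventually x w p p-enum w⊆x)
      (eventually-map (λ k h n n<w → h n<w) (eventually-< w λ {n} _ → respond n)))
    where
    respond : ∀ n → Eventually (λ k → Seen aU n w → Seen aV n (p ↾ k))
    respond n with seen aU n w ≟ 0
    ... | yes ¬s = 0 , λ _ _ s → contradiction ¬s (Equivalence.from (seen-≢0 aU n w) s)
    ... | no s≢0 = eventually-map (λ k h _ → h) (V-complete x n p p-enum
      (Equivalence.to (A⇔ x) Ax n (U-sound x n w w⊆x (Equivalence.to (seen-≢0 aU n w) s≢0))))

  module Union (I : OpenSet ℕₛ) (rounded : Classical.RoundedIdeal em _≺_ I)
    (⋃I : OpenSet ℕₛ) (∈⋃ : ∀ m → m ∈ₒ ⋃I ⇔ (∃[ w ] w ∈ₒ I × m ∈ꟳ w)) where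
    private
      downward = proj₁ (proj₂ rounded)
      directed = proj₂ (proj₂ rounded)

      ∈I⇒⊆⋃ : ∀ w → w ∈ₒ I → w ⊆ᵒ ⋃I
      ∈I⇒⊆⋃ w w∈I m m∈w = Equivalence.from (∈⋃ m) (w , w∈I , m∈w)

      -- Each element of F w lies in some member of I; directedness merges these members, one digit
      -- at a time.
      cover : ∀ w → w ⊆ᵒ ⋃I → ∀ j →
              ∃[ v ] v ∈ₒ I × (∀ {i} → i < j → ∀ m → digit w i ≡ suc m → m ∈ꟳ v)
      cover w w⊆⋃ zero = let v , v∈I = proj₁ rounded in v , v∈I , λ ()
      cover w w⊆⋃ (suc j) with cover w w⊆⋃ j | digit w j in eq
      ... | v , v∈I , below | zero  = v , v∈I , λ { (s≤s i≤j) → extend (m≤n⇒m<n∨m≡n i≤j) }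
        where
        extend : ∀ {i} → i < j ⊎ i ≡ j → ∀ m → digit w i ≡ suc m → m ∈ꟳ v
        extend (inj₁ i<j)  = below i<j
        extend (inj₂ refl) m eq′ = contradiction (trans (sym eq) eq′) λ ()
      ... | v , v∈I , below | suc n =
        let u , u∈I , n∈u = Equivalence.to (∈⋃ n) (w⊆⋃ n (j , eq))
            z , z∈I , (_ , v⊆z , _) , (_ , u⊆z , _) = directed v∈I u∈I
        in z , z∈I , λ { (s≤s i≤j) → extend z v⊆z (u⊆z n n∈u) (m≤n⇒m<n∨m≡n i≤j) }
        where
        extend : ∀ z → v ⊆ꟳ z → n ∈ꟳ z → ∀ {i} → i < j ⊎ i ≡ j → ∀ m → digit w i ≡ suc m → m ∈ꟳ z
        extend z v⊆z n∈z (inj₁ i<j)  m eq′ = v⊆z m (below i<j m eq′)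
        extend z v⊆z n∈z (inj₂ refl) m eq′ =
          subst (_∈ꟳ z) (suc-injective (trans (sym eq) eq′)) n∈z

      -- Directedness applied to a pair of equal members yields a strictly larger one, as `_≺_`
      -- refines <.
      large : ∀ N v → v ∈ₒ I → ∃[ z ] z ∈ₒ I × N ≤ z × v ⊆ꟳ z
      large zero    v v∈I = v , v∈I , z≤n , λ _ → id
      large (suc N) v v∈I =
        let u , u∈I , N≤u , v⊆u = large N v v∈I
            z , z∈I , (u<z , u⊆z , _) , _ = directed u∈I u∈I
        in z , z∈I , ≤-trans (s≤s N≤u) u<z , ⊆ꟳ-trans v u z v⊆u u⊆z

      above : ∀ w → w ⊆ᵒ ⋃I → ∀ N → ∃[ v ] v ∈ₒ I × N ≤ v × w ⊆ꟳ v
      above w w⊆⋃ N =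
        let v , v∈I , w⊆v = cover w w⊆⋃ (suc (len w))
            z , z∈I , N≤z , v⊆z = large N v v∈I
        in z , z∈I , N≤z , λ m (i , eq) →
             let j , j<l , i≡j = digit-bounded w i in v⊆z m (w⊆v j<l m (trans (sym i≡j) eq))

    -- A finite part `w` shows that the union is in U n. Some member `v` of I also sees this, and a
    -- member `z` above `v` is then obliged to see V n.
    ⋃∈A : A ⋃I
    ⋃∈A = Equivalence.from (A⇔ ⋃I) λ n ⋃I∈U →
      let K , h = U-complete ⋃I n (listing ⋃I) (listing-enumerates ⋃I) ⋃I∈U
          w = listing ⋃I ↾ K
          -- The bound gives both w ≤ v, so that `v` inherits what `w` has seen, and n < v, so that
          -- condition n counts as a request at `v`.
          v , v∈I , wn≤v , w⊆v = 
            above w (prefix-⊆ᵒ ⋃I K (listing ⋃I) (listing-enumerates ⋃I)) (w + suc n)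
          z , z∈I , (_ , _ , v≺z) , _ = directed v∈I v∈I
      in V-sound ⋃I n z (∈I⇒⊆⋃ z z∈I)
           (v≺z n (≤-trans (m≤n+m _ w) wn≤v)
             (Seen-mono aU n w v (≤-trans (m≤m+n w _) wn≤v) w⊆v (h K ≤-refl)))

    -- An ideal is recovered from its union: with v ∈ I above `w` and z ∈ I above `v`, each request
    -- of `w` is one of `v`, so `z` answers it. Thus w ≺ z, and I is closed downwards.
    ⊆⋃⇔∈ : ∀ w → w ⊆ᵒ ⋃I ⇔ w ∈ₒ I
    ⊆⋃⇔∈ w = mk⇔
      (λ w⊆⋃ →
        let v , v∈I , w≤v , w⊆v = above w w⊆⋃ w
            z , z∈I , (v<z , v⊆z , v≺z) , _ = directed v∈I v∈I
        in downward z∈I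
             ( ≤-trans (s≤s w≤v) v<z , ⊆ꟳ-trans w v z w⊆v v⊆z
             , λ n n<w s → v≺z n (≤-trans n<w w≤v) (Seen-mono aU n w v w≤v w⊆v s)))
      (∈I⇒⊆⋃ w)

-- Spaces of rounded ideals and Π⁰₂ subspaces of 𝒪(ℕ)

module _ (em : ∀ {ℓ} → ExcludedMiddle ℓ) where
  open Classical em

  range : Baire → OpenSet ℕₛ
  range = section em rangeˢᵒᵖ

  rangeᵐ : Map Baireₛ (𝒪 ℕₛ) range
  rangeᵐ = sectionᵐ em rangeˢᵒᵖ

  range-≈ : ∀ p x → p enumerates (_∈ₒ x) → _≈𝒪_ ℕₛ x (range p)
  range-≈ p x p-enum m = true-iff
    (Equivalence.from (∈-section em rangeˢᵒᵖ) ∘ Equivalence.to (p-enum m))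
    (Equivalence.from (p-enum m) ∘ Equivalence.to (∈-section em rangeˢᵒᵖ))

  memberℕ : SemiDec (ℕₛ ⊗ 𝒪 ℕₛ) (λ (m , x) → m ∈ₒ x)
  memberℕ = memberˢ em ℕₛ fstᵐ sndᵐ

  ⊆ᵒˢ : SemiDec (𝒪 ℕₛ ⊗ ℕₛ) (λ (x , w) → w ⊆ᵒ x)
  ⊆ᵒˢ = searchˢ {F = λ s xs → test (tl (s 0)) (left s) (lookup xs zero)}
    (call₂ withinᵗ (call₁ tlᵗ (query (lit 0)))
      (restrictᵗ (app (relativizeᵗ (enumerationᵗ memberℕ) (call₁ hdᵗ (query v₀))) (v₀ ∷ᵗ []ᵗ)) v₀))
    λ { s (x , w) (sx , refl) → test-≢0 w (left s) x sx }
    where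
    test : ℕ → Baire → ℕ → ℕ
    test w p k = within w (enumeration memberℕ p ↾ k)
    test-≢0 : ∀ w p x → RepresentedSpace.δ (𝒪 ℕₛ) p x → w ⊆ᵒ x ⇔ (∃[ k ] test w p k ≢ 0)
    test-≢0 w p x px = mk⇔
      (λ w⊆x → let K , h = ⊆-eventually x w e e-enum w⊆x
                in K , Equivalence.from (within-≢0 _ _) (h K ≤-refl))
      (λ (k , h) m m∈w → prefix-⊆ᵒ x k e e-enum m (Equivalence.to (within-≢0 _ _) h m m∈w))
      where
      e : Baire
      e = enumeration memberℕ p
      e-enum : e enumerates (_∈ₒ x)
      e-enum = enumeration-enumerates memberℕ {p = p} {x} px

  RoundedIdeal-Π⁰₂ : ∀ {_≺_} → CE _≺_ → IsΠ⁰₂ (𝒪 ℕₛ) (RoundedIdeal _≺_)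
  RoundedIdeal-Π⁰₂ {_≺_} ce = Π⁰₂-∩ em (𝒪 ℕₛ) nonempty (Π⁰₂-∩ em (𝒪 ℕₛ) downward directed)
    where
    ≺ˢ : SemiDec (ℕₛ ⊗ ℕₛ) (λ (x , y) → x ≺ y)
    ≺ˢ = ceˢ ce
    hdᵐ : Map (ℕₛ ⊗ 𝒪 ℕₛ) ℕₛ (λ (n , _) → hd n)
    hdᵐ = numᵐ hdᵗ fstᵐ
    tlᵐ : Map (ℕₛ ⊗ 𝒪 ℕₛ) ℕₛ (λ (n , _) → tl n)
    tlᵐ = numᵐ tlᵗ fstᵐ
    hd∈ : SemiDec (ℕₛ ⊗ 𝒪 ℕₛ) (λ (n , I) → hd n ∈ₒ I)
    hd∈ = memberℕ ∘ˢ (hdᵐ ,ᵐ sndᵐ)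
    tl∈ : SemiDec (ℕₛ ⊗ 𝒪 ℕₛ) (λ (n , I) → tl n ∈ₒ I)
    tl∈ = memberℕ ∘ˢ (tlᵐ ,ᵐ sndᵐ)
    always : SemiDec (ℕₛ ⊗ 𝒪 ℕₛ) (λ _ → 1 ≢ 0)
    always = decideˢ (lit 1) λ _ _ _ → mk⇔ id id
    nonempty : IsΠ⁰₂ (𝒪 ℕₛ) (λ I → ∃[ x ] x ∈ₒ I)
    nonempty = isΠ⁰₂ em (𝒪 ℕₛ) always (∃ˢ memberℕ ∘ˢ sndᵐ)
      λ I → mk⇔ (λ h _ _ → h) (λ h → h 0 λ ())
    downward : IsΠ⁰₂ (𝒪 ℕₛ) (λ I → ∀ {x y} → y ∈ₒ I → x ≺ y → x ∈ₒ I)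
    downward = isΠ⁰₂ em (𝒪 ℕₛ) (tl∈ ×ˢ ≺ˢ ∘ˢ (hdᵐ ,ᵐ tlᵐ)) hd∈
      λ I → mk⇔ (λ h n (y∈I , x≺y) → h y∈I x≺y)
        λ h {x} {y} y∈I x≺y → subst (_∈ₒ I) (hd-⟪⟫ x y) (h ⟪ x , y ⟫
          ( subst (_∈ₒ I) (sym (tl-⟪⟫ x y)) y∈I
          , subst₂ _≺_ (sym (hd-⟪⟫ x y)) (sym (tl-⟪⟫ x y)) x≺y))
    directed : IsΠ⁰₂ (𝒪 ℕₛ) (λ I → ∀ {x y} → x ∈ₒ I → y ∈ₒ I → ∃[ z ] z ∈ₒ I × x ≺ z × y ≺ z)
    directed = isΠ⁰₂ em (𝒪 ℕₛ) (hd∈ ×ˢ tl∈)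
      (∃ˢ (memberℕ ∘ˢ (fstᵐ ,ᵐ sndᵐ ∘ᵐ sndᵐ)
        ×ˢ ≺ˢ ∘ˢ (hdᵐ ∘ᵐ sndᵐ ,ᵐ fstᵐ) ×ˢ ≺ˢ ∘ˢ (tlᵐ ∘ᵐ sndᵐ ,ᵐ fstᵐ)))
      λ I → mk⇔ (λ h n (x∈I , y∈I) → h x∈I y∈I)
        λ h {x} {y} x∈I y∈I →
          let z , z∈I , x≺z , y≺z = h ⟪ x , y ⟫
                ( subst (_∈ₒ I) (sym (hd-⟪⟫ x y)) x∈I , subst (_∈ₒ I) (sym (tl-⟪⟫ x y)) y∈I)
          in z , z∈I , subst (_≺ z) (hd-⟪⟫ x y) x≺z , subst (_≺ z) (tl-⟪⟫ x y) y≺z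

  module _ {A : Pred (OpenSet ℕₛ) 0ℓ} (A-Π⁰₂ : IsΠ⁰₂ (𝒪 ℕₛ) A) where

    open Π⁰₂ em (𝒪 ℕₛ) {A = A} A-Π⁰₂

    private
      -- Pulling U back along `range` allows it to be tested on strings, read as finite parts of
      -- enumerations.
      rangeU : SemiDec (ℕₛ ⊗ Baireₛ) (λ (n , p) → _∈ₒ_ {X = 𝒪 ℕₛ} (range p) (U n))
      rangeU = ∈U ∘ˢ (fstᵐ ,ᵐ rangeᵐ ∘ᵐ sndᵐ)

      rangeV : SemiDec (ℕₛ ⊗ Baireₛ) (λ (n , p) → _∈ₒ_ {X = 𝒪 ℕₛ} (range p) (V n))
      rangeV = ∈V ∘ˢ (fstᵐ ,ᵐ rangeᵐ ∘ᵐ sndᵐ)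

      aU aV : ℕ → ℕ → ℕ
      aU = run₂ rangeU
      aV = run₂ rangeV

    open Precedence aU aV (run₂ᵗ rangeU) (run₂ᵗ rangeV)

    private
      module _ (U : ℕ → OpenSet (𝒪 ℕₛ))
               (s : SemiDec (ℕₛ ⊗ Baireₛ) (λ (n , p) → _∈ₒ_ {X = 𝒪 ℕₛ} (range p) (U n))) where

        -- The accepted string lists elements of x only, so it begins some enumeration of x, and
        -- acceptance takes place within it.
        seen-sound : ∀ x n w → w ⊆ᵒ x → Seen (run₂ s) n w → _∈ₒ_ {X = 𝒪 ℕₛ} x (U n)
        seen-sound x n w w⊆x (u , _ , u⊆w , anu) =
          let p , eq , p-enum = extension (listing x) (listing-enumerates x) u (λ m → w⊆x m ∘ u⊆w m)
          in trans (OpenSet.χ-cong (U n) (range-≈ p x p-enum))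
               (run₂-sound s {p} {p} (λ _ → refl) n (len u)
                 (subst (λ v → run₂ s n v ≢ 0) (sym eq) anu))

        seen-complete : ∀ x n p → p enumerates (_∈ₒ x) → _∈ₒ_ {X = 𝒪 ℕₛ} x (U n) →
                        Eventually (λ k → Seen (run₂ s) n (p ↾ k))
        seen-complete x n p p-enum x∈U = eventually-map
          (λ k anp → p ↾ k , ≤-refl , (λ _ → id) , anp)
          (run₂-complete s {p} {p} (λ _ → refl) n
            (trans (sym (OpenSet.χ-cong (U n) (range-≈ p x p-enum))) x∈U))

    open Ideals em aU aV (run₂ᵗ rangeU) (run₂ᵗ rangeV) A
      (λ n x → _∈ₒ_ {X = 𝒪 ℕₛ} x (U n)) (λ n x → _∈ₒ_ {X = 𝒪 ℕₛ} x (V n)) A⇔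
      (seen-sound U rangeU) (seen-complete U rangeU)
      (seen-sound V rangeV) (seen-complete V rangeV)

    private
      codes : SemiDec (subspace (𝒪 ℕₛ) A ⊗ ℕₛ) (λ ((x , _) , w) → w ⊆ᵒ x)
      codes = ⊆ᵒˢ ∘ˢ (inclusionᵐ {Y = 𝒪 ℕₛ} ∘ᵐ fstᵐ ,ᵐ sndᵐ)

      union : SemiDec (RI _≺_ ⊗ ℕₛ) (λ ((I , _) , m) → ∃[ w ] w ∈ₒ I × m ∈ꟳ w)
      union = ∃ˢ (memberℕ ∘ˢ (fstᵐ ,ᵐ inclusionᵐ {Y = 𝒪 ℕₛ} ∘ᵐ fstᵐ ∘ᵐ sndᵐ)
               ×ˢ rangeˢ ∘ˢ (sndᵐ ∘ᵐ sndᵐ ,ᵐ digitᵐ ∘ᵐ fstᵐ))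

      ideal : Σ (OpenSet ℕₛ) A → OpenSet ℕₛ
      ideal = section em codes

      ⋃ : Σ (OpenSet ℕₛ) (RoundedIdeal _≺_) → OpenSet ℕₛ
      ⋃ = section em union

      ∈ideal : ∀ {x w} → w ∈ₒ ideal x ⇔ w ⊆ᵒ proj₁ x
      ∈ideal = ∈-section em codes

      ∈⋃ : ∀ {I m} → m ∈ₒ ⋃ I ⇔ (∃[ w ] w ∈ₒ proj₁ I × m ∈ꟳ w)
      ∈⋃ = ∈-section em union

      ideal-rounded : ∀ x → RoundedIdeal _≺_ (ideal x)
      ideal-rounded (x , Ax) =
          (0 , Equivalence.from ∈ideal (prefix-⊆ᵒ x 0 (listing x) (listing-enumerates x)))
        , (λ {w} {v} v∈ (_ , w⊆v , _) → Equivalence.from ∈ideal λ m →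
            Equivalence.to ∈ideal v∈ m ∘ w⊆v m)
        , λ {w} {v} w∈ v∈ →
            -- One long prefix of `listing x` lies above both codes.
            let K , h = eventually-×
                  (≺-eventually x w (listing x) Ax (listing-enumerates x)
                    (Equivalence.to ∈ideal w∈))
                  (≺-eventually x v (listing x) Ax (listing-enumerates x)
                    (Equivalence.to ∈ideal v∈))
            in listing x ↾ K ,
               Equivalence.from ∈ideal (prefix-⊆ᵒ x K (listing x) (listing-enumerates x)) ,
               h K ≤-refl

      ⋃∈A : ∀ I rounded → A (⋃ (I , rounded))
      ⋃∈A I rounded = Union.⋃∈A I rounded (⋃ (I , rounded)) λ m → ∈⋃

      ⊆⋃⇔∈ : ∀ I rounded w → w ⊆ᵒ ⋃ (I , rounded) ⇔ w ∈ₒ I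
      ⊆⋃⇔∈ I rounded = Union.⊆⋃⇔∈ I rounded (⋃ (I , rounded)) λ m → ∈⋃

      ideal-mono : ∀ {x y w} → (∀ m → m ∈ₒ proj₁ x → m ∈ₒ proj₁ y) → w ∈ₒ ideal x → w ∈ₒ ideal y
      ideal-mono x⊆y w∈ = Equivalence.from ∈ideal λ m → x⊆y m ∘ Equivalence.to ∈ideal w∈ m

      ⋃-mono : ∀ I J {m} → (∀ w → w ∈ₒ proj₁ I → w ∈ₒ proj₁ J) → m ∈ₒ ⋃ I → m ∈ₒ ⋃ J
      ⋃-mono I J {m} I⊆J m∈ =
        let w , w∈I , m∈w = Equivalence.to (∈⋃ {I} {m}) m∈
        in Equivalence.from (∈⋃ {J} {m}) (w , I⊆J w w∈I , m∈w)

    private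
      idealᵐ : Map (subspace (𝒪 ℕₛ) A) (𝒪 ℕₛ) ideal
      idealᵐ = sectionᵐ em {X = subspace (𝒪 ℕₛ) A} {Z = ℕₛ} {R = λ ((x , _) , w) → w ⊆ᵒ x} codes

      toᵐ : Map (subspace (𝒪 ℕₛ) A) (RI _≺_) (λ x → ideal x , ideal-rounded x)
      -- Names in a subspace are the names in the ambient space, so the realizer carries over.
      toᵐ = realizedBy (Map.realizer idealᵐ) (Map.realizes idealᵐ)

      ⋃ᵐ : Map (RI _≺_) (𝒪 ℕₛ) ⋃
      ⋃ᵐ = sectionᵐ em {X = RI _≺_} {Z = ℕₛ}
        {R = λ ((I , _) , m) → ∃[ w ] w ∈ₒ I × m ∈ꟳ w} union

      fromᵐ : Map (RI _≺_) (subspace (𝒪 ℕₛ) A) (λ (I , rounded) → ⋃ (I , rounded) , ⋃∈A I rounded)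
      fromᵐ = realizedBy (Map.realizer ⋃ᵐ) (Map.realizes ⋃ᵐ)

      bijection : Inverse (RepresentedSpace.points (subspace (𝒪 ℕₛ) A))
                          (RepresentedSpace.points (RI _≺_))
      bijection = record
        { to        = λ x → ideal x , ideal-rounded x
        ; from      = λ (I , rounded) → ⋃ (I , rounded) , ⋃∈A I rounded
        ; to-cong   = λ x≈y w → true-iff
            (ideal-mono (λ m → trans (sym (x≈y m)))) (ideal-mono (λ m → trans (x≈y m)))
        ; from-cong = λ {I} {J} I≈J m → true-iff
              (⋃-mono I J (λ w → trans (sym (I≈J w)))) (⋃-mono J I (λ w → trans (I≈J w)))
        ; inverse   =
            (λ {I} {x} x≈⋃I w → true-iff
              (λ w∈ → Equivalence.to (⊆⋃⇔∈ (proj₁ I) (proj₂ I) w)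
                λ m m∈w → trans (sym (x≈⋃I m)) (Equivalence.to ∈ideal w∈ m m∈w))
              (λ w∈I → Equivalence.from ∈ideal λ m m∈w → trans (x≈⋃I m)
                (Equivalence.from (⊆⋃⇔∈ (proj₁ I) (proj₂ I) w) w∈I m m∈w)))
          , (λ {x} {I} I≈x m → true-iff
              (λ m∈ → let w , w∈I , m∈w = Equivalence.to (∈⋃ {I} {m}) m∈
                      in Equivalence.to ∈ideal (trans (sym (I≈x w)) w∈I) m m∈w)
              (λ m∈x → let w , w⊆x , m∈w = singleton (proj₁ x) m m∈x
                       in Equivalence.from (∈⋃ {I} {m})
                            (w , trans (I≈x w) (Equivalence.from ∈ideal w⊆x) , m∈w)))
        }

    A≅RI : subspace (𝒪 ℕₛ) A ≅ RI _≺_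
    A≅RI = bijection , Map.toComputable toᵐ , Map.toComputable fromᵐ

    ideal-presentation : Σ (Rel ℕ 0ℓ) λ _≺_ → CE _≺_ × Transitive _≺_ × subspace (𝒪 ℕₛ) A ≅ RI _≺_
    ideal-presentation = _≺_ , ≺-CE , (λ {w} {v} {u} → ≺-trans {w} {v} {u}) , A≅RI

-- Enumerations as names of points of a Π⁰₂ subspace

≈ᵐ : {X : RepresentedSpace ℓ} {Y : RepresentedSpace ℓ′} {f g : Carrier X → Carrier Y} →
     Map X Y f → (∀ x → RepresentedSpace._≈_ Y (f x) (g x)) → Map X Y g
≈ᵐ {Y = Y} (realizedBy e h) f≈g = realizedBy e λ p x px →
  let q , pq , qy = h p x px in q , pq , RepresentedSpace.respects Y (λ _ → refl) (f≈g x) qy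

-- The acceptor may treat the name as a point of Baire space, provided its verdict depends on the
-- named point only.
by-namesˢ : {X : RepresentedSpace ℓ} {Z : RepresentedSpace ℓ′}
            {R : Pred (Carrier X × Carrier Z) a} {S : Pred (Baire × Carrier Z) b} →
            SemiDec (Baireₛ ⊗ Z) S →
            (∀ p x z → RepresentedSpace.δ X p x → R (x , z) ⇔ S (p , z)) → SemiDec (X ⊗ Z) R
by-namesˢ (acceptedBy e h) R⇔S = acceptedBy e λ s (x , z) (sx , sz) →
  let R⇔ = R⇔S (left s) x z sx
      S⇔ = h s (left s , z) ((λ _ → refl) , sz)
  in mk⇔ (Equivalence.to S⇔ ∘ Equivalence.to R⇔) (Equivalence.from R⇔ ∘ Equivalence.from S⇔)

-- The digit suc j of u selects the j-th digit of e, and 0 selects the digit 0.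

sample : Baire → ℕ → Baire
sample e u i = natrec 0 (λ j _ → e j) (digit u i)

sampleᵐ : Map (ℕₛ ⊗ Baireₛ) Baireₛ (λ (u , e) → sample e u)
sampleᵐ = totalᵐ {X = ℕₛ ⊗ Baireₛ} {Y = Baireₛ}
  (rec (lit 0) (call₁ tlᵗ (query v₀)) (call₂ digitᵗ (call₁ hdᵗ (query (lit 0))) v₀))
  λ { s (u , e) (refl , se) i → natrec-cong refl (λ j _ → se j) (digit (hd (s 0)) i) }

module _ {A : Pred ℕ a} (e : Baire) (e-enum : e enumerates A) where

  sample-complete : ∀ p → p enumerates A → ∀ k → ∃[ u ] p ≈[ k ] sample e u
  sample-complete p p-enum k = index ↾ k , λ {i} i<k →
    sym (trans (cong (natrec 0 (λ j _ → e j)) (digit-↾ index k i<k)) (proj₂ (find i (p i) refl)))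
    where
    find : ∀ i d → p i ≡ d → ∃[ j ] natrec 0 (λ j _ → e j) j ≡ p i
    find i zero    eq = 0 , sym eq
    find i (suc m) eq =
      let j , eq′ = Equivalence.to (e-enum m) (Equivalence.from (p-enum m) (i , eq))
      in suc j , trans eq′ (sym eq)
    index : Baire
    index i = proj₁ (find i (p i) refl)

  -- A sample lists elements of A only, but perhaps not all of them. It need not be a name itself,
  -- yet each finite part of it begins one.
  sample-extends : ∀ u k → ∃[ p ] p enumerates A × sample e u ≈[ k ] p
  sample-extends u k =
    let v = sample e u ↾ k
        p , eq , p-enum = extension e e-enum v λ m (i , eq) →
          let j , eq′ = digit-range (sample e u) k i eq in select m (digit u j) eq′
        _ , v≈p = ↾-injective {sample e u} {p} k (len v) (sym eq)
    in p , p-enum , v≈p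
    where
    select : ∀ m d → natrec 0 (λ j _ → e j) d ≡ suc m → A m
    select m (suc j) eq = Equivalence.from (e-enum m) (j , eq)

module _ (em : ∀ {ℓ} → ExcludedMiddle ℓ) where
  open Classical em

  -- The closure of a fibre meets an open set iff the fibre itself does.

  MeetsFibre : (X : RepresentedSpace ℓ) → Pred (Carrier X × OpenSet Baireₛ) ℓ
  MeetsFibre X (x , U) = ∃[ p ] RepresentedSpace.δ X p x × p ∈ₒ U

  module _ (X : RepresentedSpace ℓ) where
    private
      module X = RepresentedSpace X

      fibre : X.Carrier → ClosedSet Baireₛ
      fibre x = closure Baireₛ (λ p → X.δ p x)

      ∈hits⇔ : ∀ x U → _∈ₒ_ {X = 𝒪 Baireₛ} U (hits Baireₛ (fibre x)) ⇔ MeetsFibre X (x , U)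
      ∈hits⇔ x U = mk⇔
        (λ h → let p , p∈U , adherent = true-does {P = Meets Baireₛ (fibre x) U} h
               in true-does {P = Adherent Baireₛ (λ p → X.δ p x) p} adherent U p∈U)
        (λ (p , px , p∈U) → does-true {P = Meets Baireₛ (fibre x) U}
          (p , p∈U , does-true {P = Adherent Baireₛ (λ p → X.δ p x) p} λ V p∈V → p , px , p∈V))

    fibreOvert⁺ : SemiDec (X ⊗ 𝒪 Baireₛ) (MeetsFibre X) → EffectivelyFiberOvert X
    fibreOvert⁺ s = Map.toComputable {f = fibre}
      -- A name of a closed set is by definition a name of the open set `hits`.
      (realizedBy {X = X} {Y = 𝒱 Baireₛ} (Map.realizer hitsᵐ) (Map.realizes hitsᵐ))
      where
      hitsᵐ : Map X (𝒪 (𝒪 Baireₛ)) (λ x → hits Baireₛ (fibre x))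
      hitsᵐ = ≈ᵐ {X = X} {Y = 𝒪 (𝒪 Baireₛ)}
        (sectionᵐ em {X = X} {Z = 𝒪 Baireₛ} {R = MeetsFibre X} s)
        λ x U → true-iff
          (Equivalence.from (∈hits⇔ x U) ∘ Equivalence.to (∈-section em s))
          (Equivalence.from (∈-section em s) ∘ Equivalence.to (∈hits⇔ x U))

    fibreOvert⁻ : EffectivelyFiberOvert X → SemiDec (X ⊗ 𝒪 Baireₛ) (MeetsFibre X)
    fibreOvert⁻ overt = ⇔ˢ (λ (x , U) → ∈hits⇔ x U)
      (memberˢ em (𝒪 Baireₛ) {W = X ⊗ 𝒪 Baireₛ} {g = proj₂} {h = λ (x , _) → hits Baireₛ (fibre x)}
        sndᵐ (_∘ᵐ_ {f = λ x → hits Baireₛ (fibre x)} {g = proj₁} hitsᵐ fstᵐ))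
      where
      closureᵐ : Map X (𝒱 Baireₛ) fibre
      closureᵐ = fromComputable X (𝒱 Baireₛ) {fibre} overt
      hitsᵐ : Map X (𝒪 (𝒪 Baireₛ)) (λ x → hits Baireₛ (fibre x))
      hitsᵐ = realizedBy (Map.realizer closureᵐ) (Map.realizes closureᵐ)

  module Enumerated (X : RepresentedSpace ℓ) {A : Pred (OpenSet ℕₛ) 0ℓ} (A-Π⁰₂ : IsΠ⁰₂ (𝒪 ℕₛ) A)
                    (X≅A : X ≅ subspace (𝒪 ℕₛ) A) where
    private
      module X = RepresentedSpace X
      module A = Π⁰₂ em (𝒪 ℕₛ) {A = A} A-Π⁰₂

      toA : X.Carrier → Σ (OpenSet ℕₛ) A
      toA = Inverse.to (proj₁ X≅A)

      fromA : Σ (OpenSet ℕₛ) A → X.Carrier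
      fromA = Inverse.from (proj₁ X≅A)

      φ : X.Carrier → OpenSet ℕₛ
      φ = proj₁ ∘ toA

      φ-injective : ∀ {x y} → _≈𝒪_ ℕₛ (φ x) (φ y) → x X.≈ y
      φ-injective {x} {y} φx≈φy = X.≈.trans
        (X.≈.sym (proj₂ (Inverse.inverse (proj₁ X≅A)) {x} {toA y} λ m → sym (φx≈φy m)))
        (proj₂ (Inverse.inverse (proj₁ X≅A)) {y} {toA y} λ m → refl)

      φ-cong : ∀ {x y} → x X.≈ y → _≈𝒪_ ℕₛ (φ x) (φ y)
      φ-cong = Inverse.to-cong (proj₁ X≅A)

      enumerates-≈ : ∀ p x y → p enumerates (_∈ₒ x) → p enumerates (_∈ₒ y) → _≈𝒪_ ℕₛ x y
      enumerates-≈ p x y px py m = true-iff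
        (Equivalence.from (py m) ∘ Equivalence.to (px m))
        (Equivalence.from (px m) ∘ Equivalence.to (py m))

    ρ : Representation X.points
    ρ = record
      { δ          = λ p x → Lift _ (p enumerates (_∈ₒ φ x))
      ; respects   = λ p≗q x≈y (lift h) → lift λ m → mk⇔
          (λ m∈ → let i , eq = Equivalence.to (h m) (trans (φ-cong x≈y m) m∈)
                  in i , trans (sym (p≗q i)) eq)
          (λ (i , eq) → trans (sym (φ-cong x≈y m)) (Equivalence.from (h m) (i , trans (p≗q i) eq)))
      ; functional = λ {p} {x} {y} (lift h) (lift h′) →
          φ-injective (enumerates-≈ p (φ x) (φ y) h h′)
      ; surjective = λ x → listing (φ x) , lift (listing-enumerates (φ x))
      }

    X′ : RepresentedSpace _
    X′ = record { points = X.points ; representation = ρ }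

    private
      ∈φ : SemiDec (ℕₛ ⊗ X) (λ (m , x) → m ∈ₒ φ x)
      ∈φ = memberˢ em ℕₛ fstᵐ (_∘ᵐ_ {f = φ} {g = proj₂} φᵐ sndᵐ)
        where
        toᵐ : Map X (subspace (𝒪 ℕₛ) A) toA
        toᵐ = fromComputable X (subspace (𝒪 ℕₛ) A) {toA} (proj₁ (proj₂ X≅A))
        φᵐ : Map X (𝒪 ℕₛ) φ
        φᵐ = realizedBy (Map.realizer toᵐ) (Map.realizes toᵐ)

      ∈φ′ : SemiDec (ℕₛ ⊗ X′) (λ (m , x) → m ∈ₒ φ x)
      ∈φ′ = enumeratedˢ λ p x (lift h) → h

      ∈φ″ : SemiDec (X′ ⊗ ℕₛ) (λ (x , m) → m ∈ₒ φ x)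
      ∈φ″ = ∈φ′ ∘ˢ swapᵐ

    X→X′ : Map X X′ id
    X→X′ = totalᵐ {X = X} {Y = X′} (enumerationᵗ ∈φ) λ p x px → lift (enumeration-enumerates ∈φ px)

    X′→X : Map X′ X id
    X′→X = ≈ᵐ {X = X′} {Y = X}
      (_∘ᵐ_ {Y = subspace (𝒪 ℕₛ) A} {f = fromA} {g = toA}
        (fromComputable (subspace (𝒪 ℕₛ) A) X {fromA} (proj₂ (proj₂ X≅A))) toᵐ)
      λ x → proj₂ (Inverse.inverse (proj₁ X≅A)) {x} {toA x} λ m → refl
      where
      φᵐ : Map X′ (𝒪 ℕₛ) φ
      φᵐ = ≈ᵐ {X = X′} {Y = 𝒪 ℕₛ} (sectionᵐ em {X = X′} {Z = ℕₛ} {R = λ (x , m) → m ∈ₒ φ x} ∈φ″)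
        λ x m → true-iff (Equivalence.to (∈-section em ∈φ″)) (Equivalence.from (∈-section em ∈φ″))
      toᵐ : Map X′ (subspace (𝒪 ℕₛ) A) toA
      toᵐ = realizedBy (Map.realizer φᵐ) (Map.realizes φᵐ)

    X′-fibreOvert : EffectivelyFiberOvert X′
    X′-fibreOvert = fibreOvert⁺ X′ (by-namesˢ {X = X′} {Z = 𝒪 Baireₛ} (∃ˢ sampled) sampled⇔)
      where
      sampled : SemiDec (ℕₛ ⊗ (Baireₛ ⊗ 𝒪 Baireₛ)) (λ (u , (e , U)) → sample e u ∈ₒ U)
      sampled = memberˢ em Baireₛ (sampleᵐ ∘ᵐ (fstᵐ ,ᵐ fstᵐ ∘ᵐ sndᵐ)) (sndᵐ ∘ᵐ sndᵐ)
      sampled⇔ : ∀ e x U → RepresentedSpace.δ X′ e x →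
                 MeetsFibre X′ (x , U) ⇔ (∃[ u ] sample e u ∈ₒ U)
      sampled⇔ e x U (lift e-enum) = mk⇔
        (λ (p , lift p-enum , p∈U) →
          let k , inU = OpenSet.isOpen U p p (λ _ → refl) p∈U
              u , p≈  = sample-complete e e-enum p p-enum k
          in u , inU (sample e u) (sample e u) p≈ λ _ → refl)
        (λ (u , u∈U) →
          let k , inU = OpenSet.isOpen U (sample e u) (sample e u) (λ _ → refl) u∈U
              p , p-enum , ≈p = sample-extends e e-enum u k
          in p , lift p-enum , inU p p ≈p λ _ → refl)

    -- The neighbourhoods of x determine φ x, because m ∈ φ x iff `containing m` is one of them.
    -- Enumerating these m from a name of the neighbourhood family produces a name of x.
    X′-admissible : ComputablyAdmissible X′
    X′-admissible = injective , Total.program (enumerationᵗ inside) , recovers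
      where
      containing : ℕ → OpenSet X′
      containing = section em ∈φ′
      containingᵐ : Map ℕₛ (𝒪 X′) containing
      containingᵐ = sectionᵐ em {X = ℕₛ} {Z = X′} {R = λ (m , x) → m ∈ₒ φ x} ∈φ′
      ∈containing : ∀ m x → _∈ₒ_ {X = X′} x (containing m) ⇔ m ∈ₒ φ x
      ∈containing m x = ∈-section em ∈φ′ {m} {x}
      injective : ∀ {x y} → _≈𝒪_ (𝒪 X′) (nbhds X′ x) (nbhds X′ y) → x X.≈ y
      injective {x} {y} h = φ-injective λ m → true-iff
        (λ m∈ → Equivalence.to (∈containing m y)
          (trans (sym (h (containing m))) (Equivalence.from (∈containing m x) m∈)))
        (λ m∈ → Equivalence.to (∈containing m x)
          (trans (h (containing m)) (Equivalence.from (∈containing m y) m∈)))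
      inside : SemiDec (ℕₛ ⊗ 𝒪 (𝒪 X′)) (λ (m , 𝒰) → _∈ₒ_ {X = 𝒪 X′} (containing m) 𝒰)
      inside = memberˢ em (𝒪 X′) {W = ℕₛ ⊗ 𝒪 (𝒪 X′)} {g = λ (m , _) → containing m} {h = proj₂}
        (_∘ᵐ_ {f = containing} {g = proj₁} containingᵐ fstᵐ) sndᵐ
      recovers : IsRealizer (𝒪 (𝒪 X′)) X′ ⟦ Total.program (enumerationᵗ inside) ⟧
                   (λ 𝒰 x → _≈𝒪_ (𝒪 X′) (nbhds X′ x) 𝒰)
      recovers p 𝒰 p𝒰 (x , x≈𝒰) =
        enumeration inside p , (λ n → Total.correct (enumerationᵗ inside) p (n ∷ [])) ,
        x , lift (λ m →
          let ∈𝒰⇔ = enumeration-enumerates inside {p} {𝒰} p𝒰 m in mk⇔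
          (λ m∈ → Equivalence.to ∈𝒰⇔
            (trans (sym (x≈𝒰 (containing m))) (Equivalence.from (∈containing m x) m∈)))
          (λ h → Equivalence.to (∈containing m x)
            (trans (x≈𝒰 (containing m)) (Equivalence.from ∈𝒰⇔ h)))) ,
        x≈𝒰

    -- A sequence is a name iff its range lies in A, so the conditions for A pull back along
    -- `range`.
    X′-dom : IsΠ⁰₂ Baireₛ (RepresentedSpace.dom X′)
    X′-dom = isΠ⁰₂ em Baireₛ (A.∈U ∘ˢ onRange) (A.∈V ∘ˢ onRange) λ p → mk⇔
      (λ (x , lift h) n p∈U →
        trans (sym (OpenSet.χ-cong (A.V n) (range-≈ em p (φ x) h)))
          (Equivalence.to (A.A⇔ (φ x)) (proj₂ (toA x)) n
            (trans (OpenSet.χ-cong (A.U n) (range-≈ em p (φ x) h)) p∈U)))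
      (λ h → let S = range em p , Equivalence.from (A.A⇔ (range em p)) h
                 x = fromA S
                 φx≈ = proj₁ (Inverse.inverse (proj₁ X≅A)) {S} {x} X.≈.refl
             in x , lift λ m → mk⇔
               (λ m∈ → Equivalence.to (∈-section em rangeˢᵒᵖ {p} {m}) (trans (sym (φx≈ m)) m∈))
               (λ i → trans (φx≈ m) (Equivalence.from (∈-section em rangeˢᵒᵖ {p} {m}) i)))
      where
      onRange : Map (ℕₛ ⊗ Baireₛ) (ℕₛ ⊗ 𝒪 ℕₛ) (λ (n , p) → n , range em p)
      onRange = fstᵐ ,ᵐ _∘ᵐ_ {f = range em} {g = proj₂} (rangeᵐ em) sndᵐ

    admits : Admits X λ X′ → EffectivelyFiberOvert X′ × ComputablyAdmissible X′ ×
                             IsΠ⁰₂ Baireₛ (RepresentedSpace.dom X′)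
    admits = ρ , Map.toComputable X→X′ , Map.toComputable X′→X ,
             X′-fibreOvert , X′-admissible , X′-dom

-- Extension of strings and generic paths

Prefix : ℕ → ℕ → Set
Prefix v u = len v ≤ len u × digit v ≈[ len v ] digit u

Prefix-refl : ∀ v → Prefix v v
Prefix-refl v = ≤-refl , λ _ → refl

Prefix-trans : ∀ u v w → Prefix u v → Prefix v w → Prefix u w
Prefix-trans u v w (lu≤lv , u≈v) (lv≤lw , v≈w) =
  ≤-trans lu≤lv lv≤lw , λ i<lu → trans (u≈v i<lu) (v≈w (≤-trans i<lu lu≤lv))

≈⇒↾ : ∀ p w → digit w ≈[ len w ] p → p ↾ len w ≡ w
≈⇒↾ p w w≈p = trans (sym (↾-cong (len w) w≈p)) (digit-↾-id w)

↾⇒≈ : ∀ p w → p ↾ len w ≡ w → p ≈[ len w ] digit w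
↾⇒≈ p w eq = proj₂ (↾-injective {p} {digit w} (len w) (len w) (trans eq (sym (digit-↾-id w))))

⊕-string-cong : ∀ w → p ≗ q → ⊕-string p w ≡ ⊕-string q w
⊕-string-cong w p≗q = ↾-cong (len w) λ {i} _ → cong (λ d → ⟪ d , digit w i ⟫) (p≗q i)

run-⊕ˢ : {R : Pred (Carrier X) a} (s : SemiDec X R) →
         SemiDec (ℕₛ ⊗ Baireₛ) (λ (w , Q) → run s (⊕-string Q w) ≢ 0)
run-⊕ˢ s = decideˢ {F = λ r _ → run s (⊕-string (right r) (hd (r 0)))}
  (call₁ (runᵗ s) (⊕-stringᵗ (call₁ tlᵗ (query v₀)) (call₁ hdᵗ (query (lit 0)))))
  λ { r (w , Q) (refl , rQ) → mk⇔
    (λ h → h ∘ trans (cong (run s) (⊕-string-cong (hd (r 0)) (sym ∘ rQ))))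
    (λ h → h ∘ trans (cong (run s) (⊕-string-cong (hd (r 0)) rQ))) }

-- Stated by an equation of codes so as to be decidable; the strict inequality makes the generic
-- path infinite.
Extends : ℕ → ℕ → Set
Extends v u = len v < len u × digit u ↾ len v ≡ v

Extends⇒Prefix : ∀ v u → Extends v u → Prefix v u
Extends⇒Prefix v u (lv<lu , eq) = <⇒≤ lv<lu , λ i<lv → sym (↾⇒≈ (digit u) v eq i<lv)

extendsˢ : SemiDec (ℕₛ ⊗ ℕₛ) (λ (v , u) → Extends v u)
extendsˢ = decideˢ {F = λ p _ → test (hd (p 0)) (tl (p 0))}
  (call₂ testᵗ (call₁ hdᵗ (query (lit 0))) (call₁ tlᵗ (query (lit 0))))
  λ { p (v , u) (refl , refl) → test-≢0 (hd (p 0)) (tl (p 0)) }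
  where
  test : ℕ → ℕ → ℕ
  test v u = gate (len u ∸ len v) (eqB (digit u ↾ len v) v)
  testᵗ : Total₂ test
  testᵗ = total₂ (call₂ gateᵗ (call₂ monusᵗ (call₁ lenᵗ v₁) (call₁ lenᵗ v₀))
    (call₂ eqBᵗ (restrictᵗ (call₂ digitᵗ v₂ v₀) (call₁ lenᵗ v₀)) v₀))
  test-≢0 : ∀ v u → Extends v u ⇔ test v u ≢ 0
  test-≢0 v u = mk⇔
    (λ (lv<lu , eq) → Equivalence.from (gate-≢0 (len u ∸ len v) _)
      (m>n⇒m∸n≢0 lv<lu , Equivalence.from (eqB-≢0 (digit u ↾ len v) v) eq))
    (λ h → let h₁ , h₂ = Equivalence.to (gate-≢0 (len u ∸ len v) _) h
           in ≰⇒> (λ lu≤lv → h₁ (m≤n⇒m∸n≡0 lu≤lv)) , Equivalence.to (eqB-≢0 _ v) h₂)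

extends-eventually : ∀ p v → p ↾ len v ≡ v → Eventually (λ k → Extends v (p ↾ k))
extends-eventually p v eq = suc (len v) , λ k lv<k →
  subst (len v <_) (sym (len-↾ p k)) lv<k ,
  trans (↾-cong (len v) λ i<lv → digit-↾ p k (<-trans i<lv lv<k)) eq

cylinderˢ : SemiDec (ℕₛ ⊗ Baireₛ) (λ (w , p) → p ↾ len w ≡ w)
cylinderˢ = decideˢ {F = λ s _ → eqB (right s ↾ len (hd (s 0))) (hd (s 0))}
  (call₂ eqBᵗ (restrictᵗ (call₁ tlᵗ (query v₀)) (call₁ lenᵗ (call₁ hdᵗ (query (lit 0)))))
    (call₁ hdᵗ (query (lit 0))))
  λ { s (w , p) (refl , sp) → mk⇔
    (λ eq → Equivalence.from (eqB-≢0 _ _) (trans (↾-cong (len w) (λ {i} _ → sp i)) eq))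
    (λ h → trans (sym (↾-cong (len w) (λ {i} _ → sp i))) (Equivalence.to (eqB-≢0 _ _) h)) }

decideᵗ : {f : ℕ → ℕ → ℕ} → Total₂ f → SemiDec (ℕₛ ⊗ ℕₛ) (λ (m , n) → f m n ≢ 0)
decideᵗ f = decideˢ (call₂ f (call₁ hdᵗ (query (lit 0))) (call₁ tlᵗ (query (lit 0))))
  λ { p (m , n) (refl , refl) → mk⇔ id id }

-- A path with infinitely many prefixes in S that meets all requests "accept w"
-- for w in S and "satisfy V n" for those n whose U n it satisfies.  Stage i
-- serves the requests with number hd i, so each number is served infinitely often.

module Generic (S : Pred ℕ 0ℓ) (S? : ∀ w → S w ⊎ ¬ S w) (forces aU aV : ℕ → ℕ → ℕ)
  (nonempty : ∃[ w ] S w)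
  (accept : ∀ w v → S w → S v → ∃[ u ] S u × Extends v u × forces w u ≢ 0)
  (satisfy : ∀ n v → S v → aU n v ≢ 0 → ∃[ u ] S u × Extends v u × aV n u ≢ 0)
  where

  private
    Node : Set
    Node = ∃[ w ] S w

    first : ∀ n ((v , _) : Node) → Σ Node λ (u , _) → Extends v u × (S n → forces n u ≢ 0)
    first n (v , v∈S) with S? n
    ... | inj₁ n∈S = let u , u∈S , ext , f = accept n v n∈S v∈S in (u , u∈S) , ext , λ _ → f
    -- Without a request the string must still grow, so `v` itself is accepted once more.
    ... | inj₂ n∉S = let u , u∈S , ext , _ = accept v v v∈S v∈S
                     in (u , u∈S) , ext , λ n∈S → contradiction n∈S n∉S

    second : ∀ n ((v , _) : Node) → Σ Node λ (u , _) → Prefix v u × (aU n v ≢ 0 → aV n u ≢ 0)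
    second n (v , v∈S) with aU n v ≟ 0
    ... | yes eq = (v , v∈S) , Prefix-refl v , contradiction eq
    ... | no neq = let u , u∈S , ext , h = satisfy n v v∈S neq
                   in (u , u∈S) , Extends⇒Prefix v u ext , λ _ → h

    node half : ℕ → Node
    node zero    = nonempty
    node (suc i) = proj₁ (second (hd i) (half i))
    half i       = proj₁ (first (hd i) (node i))

    at between : ℕ → ℕ
    at i      = proj₁ (node i)
    between i = proj₁ (half i)

    at-between : ∀ i → Extends (at i) (between i)
    at-between i = proj₁ (proj₂ (first (hd i) (node i)))

    between-at : ∀ i → Prefix (between i) (at (suc i))
    between-at i = proj₁ (proj₂ (second (hd i) (half i)))

    at-suc : ∀ i → Prefix (at i) (at (suc i))
    at-suc i = Prefix-trans (at i) (between i) (at (suc i))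
      (Extends⇒Prefix (at i) (between i) (at-between i)) (between-at i)

    at-+ : ∀ i d → Prefix (at i) (at (d + i))
    at-+ i zero    = Prefix-refl (at i)
    at-+ i (suc d) = Prefix-trans (at i) (at (d + i)) (at (suc d + i)) (at-+ i d) (at-suc (d + i))

    at-mono : ∀ {i j} → i ≤ j → Prefix (at i) (at j)
    at-mono {i} {j} i≤j = subst (λ k → Prefix (at i) (at k)) (m∸n+n≡m i≤j) (at-+ i (j ∸ i))

    i≤at : ∀ i → i ≤ len (at i)
    i≤between : ∀ i → i < len (between i)
    i≤at zero    = z≤n
    i≤at (suc i) = ≤-trans (i≤between i) (proj₁ (between-at i))
    i≤between i  = ≤-trans (s≤s (i≤at i)) (proj₁ (at-between i))

  -- The strings `at i` form a chain and `at (suc i)` has more than i digits, so this digit is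
  -- final.
  path : Baire
  path i = digit (at (suc i)) i

  private
    at≈path : ∀ i → digit (at i) ≈[ len (at i) ] path
    at≈path i {j} j<l with ≤-total i (suc j)
    ... | inj₁ i≤1+j = proj₂ (at-mono i≤1+j) j<l
    ... | inj₂ 1+j≤i = sym (proj₂ (at-mono 1+j≤i) (i≤at (suc j)))

    path-at : ∀ i → path ↾ len (at i) ≡ at i
    path-at i = ≈⇒↾ path (at i) (at≈path i)

    path-between : ∀ i → path ↾ len (between i) ≡ between i
    path-between i = ≈⇒↾ path (between i) λ j<l →
      trans (proj₂ (between-at i) j<l) (at≈path (suc i) (≤-trans j<l (proj₁ (between-at i))))

  path-accepts : ∀ w → S w → ∃[ k ] forces w (path ↾ k) ≢ 0
  path-accepts w w∈S = len (between t₀) ,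
    subst₂ (λ n v → forces n v ≢ 0) (hd-⟪⟫ w 0) (sym (path-between t₀))
    (proj₂ (proj₂ (first (hd t₀) (node t₀))) (subst S (sym (hd-⟪⟫ w 0)) w∈S))
    where
    t₀ : ℕ
    t₀ = ⟪ w , 0 ⟫

  -- Stage ⟪ n , K ⟫ serves number n, and its string is longer than K. As acceptance holds at all
  -- lengths from K on, it is noticed at this stage.
  path-satisfies : ∀ n → Eventually (λ k → aU n (path ↾ k) ≢ 0) → ∃[ k ] aV n (path ↾ k) ≢ 0
  path-satisfies n (K , h) = len (at (suc t₀)) ,
    subst₂ (λ n v → aV n v ≢ 0) (hd-⟪⟫ n K) (sym (path-at (suc t₀)))
      (proj₂ (proj₂ (second (hd t₀) (half t₀)))
        (subst₂ (λ n v → aU n v ≢ 0) (sym (hd-⟪⟫ n K)) (path-between t₀)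
          (h (len (between t₀)) (<⇒≤ (<-trans (<⟪⟫ n K) (i≤between t₀))))))
    where
    t₀ : ℕ
    t₀ = ⟪ n , K ⟫

  path-in : ∀ K → ∃[ k ] K ≤ k × S (path ↾ k)
  path-in K = len (at K) , i≤at K , subst S (sym (path-at K)) (proj₂ (node K))

  opaque
    generic : ∃[ p ] (∀ w → S w → ∃[ k ] forces w (p ↾ k) ≢ 0)
                   × (∀ n → Eventually (λ k → aU n (p ↾ k) ≢ 0) → ∃[ k ] aV n (p ↾ k) ≢ 0)
                   × (∀ K → ∃[ k ] K ≤ k × S (p ↾ k))
    generic = path , path-accepts , path-satisfies , path-in

-- Points as sets of prefixes of their names

module _ (em : ∀ {ℓ} → ExcludedMiddle ℓ) where
  open Classical em

  module Fibres (X : RepresentedSpace ℓ) (overt : EffectivelyFiberOvert X)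
                (admissible : ComputablyAdmissible X)
                (dom-Π⁰₂ : IsΠ⁰₂ Baireₛ (RepresentedSpace.dom X)) where
    private
      module X = RepresentedSpace X
      open Π⁰₂ em Baireₛ {A = X.dom} dom-Π⁰₂

    Touches : ℕ → X.Carrier → Set _
    Touches w x = ∃[ p ] X.δ p x × p ↾ len w ≡ w

    private
      cylinder : ℕ → OpenSet Baireₛ
      cylinder = section em cylinderˢ

      cylinderᵐ : Map ℕₛ (𝒪 Baireₛ) cylinder
      cylinderᵐ = sectionᵐ em {X = ℕₛ} {Z = Baireₛ} {R = λ (w , p) → p ↾ len w ≡ w} cylinderˢ

      touchesˢ : SemiDec (ℕₛ ⊗ X) (λ (w , x) → Touches w x)
      touchesˢ = ⇔ˢ
        (λ (w , x) → mk⇔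
          (λ (p , px , p∈) → p , px , Equivalence.to (∈-section em cylinderˢ {w} {p}) p∈)
          (λ (p , px , eq) → p , px , Equivalence.from (∈-section em cylinderˢ {w} {p}) eq))
        (_∘ˢ_ {Y = X ⊗ 𝒪 Baireₛ} {X = ℕₛ ⊗ X} {R = MeetsFibre em X} {f = λ (w , x) → x , cylinder w}
          (fibreOvert⁻ em X overt) (sndᵐ ,ᵐ _∘ᵐ_ {f = cylinder} {g = proj₁} cylinderᵐ fstᵐ))

      touchesˢ′ : SemiDec (X ⊗ ℕₛ) (λ (x , w) → Touches w x)
      touchesˢ′ = touchesˢ ∘ˢ swapᵐ

      touches-prefix : ∀ {p x} → X.δ p x → ∀ k → Touches (p ↾ k) x
      touches-prefix {p} px k = p , px , cong (p ↾_) (len-↾ p k)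

      trace : X.Carrier → OpenSet ℕₛ
      trace = section em touchesˢ′

      ∈trace : ∀ w x → w ∈ₒ trace x ⇔ Touches w x
      ∈trace w x = ∈-section em touchesˢ′ {x} {w}

      forces aU aV : ℕ → ℕ → ℕ
      forces = run₂ touchesˢ
      aU     = run₂ ∈U
      aV     = run₂ ∈V

    -- `forces w v` verifies on the finite part v of a name that the named point touches w. So
    -- members of S can always be confirmed further along, conditions for the domain can always be
    -- met, and whatever a member confirms is in S.
    Nonempty Accepting Satisfying Saturated : Pred (OpenSet ℕₛ) 0ℓ
    Nonempty S   = ∃[ w ] w ∈ₒ S
    Accepting S  = ∀ w v → w ∈ₒ S → v ∈ₒ S → ∃[ u ] u ∈ₒ S × Extends v u × forces w u ≢ 0
    Satisfying S = ∀ n v → v ∈ₒ S → aU n v ≢ 0 → ∃[ u ] u ∈ₒ S × Extends v u × aV n u ≢ 0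
    Saturated S  = ∀ w v → v ∈ₒ S → forces w v ≢ 0 → w ∈ₒ S

    Traces : Pred (OpenSet ℕₛ) 0ℓ
    Traces = Nonempty ∩ (Accepting ∩ (Satisfying ∩ Saturated))

    private
      answer : (a : ℕ → ℕ → ℕ) → Total₂ a →
               SemiDec (ℕₛ ⊗ 𝒪 ℕₛ) (λ (n , S) → ∃[ u ] u ∈ₒ S × Extends (tl n) u × a (hd n) u ≢ 0)
      answer a aᵗ = ∃ˢ (memberℕ em ∘ˢ (fstᵐ ,ᵐ sndᵐ ∘ᵐ sndᵐ)
        ×ˢ extendsˢ ∘ˢ (numᵐ tlᵗ (fstᵐ ∘ᵐ sndᵐ) ,ᵐ fstᵐ)
        ×ˢ decideᵗ aᵗ ∘ˢ (numᵐ hdᵗ (fstᵐ ∘ᵐ sndᵐ) ,ᵐ fstᵐ))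

      hd∈ : SemiDec (ℕₛ ⊗ 𝒪 ℕₛ) (λ (n , S) → hd n ∈ₒ S)
      hd∈ = memberℕ em ∘ˢ (numᵐ hdᵗ fstᵐ ,ᵐ sndᵐ)

      tl∈ : SemiDec (ℕₛ ⊗ 𝒪 ℕₛ) (λ (n , S) → tl n ∈ₒ S)
      tl∈ = memberℕ em ∘ˢ (numᵐ tlᵗ fstᵐ ,ᵐ sndᵐ)

      holds : (a : ℕ → ℕ → ℕ) → Total₂ a → SemiDec (ℕₛ ⊗ 𝒪 ℕₛ) (λ (n , S) → a (hd n) (tl n) ≢ 0)
      holds a aᵗ = decideᵗ aᵗ ∘ˢ (numᵐ hdᵗ fstᵐ ,ᵐ numᵐ tlᵗ fstᵐ)

      pairs : {P : ℕ → ℕ → Set} → (∀ n → P (hd n) (tl n)) → ∀ x y → P x y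
      pairs {P} h x y = subst₂ P (hd-⟪⟫ x y) (tl-⟪⟫ x y) (h ⟪ x , y ⟫)

    Traces-Π⁰₂ : IsΠ⁰₂ (𝒪 ℕₛ) Traces
    Traces-Π⁰₂ = Π⁰₂-∩ em (𝒪 ℕₛ) nonempty
      (Π⁰₂-∩ em (𝒪 ℕₛ) accepting (Π⁰₂-∩ em (𝒪 ℕₛ) satisfying saturated))
      where
      nonempty : IsΠ⁰₂ (𝒪 ℕₛ) Nonempty
      nonempty = isΠ⁰₂ em (𝒪 ℕₛ) {R = λ _ → 1 ≢ 0}
        (decideˢ (lit 1) λ _ _ _ → mk⇔ id id) (∃ˢ (memberℕ em) ∘ˢ sndᵐ)
        λ S → mk⇔ (λ h _ _ → h) (λ h → h 0 λ ())
      accepting : IsΠ⁰₂ (𝒪 ℕₛ) Accepting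
      accepting = isΠ⁰₂ em (𝒪 ℕₛ) (hd∈ ×ˢ tl∈) (answer forces (run₂ᵗ touchesˢ)) λ S → mk⇔
        (λ h n (w∈S , v∈S) → h (hd n) (tl n) w∈S v∈S)
        (λ h → pairs {λ w v → w ∈ₒ S → v ∈ₒ S → ∃[ u ] u ∈ₒ S × Extends v u × forces w u ≢ 0}
          λ n w∈S v∈S → h n (w∈S , v∈S))
      satisfying : IsΠ⁰₂ (𝒪 ℕₛ) Satisfying
      satisfying = isΠ⁰₂ em (𝒪 ℕₛ) (tl∈ ×ˢ holds aU (run₂ᵗ ∈U)) (answer aV (run₂ᵗ ∈V)) λ S → mk⇔
        (λ h n (v∈S , anv) → h (hd n) (tl n) v∈S anv)
        (λ h → pairs {λ n v → v ∈ₒ S → aU n v ≢ 0 → ∃[ u ] u ∈ₒ S × Extends v u × aV n u ≢ 0}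
          λ n v∈S anv → h n (v∈S , anv))
      saturated : IsΠ⁰₂ (𝒪 ℕₛ) Saturated
      saturated = isΠ⁰₂ em (𝒪 ℕₛ) (tl∈ ×ˢ holds forces (run₂ᵗ touchesˢ)) hd∈ λ S → mk⇔
        (λ h n (v∈S , f) → h (hd n) (tl n) v∈S f)
        (λ h → pairs {λ w v → v ∈ₒ S → forces w v ≢ 0 → w ∈ₒ S} λ n v∈S f → h n (v∈S , f))

    -- A string in the trace is a prefix of a name p of x; the extensions asked for are longer
    -- prefixes of the same p.
    trace-Traces : ∀ x → Traces (trace x)
    trace-Traces x = nonempty , accepting , satisfying , saturated
      where
      nonempty : Nonempty (trace x)
      nonempty = let p , px = X.surjective x
                 in p ↾ 0 , Equivalence.from (∈trace _ x) (touches-prefix px 0)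
      accepting : Accepting (trace x)
      accepting w v w∈ v∈ =
        let p , px , eq = Equivalence.to (∈trace v x) v∈
            K , h = eventually-× (extends-eventually p v eq)
                      (run₂-complete touchesˢ {p} {x} px w (Equivalence.to (∈trace w x) w∈))
            ext , f = h K ≤-refl
        in p ↾ K , Equivalence.from (∈trace _ x) (touches-prefix px K) , ext , f
      satisfying : Satisfying (trace x)
      satisfying n v v∈ anv =
        let p , px , eq = Equivalence.to (∈trace v x) v∈
            p∈U = run₂-sound ∈U {p} {p} (λ _ → refl) n (len v)
                    (subst (λ w → aU n w ≢ 0) (sym eq) anv)
            p∈V = Equivalence.to (A⇔ p) (x , px) n p∈U
            K , h = eventually-× (extends-eventually p v eq)
                      (run₂-complete ∈V {p} {p} (λ _ → refl) n p∈V)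
            ext , f = h K ≤-refl
        in p ↾ K , Equivalence.from (∈trace _ x) (touches-prefix px K) , ext , f
      saturated : Saturated (trace x)
      saturated w v v∈ f =
        let p , px , eq = Equivalence.to (∈trace v x) v∈
        in Equivalence.from (∈trace w x)
             (run₂-sound touchesˢ {p} {x} px w (len v) (subst (λ u → forces w u ≢ 0) (sym eq) f))

    private
      ∈? : ∀ (S : OpenSet ℕₛ) w → w ∈ₒ S ⊎ ¬ (w ∈ₒ S)
      ∈? S w with OpenSet.χ S w
      ... | true  = inj₁ refl
      ... | false = inj₂ λ ()

      opaque
        -- The path satisfies V n whenever it is in U n, so it names some x. It forces each w in S,
        -- so x touches w. Conversely, a touched w is forced by all long prefixes, of which some are
        -- in S; `Saturated` then gives w ∈ S.
        realize : ∀ S → Traces S → ∃[ x ] ∀ w → w ∈ₒ S ⇔ Touches w x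
        realize S (nonempty , accepting , satisfying , saturated) =
          let p , accepts , satisfies , prefixes =
                Generic.generic (_∈ₒ S) (∈? S) forces aU aV nonempty accepting satisfying
              x , px = Equivalence.from (A⇔ p) λ n p∈U →
                let k , h = satisfies n (run₂-complete ∈U {p} {p} (λ _ → refl) n p∈U)
                in run₂-sound ∈V {p} {p} (λ _ → refl) n k h
          in x , λ w → mk⇔
            (λ w∈S → let k , f = accepts w w∈S in run₂-sound touchesˢ {p} {x} px w k f)
            (λ t → let K , h       = run₂-complete touchesˢ {p} {x} px w t
                       k , K≤k , k∈S = prefixes K
                   in saturated w (p ↾ k) k∈S (h k K≤k))

      point : ∀ S → Traces S → X.Carrier
      point S s = proj₁ (realize S s)

      ∈S⇔ : ∀ S s w → w ∈ₒ S ⇔ Touches w (point S s)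
      ∈S⇔ S s = proj₂ (realize S s)

      toPoint : Σ (OpenSet ℕₛ) Traces → X.Carrier
      toPoint (S , s) = point S s

      -- A finite part of a name of x already guarantees membership in U, and y has a name with the
      -- same finite part.
      touched-open : ∀ x y → (∀ w → Touches w x → Touches w y) →
                     ∀ (U : OpenSet X) → _∈ₒ_ {X = X} x U → _∈ₒ_ {X = X} y U
      touched-open x y x⇒y U x∈U =
        let p , px  = X.surjective x
            k , inU = OpenSet.isOpen U p x px x∈U
            q , qy , eq = x⇒y (p ↾ k) (touches-prefix px k)
        in inU q y (proj₂ (↾-injective {p} {q} k k (sym (trans (cong (q ↾_) (sym (len-↾ p k))) eq)))) qy

      Touches-injective : ∀ x y → (∀ w → Touches w x ⇔ Touches w y) → x X.≈ y
      Touches-injective x y x⇔y = proj₁ admissible λ U → true-iff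
        (touched-open x y (λ w → Equivalence.to (x⇔y w)) U)
        (touched-open y x (λ w → Equivalence.from (x⇔y w)) U)

      Touches-resp : ∀ {x y} → x X.≈ y → ∀ w → Touches w x → Touches w y
      Touches-resp x≈y w (p , px , eq) = p , X.respects (λ _ → refl) x≈y px , eq

      bijection : Inverse X.points (RepresentedSpace.points (subspace (𝒪 ℕₛ) Traces))
      bijection = record
        { to        = λ x → trace x , trace-Traces x
        ; from      = toPoint
        ; to-cong   = λ {x} {y} x≈y w → true-iff
            (Equivalence.from (∈trace w y) ∘ Touches-resp x≈y w ∘ Equivalence.to (∈trace w x))
            (Equivalence.from (∈trace w x) ∘ Touches-resp (X.≈.sym x≈y) w ∘ Equivalence.to (∈trace w y))
        ; from-cong = λ {(S , s)} {(T , t)} S≈T → Touches-injective (point S s) (point T t) λ w → mk⇔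
            (Equivalence.to (∈S⇔ T t w) ∘ trans (sym (S≈T w)) ∘ Equivalence.from (∈S⇔ S s w))
            (Equivalence.to (∈S⇔ S s w) ∘ trans (S≈T w) ∘ Equivalence.from (∈S⇔ T t w))
        ; inverse   =
            (λ {(S , s)} {x} x≈S w → true-iff
              (Equivalence.from (∈S⇔ S s w) ∘ Touches-resp x≈S w ∘ Equivalence.to (∈trace w x))
              (Equivalence.from (∈trace w x) ∘ Touches-resp (X.≈.sym x≈S) w ∘ Equivalence.to (∈S⇔ S s w)))
          , (λ {x} {(S , s)} S≈x → Touches-injective (point S s) x λ w → mk⇔
              (Equivalence.to (∈trace w x) ∘ trans (sym (S≈x w)) ∘ Equivalence.from (∈S⇔ S s w))
              (Equivalence.to (∈S⇔ S s w) ∘ trans (S≈x w) ∘ Equivalence.from (∈trace w x)))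
        }

      traceᵐ : Map X (𝒪 ℕₛ) trace
      traceᵐ = sectionᵐ em {X = X} {Z = ℕₛ} {R = λ (x , w) → Touches w x} touchesˢ′

      toᵐ : Map X (subspace (𝒪 ℕₛ) Traces) (λ x → trace x , trace-Traces x)
      toᵐ = realizedBy (Map.realizer traceᵐ) (Map.realizes traceᵐ)

      evaluateX : SemiDec (𝒪 X ⊗ X) (λ (U , x) → _∈ₒ_ {X = X} x U)
      evaluateX = evaluate em X

      accepted : Baire → ℕ → ℕ
      accepted Q w = run evaluateX (⊕-string Q w)

      point∈⇔ : ∀ Q U S s → δ𝒪 X Q U →
                _∈ₒ_ {X = X} (point S s) U ⇔ (∃[ w ] w ∈ₒ S × accepted Q w ≢ 0)
      point∈⇔ Q U S s QU = mk⇔ to from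
        where
        to : _∈ₒ_ {X = X} (point S s) U → ∃[ w ] w ∈ₒ S × accepted Q w ≢ 0
        to x∈U =
          let p , px = X.surjective (point S s)
              K , h  = run-complete evaluateX {Q ⊕ p} {U , point S s}
                         (δ-⊕ (𝒪 X) X {Q} {p} {U} {point S s} QU px) x∈U
          in p ↾ K , Equivalence.from (∈S⇔ S s (p ↾ K)) (touches-prefix px K) ,
             subst (λ w → run evaluateX w ≢ 0) (sym (⊕-string-↾ Q p K)) (h K ≤-refl)
        from : ∃[ w ] w ∈ₒ S × accepted Q w ≢ 0 → _∈ₒ_ {X = X} (point S s) U
        from (w , w∈S , h) =
          let p , px , eq = Equivalence.to (∈S⇔ S s w) w∈S
          in run-sound evaluateX {Q ⊕ p} {U , point S s}
               (δ-⊕ (𝒪 X) X {Q} {p} {U} {point S s} QU px) (len w)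
               (subst (λ v → run evaluateX v ≢ 0)
                 (trans (cong (⊕-string Q) (sym eq)) (⊕-string-↾ Q p (len w))) h)

      acceptedˢ : SemiDec (Baireₛ ⊗ subspace (𝒪 ℕₛ) Traces)
                    (λ (Q , S) → ∃[ w ] w ∈ₒ proj₁ S × accepted Q w ≢ 0)
      acceptedˢ = ∃ˢ (memberℕ em ∘ˢ (fstᵐ ,ᵐ inclusionᵐ {Y = 𝒪 ℕₛ} {P = Traces} ∘ᵐ sndᵐ ∘ᵐ sndᵐ)
        ×ˢ run-⊕ˢ evaluateX ∘ˢ (fstᵐ ,ᵐ fstᵐ ∘ᵐ sndᵐ))

      point∈ˢ : SemiDec (𝒪 X ⊗ subspace (𝒪 ℕₛ) Traces) (λ (U , S) → _∈ₒ_ {X = X} (toPoint S) U)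
      point∈ˢ = by-namesˢ {X = 𝒪 X} {Z = subspace (𝒪 ℕₛ) Traces}
        {R = λ (U , S) → _∈ₒ_ {X = X} (toPoint S) U}
        {S = λ (Q , S) → ∃[ w ] w ∈ₒ proj₁ S × accepted Q w ≢ 0}
        acceptedˢ λ Q U (S , s) QU → point∈⇔ Q U S s QU

      point∈ˢ′ : SemiDec (subspace (𝒪 ℕₛ) Traces ⊗ 𝒪 X) (λ (S , U) → _∈ₒ_ {X = X} (toPoint S) U)
      point∈ˢ′ = _∘ˢ_ {f = λ (S , U) → U , S} point∈ˢ (swapᵐ {X = subspace (𝒪 ℕₛ) Traces} {Y = 𝒪 X})

      nbhdsᵐ : Map (subspace (𝒪 ℕₛ) Traces) (𝒪 (𝒪 X)) (λ S → nbhds X (toPoint S))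
      nbhdsᵐ = ≈ᵐ {X = subspace (𝒪 ℕₛ) Traces} {Y = 𝒪 (𝒪 X)}
        (sectionᵐ em {X = subspace (𝒪 ℕₛ) Traces} {Z = 𝒪 X}
          {R = λ (S , U) → _∈ₒ_ {X = X} (toPoint S) U} point∈ˢ′)
        λ S U → true-iff (Equivalence.to (∈-section em point∈ˢ′ {S} {U}))
                         (Equivalence.from (∈-section em point∈ˢ′ {S} {U}))

      fromᵐ : Map (subspace (𝒪 ℕₛ) Traces) X toPoint
      fromᵐ = realizedBy (relativize (proj₁ (proj₂ admissible)) (Map.realizer nbhdsᵐ)) λ p S pS →
        let P , pP , P𝒰 = Map.realizes nbhdsᵐ p S pS
            q , Pq , x , qx , eq =
              proj₂ (proj₂ admissible) P (nbhds X (toPoint S)) P𝒰 (toPoint S , λ _ → refl)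
        -- The partial inverse yields a name of some point with the same neighbourhoods; injectivity
        -- identifies it with `toPoint S`.
        in q , (λ n → relativize⁺ pP (Pq n)) , X.respects (λ _ → refl) (proj₁ admissible eq) qx

    X≅Traces : X ≅ subspace (𝒪 ℕₛ) Traces
    X≅Traces = bijection , Map.toComputable toᵐ , Map.toComputable fromᵐ

theorem12 : (em : ∀ {ℓ} → ExcludedMiddle ℓ) →
    let open Classical em in
    ∀ {ℓ} (X : RepresentedSpace ℓ) →
    let Condition₁ = Σ (Rel ℕ 0ℓ) λ _≺_ → CE _≺_ × Transitive _≺_ × X ≅ RI _≺_
        Condition₂ = Σ (Pred (OpenSet ℕₛ) 0ℓ) λ A → IsΠ⁰₂ (𝒪 ℕₛ) A × X ≅ subspace (𝒪 ℕₛ) A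
        Condition₃ = Admits X λ X′ → EffectivelyFiberOvert X′ × ComputablyAdmissible X′ × IsΠ⁰₂ Baireₛ (RepresentedSpace.dom X′)
    in (Condition₁ ⇔ Condition₂) × (Condition₂ ⇔ Condition₃)
theorem12 em X = mk⇔
  (λ (_≺_ , ce , _ , X≅RI) → RoundedIdeal _≺_ , RoundedIdeal-Π⁰₂ em ce , X≅RI)
  (λ (A , A-Π⁰₂ , X≅A) →
    let _≺_ , ce , trans , A≅RI = ideal-presentation em {A} A-Π⁰₂
    in _≺_ , ce , (λ {w} {v} {u} → trans {w} {v} {u}) ,
       ≅-trans X (subspace (𝒪 ℕₛ) A) (RI _≺_) X≅A A≅RI)
  , mk⇔
  (λ (A , A-Π⁰₂ , X≅A) → Enumerated.admits em X A-Π⁰₂ X≅A)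
  (λ (ρ , X→X′ , X′→X , overt , admissible , dom-Π⁰₂) →
    let X′ = record { points = RepresentedSpace.points X ; representation = ρ }
        open Fibres em X′ overt admissible dom-Π⁰₂
    in Traces , Traces-Π⁰₂ ,
       ≅-trans X X′ (subspace (𝒪 ℕₛ) Traces)
         (Identity.inverse (RepresentedSpace.points X) , X→X′ , X′→X) X≅Traces)
  where open Classical em
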